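{- Let $p\ge5$ be a prime with Legendre symbol $\left(\frac{ -1}{p}\right)=-1$, and let $\alpha\ge0$, $n\ge0$ be integers. Then for every integer $i$ with $1\le i\le p-1$, $$\overline{S}_3\big(48p^{2\alpha+2}n+6(8i+p)p^{2\alpha+1}\big)\equiv0\pmod{12}.$$
   Context: For $|q|<1$ and a positive integer $k$, write $f_k=\prod_{j\ge1}(1-q^{kj})$. The function $\overline{S}_3(n)$ (number of $3$-Schur overpartitions of $n$) is defined by $\sum_{n\ge0}\overline{S}_3(n)q^n=\prod_{n\ge1}\frac{(1+q^{2n-1})(1-q^{3(2n-1)})}{(1+q^{3(2n-1)})(1-q^{2n-1})}=\frac{f_2^3f_3^2f_{12}}{f_1^2f_4f_6^3}$. -}

module Defs where

open import Data.Nat as ℕ using (ℕ; zero; suc; _%_; _/_)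
open import Data.Integer as ℤ using (ℤ; +_; -_; 0ℤ; 1ℤ)
open import Data.Integer.Divisibility using (_∣_)
open import Data.Product using (∃-syntax)
open import Relation.Nullary using (¬_)

-- Formal power series over ℤ, represented by their coefficient functions.
Series : Set
Series = ℕ → ℤ

sumTo : ℕ → (ℕ → ℤ) → ℤ
sumTo zero    f = f 0
sumTo (suc n) f = sumTo n f ℤ.+ f (suc n)

_⊛_ : Series → Series → Series
(f ⊛ g) n = sumTo n (λ k → f k ℤ.* g (n ℕ.∸ k))

one : Series
one zero    = 1ℤ
one (suc _) = 0ℤ

-- 1 + c q^m  (m ≥ 1), coefficient function
binom : ℤ → ℕ → Series
binom c m zero = 1ℤ
binom c m (suc k) with suc k ℕ.≟ m
... | Relation.Nullary.yes _ = c
... | Relation.Nullary.no  _ = 0ℤ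

-- 1/(1 - q^(suc m')) = Σ_k q^(k (suc m'))
invOneMinus : ℕ → Series
invOneMinus m' k with k % suc m' ℕ.≟ 0
... | Relation.Nullary.yes _ = 1ℤ
... | Relation.Nullary.no  _ = 0ℤ

sgn : ℕ → ℤ
sgn zero    = 1ℤ
sgn (suc j) = - sgn j

-- 1/(1 + q^(suc m')) = Σ_k (-1)^k q^(k (suc m'))
invOnePlus : ℕ → Series
invOnePlus m' k with k % suc m' ℕ.≟ 0
... | Relation.Nullary.yes _ = sgn (k / suc m')
... | Relation.Nullary.no  _ = 0ℤ

factor : ℕ → Series
factor j =
  let m = suc (2 ℕ.* j) in
  ((binom 1ℤ m ⊛ binom (- 1ℤ) (3 ℕ.* m)) ⊛ invOnePlus (3 ℕ.* m ℕ.∸ 1)) ⊛ invOneMinus (m ℕ.∸ 1)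

partialProd : ℕ → Series
partialProd zero    = one
partialProd (suc N) = partialProd N ⊛ factor N

-- Number of 3-Schur overpartitions of n: the coefficient of q^n in
-- ∏_{n≥1} (1+q^{2n-1})(1-q^{3(2n-1)}) / ((1+q^{3(2n-1)})(1-q^{2n-1})).
-- Factors with 2j+1 > n are ≡ 1 mod q^{n+1}, so the partial product
-- over j < n+1 already has the correct coefficient of q^n.
S3bar : ℕ → ℤ
S3bar n = partialProd (suc n) n

QuadRes : ℤ → ℕ → Set
QuadRes a p = ∃[ x ] ((+ p) ∣ (x ℤ.* x ℤ.- a))

-- Legendre symbol (-1 / p) = -1, for an odd prime p:
-- -1 is a quadratic non-residue modulo p.
LegendreMinusOneIsMinusOne : ℕ → Set
LegendreMinusOneIsMinusOne p = ¬ QuadRes (- 1ℤ) p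

{-# OPTIONS --safe #-}
-- Write φ = Σ_{k∈ℤ} q^{k²}, φ⁻ = φ(-q), φ′ = φ(-q²) and S for the generating function.
-- Gauss' product φ(-q) = ∏ (1-qᵏ)/(1+qᵏ), the limit of a finite identity of Shanks' type,
-- gives φ φ⁻ = φ′² and S φ′ φ(q³) = φ φ′(q³).
--
-- Modulo 4, φ = 1 + 2θ turns the last identity into S ≡ 1 + 2 (θ + θ(q³) + ...), which is supported
-- on 0 and on 1, 2, 3 and 6 times squares; the index in question is 6r with r of odd p-adic valuation.
--
-- Modulo 3, f(q³) ≡ f(q)³, hence S φ ≡ φ⁻.  Taking even parts, with r₂(2n) = r₂(n), gives
-- S₂ φ⁻² ≡ φ² for S₂ = Σ S(2n) qⁿ, and extracting exponents divisible by 3 then shows that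
-- S₆ = Σ S(6n) qⁿ satisfies S₆(-q) ≡ S₆(q): the two sides are compared through the 3-dissections
-- φ = φ(q⁹) + q b(q³) and φ′ = φ′(q⁹) - q² b′(q³), by which the parts of φ φ′² and φ′ φ² with exponents
-- divisible by 3 are in the ratio φ′(q⁹) : φ(q⁹).  So 3 ∣ S(6r) for every odd r.

module Submission where

open import Defs
open import Data.Nat using (ℕ; _+_; _*_; _^_; _≤_; _∸_)
open import Data.Nat.Primality using (Prime)
open import Data.Integer using (+_)
open import Data.Integer.Divisibility using (_∣_)

open import Algebra.Bundles using (CommutativeRing)
import Algebra.Solver.Ring
open import Algebra.Solver.Ring.AlmostCommutativeRing using (fromCommutativeRing; _-Raw-AlmostCommutative⟶_)
open import Algebra.Structures using (IsCommutativeRing)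
open import Data.Integer as ℤ using (ℤ; -[1+_]; 0ℤ; 1ℤ)
import Data.Integer.Divisibility.Signed as ∣ℤ
import Data.Integer.Properties as ℤₚ
open import Data.Integer.Solver using () renaming (module +-*-Solver to ℤ-Solver)
open import Data.Maybe using (Maybe) renaming (map to mapMaybe)
open import Data.Nat as ℕ using (zero; suc; _<_; _%_; _/_; z≤n; s≤s)
open import Data.Nat.Divisibility as ∣ₙ using () renaming (_∣_ to _∣ₙ_)
import Data.Nat.DivMod as DM
open import Data.Nat.Primality using (euclidsLemma; prime⇒nonZero; prime⇒irreducible; prime[2])
import Data.Nat.Properties as ℕₚ
open import Data.Nat.Solver using () renaming (module +-*-Solver to ℕ-Solver)
open import Data.Product using (_,_)
open import Data.Sum using ([_,_]; [_,_]′; reduce)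
open import Data.Unit using (⊤; tt)
open import Function using (_∘_; id)
open import Level using (0ℓ)
open import Relation.Binary using (IsEquivalence)
open import Relation.Binary.PropositionalEquality hiding (setoid; [_])
import Relation.Binary.Reasoning.Setoid as SetoidReasoning
open import Relation.Nullary using (¬_; yes; no; contradiction)
open import Relation.Nullary.Decidable using (dec⇒maybe)

open ℤ-Solver using () renaming (solve to solveℤ; _:+_ to _∔_; _:*_ to _∙_; _:=_ to _≐_; :-_ to ∼_; con to ⟪_⟫)
open ℕ-Solver using () renaming (solve to solveℕ; _:+_ to infixl 6 _⊞_; _:*_ to infixl 7 _⊠_; _:=_ to infix 4 _≜_; con to lit)

-- No infinite product is ever formed. Each product identity is proved for finite products modulo
-- q^K; these products are then cancelled as series with constant term 1, and what remains relates
-- theta series only, so letting K grow makes it exact. One such relation does all the work: O⁻ φ =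
-- O⁺ φ′ up to q^N, where O⁺ and O⁻ are the finite products of 1 + q^k and 1 - q^k over odd k.
-- Multiplied by its image under q ↦ -q it gives φ φ⁻ = φ′²; taken at q and at q³ it gives the theta
-- quotient for S.
--
-- The multipliers in the argument modulo 3 have one origin. A series in q^m passes through the
-- extraction of exponents divisible by m, so each equation is first multiplied by such a series,
-- chosen so that the other side becomes computable; modulo 3 a leftover cube is again a series in
-- q³ and can be pulled out. The extractions that result for S₆ and for S₆(-q) are different and
-- neither is evaluated in closed form: only their ratio is needed. The symmetry then gives c ≡ -c
-- for a coefficient c of odd index, hence 3 ∣ c.

∣0 : ∀ {d} → d ∣ℤ.∣ 0ℤ
∣0 = ∣ℤ.∣n⇒∣m*n 0ℤ ∣ℤ.∣-refl

-- The ring of formal power series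

infixl 6 _⊕_
infixl 7 _⊗_
infix 8 ⊖_

-- Opaque, so that unification and the ring solver do not unfold series into coefficients.
opaque
  _⊗_ : Series → Series → Series
  _⊗_ = _⊛_

  _⊕_ : Series → Series → Series
  (f ⊕ g) n = f n ℤ.+ g n

  ⊖_ : Series → Series
  (⊖ f) n = ℤ.- f n

  ⊗-0 : ∀ f g → (f ⊗ g) 0 ≡ f 0 ℤ.* g 0
  ⊗-0 f g = refl

  ⊕-at : ∀ f g n → (f ⊕ g) n ≡ f n ℤ.+ g n
  ⊕-at f g n = refl

  ⊖-at : ∀ f n → (⊖ f) n ≡ ℤ.- f n
  ⊖-at f n = refl

const : ℤ → Series
const c zero    = c
const c (suc _) = 0ℤ

shift : Series → Series
shift f zero    = 0ℤ
shift f (suc n) = f n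

tail : Series → Series
tail f n = f (suc n)

sumTo-cong : ∀ n {f g : ℕ → ℤ} → (∀ k → k ≤ n → f k ≡ g k) → sumTo n f ≡ sumTo n g
sumTo-cong zero    e = e 0 z≤n
sumTo-cong (suc n) e = cong₂ ℤ._+_ (sumTo-cong n (λ k k≤n → e k (ℕₚ.m≤n⇒m≤1+n k≤n))) (e (suc n) ℕₚ.≤-refl)

sumTo-head : ∀ n (f : ℕ → ℤ) → sumTo (suc n) f ≡ f 0 ℤ.+ sumTo n (f ∘ suc)
sumTo-head zero    f = refl
sumTo-head (suc n) f = trans (cong (ℤ._+ f (suc (suc n))) (sumTo-head n f)) (ℤₚ.+-assoc (f 0) _ _)

opaque
  unfolding _⊕_ _⊗_ ⊖_

  -- Splitting f as f 0 + q (tail f) makes the Cauchy product a recursion on the index. The ring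
  -- laws are inductions along it, with `tail f` in place of f, which avoids rearranging double
  -- sums.
  ⊗-suc : ∀ f g n → (f ⊗ g) (suc n) ≡ f 0 ℤ.* g (suc n) ℤ.+ (tail f ⊗ g) n
  ⊗-suc f g n = sumTo-head n (λ k → f k ℤ.* g (suc n ∸ k))

  ⊗-sucʳ : ∀ f g n → (f ⊗ g) (suc n) ≡ (f ⊗ tail g) n ℤ.+ f (suc n) ℤ.* g 0
  ⊗-sucʳ f g n = cong₂ ℤ._+_
    (sumTo-cong n λ k k≤n → cong (λ m → f k ℤ.* g m) (ℕₚ.+-∸-assoc 1 k≤n))
    (cong (λ m → f (suc n) ℤ.* g m) (ℕₚ.n∸n≡0 n))

  ⊗-comm : ∀ n f g → (f ⊗ g) n ≡ (g ⊗ f) n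
  ⊗-comm zero    f g = ℤₚ.*-comm (f 0) (g 0)
  ⊗-comm (suc n) f g = begin
    (f ⊗ g) (suc n)                            ≡⟨ ⊗-suc f g n ⟩
    f 0 ℤ.* g (suc n) ℤ.+ (tail f ⊗ g) n       ≡⟨ ℤₚ.+-comm (f 0 ℤ.* g (suc n)) ((tail f ⊗ g) n) ⟩
    (tail f ⊗ g) n ℤ.+ f 0 ℤ.* g (suc n)       ≡⟨ cong₂ ℤ._+_ (⊗-comm n (tail f) g) (ℤₚ.*-comm (f 0) _) ⟩
    (g ⊗ tail f) n ℤ.+ g (suc n) ℤ.* f 0       ≡⟨ ⊗-sucʳ g f n ⟨
    (g ⊗ f) (suc n)                            ∎
    where open ≡-Reasoning

  ⊗-distribʳ : ∀ n f g h → ((g ⊕ h) ⊗ f) n ≡ (g ⊗ f) n ℤ.+ (h ⊗ f) n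
  ⊗-distribʳ zero    f g h = ℤₚ.*-distribʳ-+ (f 0) (g 0) (h 0)
  ⊗-distribʳ (suc n) f g h
    rewrite ⊗-suc (g ⊕ h) f n | ⊗-suc g f n | ⊗-suc h f n | ⊗-distribʳ n f (tail g) (tail h)
    = solveℤ 5 (λ a b c x y → (a ∔ b) ∙ c ∔ (x ∔ y) ≐ (a ∙ c ∔ x) ∔ (b ∙ c ∔ y)) refl
        (g 0) (h 0) (f (suc n)) ((tail g ⊗ f) n) ((tail h ⊗ f) n)

  const-⊗ : ∀ c f n → (const c ⊗ f) n ≡ c ℤ.* f n
  const-⊗ c f zero    = refl
  const-⊗ c f (suc n) = trans (⊗-suc (const c) f n) (trans (cong₂ ℤ._+_ (refl {x = c ℤ.* f (suc n)}) (zero-⊗ n)) (ℤₚ.+-identityʳ _))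
    where
    zero-⊗ : ∀ n → (tail (const c) ⊗ f) n ≡ 0ℤ
    zero-⊗ zero    = refl
    zero-⊗ (suc n) = trans (⊗-suc (tail (const c)) f n) (trans (ℤₚ.+-identityˡ _) (zero-⊗ n))

  ⊗-congˡ : ∀ n {f g} h → (∀ k → k ≤ n → f k ≡ g k) → (f ⊗ h) n ≡ (g ⊗ h) n
  ⊗-congˡ n h e = sumTo-cong n (λ k k≤n → cong (ℤ._* h (n ∸ k)) (e k k≤n))

  scale-⊗ : ∀ n c f g → ((λ k → c ℤ.* f k) ⊗ g) n ≡ c ℤ.* (f ⊗ g) n
  scale-⊗ zero    c f g = ℤₚ.*-assoc c (f 0) (g 0)
  scale-⊗ (suc n) c f g
    rewrite ⊗-suc (λ k → c ℤ.* f k) g n | ⊗-suc f g n | scale-⊗ n c (tail f) g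
    = solveℤ 4 (λ c a b x → (c ∙ a) ∙ b ∔ c ∙ x ≐ c ∙ (a ∙ b ∔ x)) refl c (f 0) (g (suc n)) ((tail f ⊗ g) n)

  ⊗-assoc : ∀ n f g h → ((f ⊗ g) ⊗ h) n ≡ (f ⊗ (g ⊗ h)) n
  ⊗-assoc zero    f g h = ℤₚ.*-assoc (f 0) (g 0) (h 0)
  ⊗-assoc (suc n) f g h = begin
    ((f ⊗ g) ⊗ h) (suc n)
      ≡⟨ ⊗-suc (f ⊗ g) h n ⟩
    f 0 ℤ.* g 0 ℤ.* h (suc n) ℤ.+ (tail (f ⊗ g) ⊗ h) n
      ≡⟨ cong₂ ℤ._+_ (refl {x = f 0 ℤ.* g 0 ℤ.* h (suc n)}) (trans (⊗-congˡ n h (λ k _ → ⊗-suc f g k)) (⊗-distribʳ n h (λ k → f 0 ℤ.* tail g k) (tail f ⊗ g))) ⟩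
    f 0 ℤ.* g 0 ℤ.* h (suc n) ℤ.+ (((λ k → f 0 ℤ.* tail g k) ⊗ h) n ℤ.+ ((tail f ⊗ g) ⊗ h) n)
      ≡⟨ cong₂ ℤ._+_ (refl {x = f 0 ℤ.* g 0 ℤ.* h (suc n)}) (cong₂ ℤ._+_ (scale-⊗ n (f 0) (tail g) h) (⊗-assoc n (tail f) g h)) ⟩
    f 0 ℤ.* g 0 ℤ.* h (suc n) ℤ.+ (f 0 ℤ.* (tail g ⊗ h) n ℤ.+ (tail f ⊗ (g ⊗ h)) n)
      ≡⟨ solveℤ 5 (λ a b c x y → a ∙ b ∙ c ∔ (a ∙ x ∔ y) ≐ a ∙ (b ∙ c ∔ x) ∔ y) refl (f 0) (g 0) (h (suc n)) ((tail g ⊗ h) n) ((tail f ⊗ (g ⊗ h)) n) ⟩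
    f 0 ℤ.* (g 0 ℤ.* h (suc n) ℤ.+ (tail g ⊗ h) n) ℤ.+ (tail f ⊗ (g ⊗ h)) n
      ≡⟨ cong (λ z → f 0 ℤ.* z ℤ.+ (tail f ⊗ (g ⊗ h)) n) (⊗-suc g h n) ⟨
    f 0 ℤ.* (g ⊗ h) (suc n) ℤ.+ (tail f ⊗ (g ⊗ h)) n
      ≡⟨ ⊗-suc f (g ⊗ h) n ⟨
    (f ⊗ (g ⊗ h)) (suc n) ∎
    where open ≡-Reasoning

-- Congruences on a set of indices

-- The coefficients of f and g at the indices in P agree modulo d; d = 0 gives equality.
record Cong (d : ℤ) (P : ℕ → Set) (f g : Series) : Set where
  constructor mk
  field at : ∀ n → P n → d ∣ℤ.∣ f n ℤ.- g n
open Cong public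

-- Coefficient n of a product involves the coefficients of its factors up to n only, so this is the
-- condition on P under which agreement on P is compatible with multiplication.
DownClosed : (ℕ → Set) → Set
DownClosed P = ∀ {m n} → m ≤ n → P n → P m

∣-sumTo : ∀ {d} n {f g : ℕ → ℤ} → (∀ k → k ≤ n → d ∣ℤ.∣ f k ℤ.- g k) → d ∣ℤ.∣ sumTo n f ℤ.- sumTo n g
∣-sumTo zero            h = h 0 z≤n
∣-sumTo {d} (suc n) {f} {g} h = subst (d ∣ℤ.∣_)
  (solveℤ 4 (λ a b x y → (a ∔ ∼ x) ∔ (b ∔ ∼ y) ≐ (a ∔ b) ∔ ∼ (x ∔ y)) refl (sumTo n f) (f (suc n)) (sumTo n g) (g (suc n)))
  (∣ℤ.∣m∣n⇒∣m+n (∣-sumTo n (λ k k≤n → h k (ℕₚ.m≤n⇒m≤1+n k≤n))) (h (suc n) ℕₚ.≤-refl))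

-- A commutative ring for every modulus and every index set, so that one solver and one style of
-- reasoning serve exact identities, identities below q^K, and congruences.
module Mod (d : ℤ) (P : ℕ → Set) (down : DownClosed P) where

  infix 4 _≈_
  _≈_ : Series → Series → Set
  _≈_ = Cong d P

  ≡⇒≈ : ∀ {f g} → (∀ n → f n ≡ g n) → f ≈ g
  ≡⇒≈ {f} {g} e = mk λ n _ → subst (d ∣ℤ.∣_) (sym (trans (cong (ℤ._- g n) (e n)) (ℤₚ.+-inverseʳ (g n)))) ∣0

  ≈-isEquivalence : IsEquivalence _≈_
  ≈-isEquivalence = record
    { refl  = ≡⇒≈ (λ _ → refl)
    ; sym   = λ {f} {g} e → mk λ n p → subst (d ∣ℤ.∣_) (solveℤ 2 (λ a b → ∼ (a ∔ ∼ b) ≐ b ∔ ∼ a) refl (f n) (g n)) (∣ℤ.∣m⇒∣-m (at e n p))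
    ; trans = λ {f} {g} {h} e e′ → mk λ n p → subst (d ∣ℤ.∣_)
        (solveℤ 3 (λ a b c → (a ∔ ∼ b) ∔ (b ∔ ∼ c) ≐ a ∔ ∼ c) refl (f n) (g n) (h n)) (∣ℤ.∣m∣n⇒∣m+n (at e n p) (at e′ n p))
    }

  opaque
    unfolding _⊕_ _⊗_ ⊖_

    ⊕-cong : ∀ {f f′ g g′} → f ≈ f′ → g ≈ g′ → f ⊕ g ≈ f′ ⊕ g′
    ⊕-cong {f} {f′} {g} {g′} e e′ = mk λ n p → subst (d ∣ℤ.∣_)
      (solveℤ 4 (λ a b x y → (a ∔ ∼ x) ∔ (b ∔ ∼ y) ≐ (a ∔ b) ∔ ∼ (x ∔ y)) refl (f n) (g n) (f′ n) (g′ n))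
      (∣ℤ.∣m∣n⇒∣m+n (at e n p) (at e′ n p))

    ⊖-cong : ∀ {f g} → f ≈ g → ⊖ f ≈ ⊖ g
    ⊖-cong {f} {g} e = mk λ n p → subst (d ∣ℤ.∣_) (solveℤ 2 (λ a b → ∼ (a ∔ ∼ b) ≐ ∼ a ∔ ∼ ∼ b) refl (f n) (g n)) (∣ℤ.∣m⇒∣-m (at e n p))

    ⊗-cong : ∀ {f f′ g g′} → f ≈ f′ → g ≈ g′ → f ⊗ g ≈ f′ ⊗ g′
    ⊗-cong {f} {f′} {g} {g′} e e′ = mk λ n p → ∣-sumTo n λ k k≤n → subst (d ∣ℤ.∣_)
      (solveℤ 4 (λ a b x y → (a ∔ ∼ x) ∙ b ∔ x ∙ (b ∔ ∼ y) ≐ a ∙ b ∔ ∼ (x ∙ y)) refl (f k) (g (n ∸ k)) (f′ k) (g′ (n ∸ k)))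
      (∣ℤ.∣m∣n⇒∣m+n (∣ℤ.∣m⇒∣m*n (g (n ∸ k)) (at e k (down k≤n p))) (∣ℤ.∣n⇒∣m*n (f′ k) (at e′ (n ∸ k) (down (ℕₚ.m∸n≤m n k) p))))

    isCommutativeRing : IsCommutativeRing _≈_ _⊕_ _⊗_ ⊖_ (const 0ℤ) (const 1ℤ)
    isCommutativeRing = record
      { isRing = record
        { +-isAbelianGroup = record
          { isGroup = record
            { isMonoid = record
              { isSemigroup = record
                { isMagma = record { isEquivalence = ≈-isEquivalence ; ∙-cong = ⊕-cong }
                ; assoc = λ f g h → ≡⇒≈ λ n → ℤₚ.+-assoc (f n) (g n) (h n)
                }
              ; identity = (λ f → ≡⇒≈ λ n → identityˡ f n)
                         , (λ f → ≡⇒≈ λ n → trans (ℤₚ.+-comm (f n) (const 0ℤ n)) (identityˡ f n))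
              }
            ; inverse = (λ f → ≡⇒≈ λ n → trans (ℤₚ.+-inverseˡ (f n)) (zero≡ n))
                      , (λ f → ≡⇒≈ λ n → trans (ℤₚ.+-inverseʳ (f n)) (zero≡ n))
            ; ⁻¹-cong = ⊖-cong
            }
          ; comm = λ f g → ≡⇒≈ λ n → ℤₚ.+-comm (f n) (g n)
          }
        ; *-cong = ⊗-cong
        ; *-assoc = λ f g h → ≡⇒≈ λ n → ⊗-assoc n f g h
        ; *-identity = (λ f → ≡⇒≈ λ n → one-⊗ f n)
                     , (λ f → ≡⇒≈ λ n → trans (⊗-comm n f (const 1ℤ)) (one-⊗ f n))
        ; distrib = (λ f g h → ≡⇒≈ λ n → trans (⊗-comm n f (g ⊕ h)) (trans (⊗-distribʳ n f g h) (cong₂ ℤ._+_ (⊗-comm n g f) (⊗-comm n h f))))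
                  , (λ f g h → ≡⇒≈ λ n → ⊗-distribʳ n f g h)
        }
      ; *-comm = λ f g → ≡⇒≈ λ n → ⊗-comm n f g
      }
      where
      zero≡ : ∀ n → 0ℤ ≡ const 0ℤ n
      zero≡ zero    = refl
      zero≡ (suc n) = refl
      identityˡ : ∀ (f : Series) n → const 0ℤ n ℤ.+ f n ≡ f n
      identityˡ f n = trans (cong (ℤ._+ f n) (sym (zero≡ n))) (ℤₚ.+-identityˡ (f n))
      one-⊗ : ∀ (f : Series) n → (const 1ℤ ⊗ f) n ≡ f n
      one-⊗ f n = trans (const-⊗ 1ℤ f n) (ℤₚ.*-identityˡ (f n))

  commutativeRing : CommutativeRing 0ℓ 0ℓ
  commutativeRing = record { isCommutativeRing = isCommutativeRing }

  open CommutativeRing commutativeRing public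
    using (setoid)
    renaming (refl to ≈-refl; sym to ≈-sym; trans to ≈-trans; reflexive to ≈-reflexive)

  private
    opaque
      unfolding _⊕_ ⊖_
      const-+ : ∀ a b n → const (a ℤ.+ b) n ≡ (const a ⊕ const b) n
      const-+ a b zero    = refl
      const-+ a b (suc n) = refl
      const-* : ∀ a b n → const (a ℤ.* b) n ≡ (const a ⊗ const b) n
      const-* a b n = sym (trans (const-⊗ a (const b) n) (lemma n))
        where
        lemma : ∀ n → a ℤ.* const b n ≡ const (a ℤ.* b) n
        lemma zero    = refl
        lemma (suc n) = ℤₚ.*-zeroʳ a
      const-neg : ∀ a n → const (ℤ.- a) n ≡ (⊖ const a) n
      const-neg a zero    = refl
      const-neg a (suc n) = refl

    constants : CommutativeRing.rawRing ℤₚ.+-*-commutativeRing -Raw-AlmostCommutative⟶ fromCommutativeRing commutativeRing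
    constants = record
      { ⟦_⟧    = const
      ; +-homo = λ a b → ≡⇒≈ (const-+ a b)
      ; *-homo = λ a b → ≡⇒≈ (const-* a b)
      ; -‿homo = λ a → ≡⇒≈ (const-neg a)
      ; 0-homo = ≈-refl
      ; 1-homo = ≈-refl
      }

    const-≈? : (a b : ℤ) → Maybe (const a ≈ const b)
    const-≈? a b = mapMaybe (λ e → ≈-reflexive (cong const e)) (dec⇒maybe (a ℤ.≟ b))

  module Solver = Algebra.Solver.Ring (CommutativeRing.rawRing ℤₚ.+-*-commutativeRing)
    (fromCommutativeRing commutativeRing) constants const-≈?
  open Solver public using (_:=_; _:+_; _:*_; :-_; con) renaming (solve to solveR)

  module ≈-Reasoning = SetoidReasoning setoid

everywhere : DownClosed (λ _ → ⊤)
everywhere _ _ = tt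

module Upto (d : ℤ) (K : ℕ) = Mod d (_< K) ℕₚ.≤-<-trans
module Everywhere (d : ℤ) = Mod d (λ _ → ⊤) everywhere
module Exact = Everywhere 0ℤ

weaken : ∀ {d P Q f g} → (∀ {n} → Q n → P n) → Cong d P f g → Cong d Q f g
weaken imp e = mk λ n q → at e n (imp q)

limit : ∀ {d f g} → (∀ K → Cong d (_< K) f g) → Cong d (λ _ → ⊤) f g
limit e = mk λ n _ → at (e (suc n)) n ℕₚ.≤-refl

0∣-⇒≡ : ∀ {a b} → 0ℤ ∣ℤ.∣ a ℤ.- b → a ≡ b
0∣-⇒≡ {a} {b} e = ℤₚ.i-j≡0⇒i≡j a b (∣ℤ.0∣⇒≡0 e)

≈⇒≡ : ∀ {f g} → Cong 0ℤ (λ _ → ⊤) f g → ∀ n → f n ≡ g n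
≈⇒≡ e n = 0∣-⇒≡ (at e n tt)

limit-≡ : ∀ {f g} → (∀ K → Cong 0ℤ (_< K) f g) → ∀ n → f n ≡ g n
limit-≡ e = ≈⇒≡ (limit e)

below-0 : ∀ {d f g} → Cong d (_< 0) f g
below-0 = mk λ n ()

shift-cong : ∀ {d K f g} → Cong d (_< K) f g → Cong d (_< suc K) (shift f) (shift g)
shift-cong e = mk λ { zero _ → ∣0 ; (suc n) (s≤s n<K) → at e n n<K }

-- The operators U, V and q ↦ -q

shifts : ℕ → Series → Series
shifts zero    f = f
shifts (suc m) f = shift (shifts m f)

mono : ℕ → Series
mono m = shifts m (const 1ℤ)

shifts-cong : ∀ m {d K f g} → Cong d (_< K) f g → Cong d (_< m + K) (shifts m f) (shifts m g)
shifts-cong zero    e = e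
shifts-cong (suc m) e = shift-cong (shifts-cong m e)

-- A positive power of q gains at least one place of precision. One is all that the inductions on K
-- use, whatever the power.
shifts-cong⁺ : ∀ m {d K f g} → Cong d (_< K) f g → Cong d (_< suc K) (shifts (suc m) f) (shifts (suc m) g)
shifts-cong⁺ m {K = K} e = weaken (λ n<1+K → ℕₚ.<-≤-trans n<1+K (s≤s (ℕₚ.m≤n+m K m))) (shifts-cong (suc m) e)

shift-⊗ : ∀ f g n → (shift f ⊗ g) n ≡ shift (f ⊗ g) n
shift-⊗ f g zero    = ⊗-0 (shift f) g
shift-⊗ f g (suc n) = trans (⊗-suc (shift f) g n) (ℤₚ.+-identityˡ ((f ⊗ g) n))

shift-≗ : ∀ {f g} → (∀ n → f n ≡ g n) → ∀ n → shift f n ≡ shift g n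
shift-≗ e zero    = refl
shift-≗ e (suc n) = e n

shifts-≗ : ∀ m {f g} → (∀ n → f n ≡ g n) → ∀ n → shifts m f n ≡ shifts m g n
shifts-≗ zero    e = e
shifts-≗ (suc m) e = shift-≗ (shifts-≗ m e)

shifts-⊗ : ∀ m f g n → (shifts m f ⊗ g) n ≡ shifts m (f ⊗ g) n
shifts-⊗ zero    f g n = refl
shifts-⊗ (suc m) f g n = trans (shift-⊗ (shifts m f) g n) (shift-≗ (shifts-⊗ m f g) n)

mono-⊗ : ∀ m f n → (mono m ⊗ f) n ≡ shifts m f n
mono-⊗ m f n = trans (shifts-⊗ m (const 1ℤ) f n) (shifts-≗ m (λ k → trans (const-⊗ 1ℤ f k) (ℤₚ.*-identityˡ (f k))) n)

shifts-+ : ∀ m k f → shifts (m + k) f ≡ shifts m (shifts k f)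
shifts-+ zero    k f = refl
shifts-+ (suc m) k f = cong shift (shifts-+ m k f)

mono-+ : ∀ m k n → mono (m + k) n ≡ (mono m ⊗ mono k) n
mono-+ m k n = trans (cong-app (shifts-+ m k (const 1ℤ)) n) (sym (mono-⊗ m (mono k) n))

shifts-skip : ∀ m f n → shifts m f (m + n) ≡ f n
shifts-skip zero    f n = refl
shifts-skip (suc m) f n = shifts-skip m f n

opaque
  unfolding _⊕_ _⊗_

  head-tail : ∀ f n → f n ≡ (const (f 0) ⊕ shift (tail f)) n
  head-tail f zero    = sym (ℤₚ.+-identityʳ (f 0))
  head-tail f (suc n) = sym (ℤₚ.+-identityˡ (f (suc n)))

  ⊗-head-tail : ∀ f g n → (f ⊗ g) n ≡ (const (f 0) ⊗ g ⊕ shift (tail f ⊗ g)) n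
  ⊗-head-tail f g zero    = sym (ℤₚ.+-identityʳ _)
  ⊗-head-tail f g (suc n) = trans (⊗-suc f g n) (cong (ℤ._+ (tail f ⊗ g) n) (sym (const-⊗ (f 0) g (suc n))))

-- A constant term 1 is invertible for every modulus, composite ones included, and on every
-- truncation. For the difference h of the two series, divisibility of h ⊗ z gives that of h 0;
-- subtracting the term h 0 z (k+1) leaves `tail h` ⊗ z, and the induction goes on.
cancel : ∀ {d P} → DownClosed P → ∀ {f g} z → z 0 ≡ 1ℤ → Cong d P (f ⊗ z) (g ⊗ z) → Cong d P f g
cancel {d} {P} down {f} {g} z z0 e = mk λ n p →
  subst (d ∣ℤ.∣_) (trans (⊕-at f (⊖ g) n) (cong₂ ℤ._+_ (refl {x = f n}) (⊖-at g n))) (go n (f ⊕ ⊖ g) λ k k≤n → subst (d ∣ℤ.∣_) (sym (difference k)) (at e k (down k≤n p)))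
  where
  difference : ∀ k → ((f ⊕ ⊖ g) ⊗ z) k ≡ (f ⊗ z) k ℤ.- (g ⊗ z) k
  difference k = trans (≈⇒≡ (Exact.solveR 3 (λ f g z → (f :+ :- g) :* z := f :* z :+ :- (g :* z)) Exact.≈-refl f g z) k)
      (trans (⊕-at (f ⊗ z) (⊖ (g ⊗ z)) k) (cong₂ ℤ._+_ (refl {x = (f ⊗ z) k}) (⊖-at (g ⊗ z) k)))
    where open Exact
  go : ∀ n h → (∀ k → k ≤ n → d ∣ℤ.∣ (h ⊗ z) k) → d ∣ℤ.∣ h n
  go zero    h e = subst (d ∣ℤ.∣_) (trans (⊗-0 h z) (trans (cong (h 0 ℤ.*_) z0) (ℤₚ.*-identityʳ (h 0)))) (e 0 z≤n)
  go (suc n) h e = go n (tail h) λ k k≤n → ∣ℤ.∣m+n∣m⇒∣n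
    (subst (d ∣ℤ.∣_) (⊗-suc h z k) (e (suc k) (s≤s k≤n)))
    (∣ℤ.∣m⇒∣m*n (z (suc k)) (go zero h (λ k k≤0 → e k (ℕₚ.≤-trans k≤0 z≤n))))

-- spread m j f is q^j f(q^(m+1)); so V m and U m below are the classical V_{m+1} and U_{m+1}.
spread : ℕ → ℕ → Series → Series
spread m zero    f zero    = f 0
spread m zero    f (suc n) = spread m m (tail f) n
spread m (suc j) f zero    = 0ℤ
spread m (suc j) f (suc n) = spread m j f n

V : ℕ → Series → Series
V m = spread m 0

U : ℕ → Series → Series
U m f n = f (n * suc m)

σ : Series → Series
σ f n = sgn n ℤ.* f n

-- Each coefficient of a spread series is 0 or a coefficient of the argument of no larger index.
-- Stated for a relation, this covers both equality and congruence.
spread-rel : ∀ (R : ℤ → ℤ → Set) → R 0ℤ 0ℤ → ∀ m j {f g} n → (∀ k → k ≤ n → R (f k) (g k)) → R (spread m j f n) (spread m j g n)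
spread-rel R r0 m zero    zero    e = e 0 z≤n
spread-rel R r0 m zero    (suc n) e = spread-rel R r0 m m n (λ k k≤n → e (suc k) (s≤s k≤n))
spread-rel R r0 m (suc j) zero    e = r0
spread-rel R r0 m (suc j) (suc n) e = spread-rel R r0 m j n (λ k k≤n → e k (ℕₚ.m≤n⇒m≤1+n k≤n))

V-cong : ∀ m {d P f g} → DownClosed P → Cong d P f g → Cong d P (V m f) (V m g)
V-cong m {d} down e = mk λ n p →
  spread-rel (λ a b → d ∣ℤ.∣ a ℤ.- b) ∣0 m 0 n (λ k k≤n → at e k (down k≤n p))

V-≗ : ∀ m {f g} → (∀ n → f n ≡ g n) → ∀ n → V m f n ≡ V m g n
V-≗ m e n = spread-rel _≡_ refl m 0 n (λ k _ → e k)

spread-shifts : ∀ m j f n → spread m j f n ≡ shifts j (V m f) n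
spread-shifts m zero    f n       = refl
spread-shifts m (suc j) f zero    = refl
spread-shifts m (suc j) f (suc n) = spread-shifts m j f n

opaque
  unfolding _⊕_

  spread-⊕ : ∀ m j f g n → spread m j (f ⊕ g) n ≡ (spread m j f ⊕ spread m j g) n
  spread-⊕ m zero    f g zero    = refl
  spread-⊕ m zero    f g (suc n) = spread-⊕ m m (tail f) (tail g) n
  spread-⊕ m (suc j) f g zero    = refl
  spread-⊕ m (suc j) f g (suc n) = spread-⊕ m j f g n

V-⊕ : ∀ m f g n → V m (f ⊕ g) n ≡ (V m f ⊕ V m g) n
V-⊕ m = spread-⊕ m 0

spread-scale : ∀ m j c f n → spread m j (const c ⊗ f) n ≡ c ℤ.* spread m j f n
spread-scale m j c f n = trans (spread-rel _≡_ refl m j n (λ k _ → const-⊗ c f k)) (go j f n)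
  where
  go : ∀ j f n → spread m j (λ k → c ℤ.* f k) n ≡ c ℤ.* spread m j f n
  go zero    f zero    = refl
  go zero    f (suc n) = go m (tail f) n
  go (suc j) f zero    = sym (ℤₚ.*-zeroʳ c)
  go (suc j) f (suc n) = go j f n

V-scale : ∀ m c f n → V m (const c ⊗ f) n ≡ (const c ⊗ V m f) n
V-scale m c f n = trans (spread-scale m 0 c f n) (sym (const-⊗ c (V m f) n))

V-shift : ∀ m f n → V m (shift f) n ≡ shifts (suc m) (V m f) n
V-shift m f zero    = refl
V-shift m f (suc n) = spread-shifts m m f n

opaque
  unfolding _⊕_

  V-unfold : ∀ m f n → V m f n ≡ (const (f 0) ⊕ shifts (suc m) (V m (tail f))) n
  V-unfold m f zero    = sym (ℤₚ.+-identityʳ (f 0))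
  V-unfold m f (suc n) = trans (spread-shifts m m (tail f) n) (sym (ℤₚ.+-identityˡ _))

V-const : ∀ m c n → V m (const c) n ≡ const c n
V-const m c zero    = refl
V-const m c (suc n) = go m n
  where
  go : ∀ j n → spread m j (tail (const c)) n ≡ 0ℤ
  go zero    zero    = refl
  go zero    (suc n) = go m n
  go (suc j) zero    = refl
  go (suc j) (suc n) = go j n

V-shifts : ∀ m k f n → V m (shifts k f) n ≡ shifts (k * suc m) (V m f) n
V-shifts m zero    f n = refl
V-shifts m (suc k) f n = begin
  V m (shift (shifts k f)) n                   ≡⟨ V-shift m (shifts k f) n ⟩
  shifts (suc m) (V m (shifts k f)) n          ≡⟨ shifts-≗ (suc m) (V-shifts m k f) n ⟩
  shifts (suc m) (shifts (k * suc m) (V m f)) n ≡⟨ cong-app (shifts-+ (suc m) (k * suc m) (V m f)) n ⟨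
  shifts (suc k * suc m) (V m f) n             ∎
  where open ≡-Reasoning

V-mono : ∀ m k n → V m (mono k) n ≡ mono (k * suc m) n
V-mono m k n = trans (V-shifts m k (const 1ℤ) n) (shifts-≗ (k * suc m) (V-const m 1ℤ) n)

-- Induction on the precision, peeling the constant term of f: the rest of f enters with the factor
-- q^(m+1), so precision K for `tail f` gives precision K + 1 for f.
V-⊗ : ∀ m f g n → V m (f ⊗ g) n ≡ (V m f ⊗ V m g) n
V-⊗ m f g = limit-≡ (λ K → go K f)
  where
  go : ∀ K f → Cong 0ℤ (_< K) (V m (f ⊗ g)) (V m f ⊗ V m g)
  go zero    f = below-0
  go (suc K) f = begin
    V m (f ⊗ g)
      ≈⟨ ≡⇒≈ (λ n → trans (V-≗ m (⊗-head-tail f g) n) (V-⊕ m (const (f 0) ⊗ g) (shift (tail f ⊗ g)) n)) ⟩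
    V m (const (f 0) ⊗ g) ⊕ V m (shift (tail f ⊗ g))
      ≈⟨ ⊕-cong (≡⇒≈ (V-scale m (f 0) g)) (≡⇒≈ (V-shift m (tail f ⊗ g))) ⟩
    const (f 0) ⊗ V m g ⊕ shifts (suc m) (V m (tail f ⊗ g))
      ≈⟨ ⊕-cong ≈-refl (shifts-cong⁺ m (go K (tail f))) ⟩
    const (f 0) ⊗ V m g ⊕ shifts (suc m) (V m (tail f) ⊗ V m g)
      ≈⟨ ⊕-cong ≈-refl (≡⇒≈ (shifts-⊗ (suc m) (V m (tail f)) (V m g))) ⟨
    const (f 0) ⊗ V m g ⊕ shifts (suc m) (V m (tail f)) ⊗ V m g
      ≈⟨ solveR 3 (λ a b c → a :* c :+ b :* c := (a :+ b) :* c) ≈-refl (const (f 0)) (shifts (suc m) (V m (tail f))) (V m g) ⟩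
    (const (f 0) ⊕ shifts (suc m) (V m (tail f))) ⊗ V m g
      ≈⟨ ⊗-cong (≡⇒≈ (V-unfold m f)) ≈-refl ⟨
    V m f ⊗ V m g ∎
    where
    open Upto 0ℤ (suc K)
    open ≈-Reasoning

U-shifts : ∀ m f n → U m (shifts (suc m) f) n ≡ shift (U m f) n
U-shifts m f zero    = refl
U-shifts m f (suc n) = shifts-skip m f (n * suc m)

opaque
  unfolding _⊕_ _⊗_

  U-scale : ∀ m c f n → U m (const c ⊗ f) n ≡ (const c ⊗ U m f) n
  U-scale m c f n = trans (const-⊗ c f (n * suc m)) (sym (const-⊗ c (U m f) n))

U-⊕ : ∀ m f g n → U m (f ⊕ g) n ≡ (U m f ⊕ U m g) n
U-⊕ m f g n = trans (⊕-at f g (n * suc m)) (sym (⊕-at (U m f) (U m g) n))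

-- The projection formula: multiplication by a series in q^(m+1) commutes with extracting the
-- exponents divisible by m+1. Every later extraction rests on it. The proof peels the constant term
-- of g.
U-⊗-V : ∀ m f g n → U m (f ⊗ V m g) n ≡ (U m f ⊗ g) n
U-⊗-V m f g = limit-≡ (λ K → go K g)
  where
  go : ∀ K g → Cong 0ℤ (_< K) (U m (f ⊗ V m g)) (U m f ⊗ g)
  go zero    g = below-0
  go (suc K) g = begin
    U m (f ⊗ V m g)
      ≈⟨ ≡⇒≈ (λ n → trans (≈⇒≡ expand (n * suc m)) (U-⊕ m (const (g 0) ⊗ f) (shifts (suc m) (f ⊗ V m (tail g))) n)) ⟩
    U m (const (g 0) ⊗ f) ⊕ U m (shifts (suc m) (f ⊗ V m (tail g)))
      ≈⟨ ⊕-cong (≡⇒≈ (U-scale m (g 0) f)) (≡⇒≈ (U-shifts m (f ⊗ V m (tail g)))) ⟩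
    const (g 0) ⊗ U m f ⊕ shift (U m (f ⊗ V m (tail g)))
      ≈⟨ ⊕-cong ≈-refl (shift-cong (go K (tail g))) ⟩
    const (g 0) ⊗ U m f ⊕ shift (U m f ⊗ tail g)
      ≈⟨ ⊕-cong ≈-refl (≡⇒≈ (shift-≗ (λ n → ⊗-comm n (U m f) (tail g)))) ⟩
    const (g 0) ⊗ U m f ⊕ shift (tail g ⊗ U m f)
      ≈⟨ ≡⇒≈ (⊗-head-tail g (U m f)) ⟨
    g ⊗ U m f
      ≈⟨ ≡⇒≈ (λ n → ⊗-comm n g (U m f)) ⟩
    U m f ⊗ g ∎
    where
    open Upto 0ℤ (suc K)
    open ≈-Reasoning
    expand : Cong 0ℤ (λ _ → ⊤) (f ⊗ V m g) (const (g 0) ⊗ f ⊕ shifts (suc m) (f ⊗ V m (tail g)))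
    expand = E.≈-trans (E.⊗-cong E.≈-refl (E.≡⇒≈ (V-unfold m g)))
      (E.≈-trans (E.solveR 3 (λ f c s → f E.:* (c E.:+ s) E.:= c E.:* f E.:+ s E.:* f) E.≈-refl f (const (g 0)) (shifts (suc m) (V m (tail g))))
      (E.⊕-cong E.≈-refl (E.≡⇒≈ λ n → trans (shifts-⊗ (suc m) (V m (tail g)) f n) (shifts-≗ (suc m) (λ k → ⊗-comm k (V m (tail g)) f) n))))
      where module E = Exact

U-V : ∀ m f n → U m (V m f) n ≡ f n
U-V m f zero    = refl
U-V m f (suc n) = trans (spread-shifts m m (tail f) (m + n * suc m)) (trans (shifts-skip m (V m (tail f)) (n * suc m)) (U-V m (tail f) n))

tail-σ : ∀ f n → tail (σ f) n ≡ (ℤ.- 1ℤ) ℤ.* σ (tail f) n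
tail-σ f n = trans (sym (ℤₚ.neg-distribˡ-* (sgn n) (f (suc n)))) (sym (ℤₚ.-1*i≡-i _))

opaque
  unfolding _⊕_ _⊗_

  σ-⊗ : ∀ n f g → σ (f ⊗ g) n ≡ (σ f ⊗ σ g) n
  σ-⊗ zero    f g = trans (ℤₚ.*-identityˡ (f 0 ℤ.* g 0)) (cong₂ ℤ._*_ (sym (ℤₚ.*-identityˡ (f 0))) (sym (ℤₚ.*-identityˡ (g 0))))
  σ-⊗ (suc n) f g = begin
    sgn (suc n) ℤ.* (f ⊗ g) (suc n)
      ≡⟨ cong (sgn (suc n) ℤ.*_) (⊗-suc f g n) ⟩
    (ℤ.- sgn n) ℤ.* (f 0 ℤ.* g (suc n) ℤ.+ (tail f ⊗ g) n)
      ≡⟨ solveℤ 4 (λ s a b x → ∼ s ∙ (a ∙ b ∔ x) ≐ a ∙ (∼ s ∙ b) ∔ ∼ (s ∙ x)) refl (sgn n) (f 0) (g (suc n)) ((tail f ⊗ g) n) ⟩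
    f 0 ℤ.* σ g (suc n) ℤ.+ ℤ.- σ (tail f ⊗ g) n
      ≡⟨ cong₂ ℤ._+_ (cong (ℤ._* σ g (suc n)) (sym (ℤₚ.*-identityˡ (f 0)))) (sym rest) ⟩
    σ f 0 ℤ.* σ g (suc n) ℤ.+ (tail (σ f) ⊗ σ g) n
      ≡⟨ ⊗-suc (σ f) (σ g) n ⟨
    (σ f ⊗ σ g) (suc n) ∎
    where
    open ≡-Reasoning
    rest : (tail (σ f) ⊗ σ g) n ≡ ℤ.- σ (tail f ⊗ g) n
    rest = begin
      (tail (σ f) ⊗ σ g) n                               ≡⟨ ⊗-congˡ n (σ g) (λ k _ → tail-σ f k) ⟩
      ((λ k → (ℤ.- 1ℤ) ℤ.* σ (tail f) k) ⊗ σ g) n        ≡⟨ scale-⊗ n (ℤ.- 1ℤ) (σ (tail f)) (σ g) ⟩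
      (ℤ.- 1ℤ) ℤ.* (σ (tail f) ⊗ σ g) n                  ≡⟨ ℤₚ.-1*i≡-i _ ⟩
      ℤ.- (σ (tail f) ⊗ σ g) n                           ≡⟨ cong ℤ.-_ (σ-⊗ n (tail f) g) ⟨
      ℤ.- σ (tail f ⊗ g) n                               ∎

  σ-⊕ : ∀ f g n → σ (f ⊕ g) n ≡ (σ f ⊕ σ g) n
  σ-⊕ f g n = ℤₚ.*-distribˡ-+ (sgn n) (f n) (g n)

σ-cong : ∀ {d P f g} → Cong d P f g → Cong d P (σ f) (σ g)
σ-cong {d} {f = f} {g} e = mk λ n p → subst (d ∣ℤ.∣_)
  (solveℤ 3 (λ s a b → s ∙ (a ∔ ∼ b) ≐ s ∙ a ∔ ∼ (s ∙ b)) refl (sgn n) (f n) (g n)) (∣ℤ.∣n⇒∣m*n (sgn n) (at e n p))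

σ-const : ∀ c n → σ (const c) n ≡ const c n
σ-const c zero    = ℤₚ.*-identityˡ c
σ-const c (suc n) = ℤₚ.*-zeroʳ (sgn (suc n))

sgn-+ : ∀ m n → sgn (m + n) ≡ sgn m ℤ.* sgn n
sgn-+ zero    n = sym (ℤₚ.*-identityˡ (sgn n))
sgn-+ (suc m) n = trans (cong ℤ.-_ (sgn-+ m n)) (ℤₚ.neg-distribˡ-* (sgn m) (sgn n))

sgn-sgn : ∀ n → sgn n ℤ.* sgn n ≡ 1ℤ
sgn-sgn zero    = refl
sgn-sgn (suc n) = trans (solveℤ 1 (λ s → ∼ s ∙ ∼ s ≐ s ∙ s) refl (sgn n)) (sgn-sgn n)

sgn-*2 : ∀ n → sgn (n * 2) ≡ 1ℤ
sgn-*2 zero    = refl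
sgn-*2 (suc n) = trans (ℤₚ.neg-involutive (sgn (n * 2))) (sgn-*2 n)

σ-σ : ∀ f n → σ (σ f) n ≡ f n
σ-σ f n = trans (sym (ℤₚ.*-assoc (sgn n) (sgn n) (f n))) (trans (cong (ℤ._* f n) (sgn-sgn n)) (ℤₚ.*-identityˡ (f n)))

U₂-σ : ∀ f n → U 1 (σ f) n ≡ U 1 f n
U₂-σ f n = trans (cong (ℤ._* f (n * 2)) (sgn-*2 n)) (ℤₚ.*-identityˡ (f (n * 2)))

σ-V₂ : ∀ f n → σ (V 1 f) n ≡ V 1 f n
σ-V₂ f zero          = ℤₚ.*-identityˡ (f 0)
σ-V₂ f (suc zero)    = refl
σ-V₂ f (suc (suc n)) = trans (cong (ℤ._* V 1 (tail f) n) (ℤₚ.neg-involutive (sgn n))) (σ-V₂ (tail f) n)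

sgn-*3 : ∀ n → sgn (n * 3) ≡ sgn n
sgn-*3 zero    = refl
sgn-*3 (suc n) = cong ℤ.-_ (trans (ℤₚ.neg-involutive (sgn (n * 3))) (sgn-*3 n))

U₃-σ : ∀ f n → U 2 (σ f) n ≡ σ (U 2 f) n
U₃-σ f n = cong (ℤ._* f (n * 3)) (sgn-*3 n)

σ-V₃ : ∀ f n → σ (V 2 f) n ≡ V 2 (σ f) n
σ-V₃ f zero                = refl
σ-V₃ f (suc zero)          = refl
σ-V₃ f (suc (suc zero))    = refl
σ-V₃ f (suc (suc (suc n))) = begin
  sgn (3 + n) ℤ.* V 2 (tail f) n          ≡⟨ solveℤ 2 (λ s x → (∼ ∼ ∼ s) ∙ x ≐ ∼ (s ∙ x)) refl (sgn n) (V 2 (tail f) n) ⟩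
  ℤ.- σ (V 2 (tail f)) n                  ≡⟨ cong ℤ.-_ (σ-V₃ (tail f) n) ⟩
  ℤ.- V 2 (σ (tail f)) n                  ≡⟨ ℤₚ.-1*i≡-i _ ⟨
  (ℤ.- 1ℤ) ℤ.* V 2 (σ (tail f)) n         ≡⟨ spread-scale 2 0 (ℤ.- 1ℤ) (σ (tail f)) n ⟨
  V 2 (const (ℤ.- 1ℤ) ⊗ σ (tail f)) n     ≡⟨ V-≗ 2 (λ k → trans (const-⊗ (ℤ.- 1ℤ) (σ (tail f)) k) (sym (tail-σ f k))) n ⟩
  V 2 (tail (σ f)) n                      ∎
  where open ≡-Reasoning

-- Both sides consume one coefficient of f every six indices, so six cases hold by computation and
-- the remaining indices recur with `tail f`.
V₂-V₃ : ∀ f n → V 1 (V 2 f) n ≡ V 2 (V 1 f) n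
V₂-V₃ f 0 = refl
V₂-V₃ f 1 = refl
V₂-V₃ f 2 = refl
V₂-V₃ f 3 = refl
V₂-V₃ f 4 = refl
V₂-V₃ f 5 = refl
V₂-V₃ f (suc (suc (suc (suc (suc (suc n)))))) = V₂-V₃ (tail f) n

σ-mono : ∀ m n → σ (mono m) n ≡ (const (sgn m) ⊗ mono m) n
σ-mono zero    n = trans (σ-const 1ℤ n) (sym (trans (const-⊗ 1ℤ (const 1ℤ) n) (ℤₚ.*-identityˡ (const 1ℤ n))))
σ-mono (suc m) zero    = sym (trans (const-⊗ (sgn (suc m)) (mono (suc m)) 0) (ℤₚ.*-zeroʳ (sgn (suc m))))
σ-mono (suc m) (suc n) = begin
  (ℤ.- sgn n) ℤ.* mono m n     ≡⟨ ℤₚ.neg-distribˡ-* (sgn n) (mono m n) ⟨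
  ℤ.- σ (mono m) n             ≡⟨ cong ℤ.-_ (trans (σ-mono m n) (const-⊗ (sgn m) (mono m) n)) ⟩
  ℤ.- (sgn m ℤ.* mono m n)     ≡⟨ ℤₚ.neg-distribˡ-* (sgn m) (mono m n) ⟩
  sgn (suc m) ℤ.* mono m n     ≡⟨ const-⊗ (sgn (suc m)) (mono (suc m)) (suc n) ⟨
  (const (sgn (suc m)) ⊗ mono (suc m)) (suc n) ∎
  where open ≡-Reasoning

-- The Frobenius congruence modulo 3

cube≡self-ℕ : ∀ n → + 3 ∣ℤ.∣ + n ℤ.* + n ℤ.* + n ℤ.- + n
cube≡self-ℕ zero    = ∣0
cube≡self-ℕ (suc n) = subst (+ 3 ∣ℤ.∣_)
  (solveℤ 1 (λ a → (a ∙ a ∙ a ∔ ∼ a) ∔ ⟪ + 3 ⟫ ∙ (a ∙ a ∔ a) ≐ (⟪ 1ℤ ⟫ ∔ a) ∙ (⟪ 1ℤ ⟫ ∔ a) ∙ (⟪ 1ℤ ⟫ ∔ a) ∔ ∼ (⟪ 1ℤ ⟫ ∔ a)) refl (+ n))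
  (∣ℤ.∣m∣n⇒∣m+n (cube≡self-ℕ n) (∣ℤ.∣m⇒∣m*n {+ 3} {+ 3} _ ∣ℤ.∣-refl))

cube≡self : ∀ a → + 3 ∣ℤ.∣ a ℤ.* a ℤ.* a ℤ.- a
cube≡self (+ n)    = cube≡self-ℕ n
cube≡self -[1+ n ] = subst (+ 3 ∣ℤ.∣_)
  (solveℤ 1 (λ a → ∼ (a ∙ a ∙ a ∔ ∼ a) ≐ (∼ a) ∙ (∼ a) ∙ (∼ a) ∔ ∼ ∼ a) refl (+ (suc n)))
  (∣ℤ.∣m⇒∣-m (cube≡self-ℕ (suc n)))

const-cong : ∀ {d P a b} → d ∣ℤ.∣ a ℤ.- b → Cong d P (const a) (const b)
const-cong e = mk λ { zero _ → e ; (suc n) _ → ∣0 }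

const≈0 : ∀ {d P} → Cong d P (const d) (const 0ℤ)
const≈0 {d} = const-cong (subst (d ∣ℤ.∣_) (sym (ℤₚ.+-identityʳ d)) ∣ℤ.∣-refl)

const-⊗-const : ∀ a b n → (const a ⊗ const b) n ≡ const (a ℤ.* b) n
const-⊗-const a b zero    = const-⊗ a (const b) 0
const-⊗-const a b (suc n) = trans (const-⊗ a (const b) (suc n)) (ℤₚ.*-zeroʳ a)

mono-small : ∀ m n → n < m → mono m n ≡ 0ℤ
mono-small (suc m) zero    _         = refl
mono-small (suc m) (suc n) (s≤s n<m) = mono-small m n n<m

const-0 : ∀ n → const 0ℤ n ≡ 0ℤ
const-0 zero    = refl
const-0 (suc n) = refl

mono≈0 : ∀ {d K} m → K ≤ m → Cong d (_< K) (mono m) (const 0ℤ)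
mono≈0 {d} m K≤m = mk λ n n<K → subst (d ∣ℤ.∣_)
  (sym (cong₂ ℤ._-_ (mono-small m n (ℕₚ.≤-trans n<K K≤m)) (const-0 n))) ∣0

-- In the cube of c + q g the mixed terms are multiples of 3, c³ ≡ c by Fermat, and q³ g³ is the
-- same claim for the tail, known to smaller precision.
frobenius : ∀ f → Cong (+ 3) (λ _ → ⊤) (f ⊗ f ⊗ f) (V 2 f)
frobenius f = limit (λ K → go K f)
  where
  go : ∀ K f → Cong (+ 3) (_< K) (f ⊗ f ⊗ f) (V 2 f)
  go zero    f = below-0
  go (suc K) f = begin
    f ⊗ f ⊗ f
      ≈⟨ ⊗-cong (⊗-cong split split) split ⟩
    (c ⊕ x ⊗ g) ⊗ (c ⊕ x ⊗ g) ⊗ (c ⊕ x ⊗ g)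
      ≈⟨ solveR 3 (λ c x g → (c :+ x :* g) :* (c :+ x :* g) :* (c :+ x :* g)
           := con (+ 3) :* (c :* c :* x :* g :+ c :* x :* g :* x :* g) :+ (c :* c :* c :+ x :* (x :* (x :* (g :* g :* g))))) ≈-refl c x g ⟩
    const (+ 3) ⊗ (c ⊗ c ⊗ x ⊗ g ⊕ c ⊗ x ⊗ g ⊗ x ⊗ g) ⊕ (c ⊗ c ⊗ c ⊕ x ⊗ (x ⊗ (x ⊗ (g ⊗ g ⊗ g))))
      ≈⟨ ⊕-cong (⊗-cong const≈0 ≈-refl) (⊕-cong cube shift³) ⟩
    const 0ℤ ⊗ (c ⊗ c ⊗ x ⊗ g ⊕ c ⊗ x ⊗ g ⊗ x ⊗ g) ⊕ (c ⊕ shifts 3 (g ⊗ g ⊗ g))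
      ≈⟨ solveR 3 (λ a b c → con 0ℤ :* a :+ (b :+ c) := b :+ c) ≈-refl (c ⊗ c ⊗ x ⊗ g ⊕ c ⊗ x ⊗ g ⊗ x ⊗ g) c (shifts 3 (g ⊗ g ⊗ g)) ⟩
    c ⊕ shifts 3 (g ⊗ g ⊗ g)
      ≈⟨ ⊕-cong ≈-refl (shifts-cong⁺ 2 (go K g)) ⟩
    c ⊕ shifts 3 (V 2 g)
      ≈⟨ ≡⇒≈ (V-unfold 2 f) ⟨
    V 2 f ∎
    where
    open Upto (+ 3) (suc K)
    open ≈-Reasoning
    c x g : Series
    c = const (f 0)
    x = mono 1
    g = tail f
    split : f ≈ c ⊕ x ⊗ g
    split = ≈-trans (≡⇒≈ (head-tail f)) (⊕-cong ≈-refl (≈-sym (≡⇒≈ (mono-⊗ 1 g))))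
    cube : c ⊗ c ⊗ c ≈ c
    cube = ≈-trans (≈-trans (⊗-cong (≡⇒≈ (const-⊗-const (f 0) (f 0))) ≈-refl) (≡⇒≈ (const-⊗-const (f 0 ℤ.* f 0) (f 0))))
      (const-cong (cube≡self (f 0)))
    shift³ : x ⊗ (x ⊗ (x ⊗ (g ⊗ g ⊗ g))) ≈ shifts 3 (g ⊗ g ⊗ g)
    shift³ = ≈-trans (⊗-cong ≈-refl (⊗-cong ≈-refl (≡⇒≈ (mono-⊗ 1 h))))
      (≈-trans (⊗-cong ≈-refl (≡⇒≈ (mono-⊗ 1 (shift h)))) (≡⇒≈ (mono-⊗ 1 (shifts 2 h))))
      where h = g ⊗ g ⊗ g

-- Gauss' product for the theta series

∑ : ℕ → (ℕ → Series) → Series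
∑ zero    F = const 0ℤ
∑ (suc M) F = ∑ M F ⊕ F M

sq : ℕ → ℕ
sq k = suc k * suc k

-- The infinite sum of the q^(a k), read diagonally: when k ≤ a k for all k, the terms after the
-- first n + 1 have exponents above n and cannot affect coefficient n.
Θ : (ℕ → ℕ) → Series
Θ a n = ∑ (suc n) (mono ∘ a) n

θ φ : Series
θ = Θ sq
φ = const 1ℤ ⊕ const (+ 2) ⊗ θ

1-x^ 1+x^ : ℕ → Series
1-x^ m = const 1ℤ ⊕ ⊖ mono m
1+x^ m = const 1ℤ ⊕ mono m

-- Q s t = ∏_{s<k≤s+t} (1-q^k)
Q : ℕ → ℕ → Series
Q s zero    = const 1ℤ
Q s (suc t) = 1-x^ (suc s) ⊗ Q (suc s) t

D : ℕ → Series
D zero    = const 1ℤ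
D (suc n) = D n ⊗ 1+x^ (suc n)

ε : ℕ → Series
ε n = const (sgn n)

-- R n n 0 = Σ_{s=1}^{n} (-1)^s q^{s(n+1)} ∏_{s<k≤n} (1-q^k) ∏_{k<s} (1+q^k)
R : ℕ → ℕ → ℕ → Series
R n zero    t = const 0ℤ
R n (suc s) t = R n s (suc t) ⊕ ε (suc s) ⊗ mono (suc s * suc n) ⊗ Q (suc s) t ⊗ D s

T : ℕ → Series
T zero    = const 1ℤ
T (suc n) = T n ⊕ const (+ 2) ⊗ ε (suc n) ⊗ mono (sq n)

module _ where
  open Exact
  open ≈-Reasoning

  Q-last : ∀ s t n → s + t ≡ n → Q s (suc t) ≈ Q s t ⊗ 1-x^ (suc n)
  Q-last s zero n e = ≈-trans (solveR 1 (λ a → a :* con 1ℤ := con 1ℤ :* a) ≈-refl (1-x^ (suc s)))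
    (⊗-cong ≈-refl (≈-reflexive (cong (1-x^ ∘ suc) (trans (sym (ℕₚ.+-identityʳ s)) e))))
  Q-last s (suc t) n e = ≈-trans (⊗-cong ≈-refl (Q-last (suc s) t n (trans (sym (ℕₚ.+-suc s t)) e)))
    (solveR 3 (λ a b c → a :* (b :* c) := a :* b :* c) ≈-refl (1-x^ (suc s)) (Q (suc s) t) (1-x^ (suc n)))

  isolate : ∀ {x y z} → x ⊕ y ≈ z → x ≈ z ⊕ ⊖ y
  isolate {x} {y} e = ≈-trans (solveR 2 (λ x y → x := x :+ y :+ :- y) ≈-refl x y) (⊕-cong e ≈-refl)

  ε-suc : ∀ n → ε (suc n) ≈ ⊖ ε n
  ε-suc n = ≡⇒≈ λ { zero → sym (⊖-at (ε n) 0) ; (suc k) → sym (⊖-at (ε n) (suc k)) }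

  mono-*-suc : ∀ s n → mono (s * suc n) ≈ mono s ⊗ mono (s * n)
  mono-*-suc s n = ≈-trans (≈-reflexive (cong mono (ℕₚ.*-suc s n))) (≡⇒≈ (mono-+ s (s * n)))

  -- Passing from n to n + 1 turns q^(s(n+1)) into q^(s(n+2)) and adds the factor 1 - q^(n+1) to
  -- `Q`; compared with (1 + q^(n+1)) `R n`, the changes telescope in s. The second summand on the
  -- left is the boundary term left over after s steps, and s + t ≡ n keeps `Q s t` equal to the
  -- product over s < k ≤ n.
  R-telescope : ∀ s t n → s + t ≡ n →
    R (suc n) s (suc t) ⊕ ε s ⊗ mono (suc s * suc n) ⊗ Q s t ⊗ D s
      ≈ 1+x^ (suc n) ⊗ R n s t ⊕ mono (suc n) ⊗ Q 0 n
  R-telescope zero t n refl = ≈-trans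
    (⊕-cong ≈-refl (⊗-cong (⊗-cong (⊗-cong ≈-refl (≈-reflexive (cong mono (ℕₚ.*-identityˡ (suc n))))) ≈-refl) ≈-refl))
    (solveR 3 (λ w q z → con 0ℤ :+ con 1ℤ :* w :* q :* con 1ℤ := z :* con 0ℤ :+ w :* q) ≈-refl (mono (suc n)) (Q 0 n) (1+x^ (suc n)))
  R-telescope (suc s) t n e = begin
    (R (suc n) s (suc (suc t)) ⊕ ε (suc s) ⊗ mono (suc s * suc (suc n)) ⊗ Q (suc s) (suc t) ⊗ D s)
      ⊕ ε (suc s) ⊗ mono (suc (suc s) * suc n) ⊗ Q (suc s) t ⊗ (D s ⊗ 1+x^ (suc s))
      ≈⟨ ⊕-cong (⊕-cong (isolate (R-telescope s (suc t) n e′))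
                        (⊗-cong (⊗-cong (⊗-cong (ε-suc s) (mono-*-suc (suc s) (suc n))) (Q-last (suc s) t n e)) ≈-refl))
                (⊗-cong (⊗-cong (⊗-cong (ε-suc s) (≡⇒≈ (mono-+ (suc n) (suc s * suc n)))) ≈-refl) ≈-refl) ⟩
    (((const 1ℤ ⊕ w) ⊗ r ⊕ w ⊗ q₀ ⊕ ⊖ (ε s ⊗ y ⊗ ((const 1ℤ ⊕ ⊖ z) ⊗ q) ⊗ D s)) ⊕ ⊖ ε s ⊗ (z ⊗ y) ⊗ (q ⊗ (const 1ℤ ⊕ ⊖ w)) ⊗ D s)
      ⊕ ⊖ ε s ⊗ (w ⊗ y) ⊗ q ⊗ (D s ⊗ (const 1ℤ ⊕ z))
      ≈⟨ solveR 8 (λ w r q₀ e y z q d →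
           (((con 1ℤ :+ w) :* r :+ w :* q₀ :+ :- (e :* y :* ((con 1ℤ :+ :- z) :* q) :* d)) :+ :- e :* (z :* y) :* (q :* (con 1ℤ :+ :- w)) :* d)
             :+ :- e :* (w :* y) :* q :* (d :* (con 1ℤ :+ z))
           := (con 1ℤ :+ w) :* (r :+ :- e :* y :* q :* d) :+ w :* q₀) ≈-refl w r q₀ (ε s) y z q (D s) ⟩
    (const 1ℤ ⊕ w) ⊗ (r ⊕ ⊖ ε s ⊗ y ⊗ q ⊗ D s) ⊕ w ⊗ q₀
      ≈⟨ ⊕-cong (⊗-cong ≈-refl (⊕-cong ≈-refl (⊗-cong (⊗-cong (⊗-cong (ε-suc s) ≈-refl) ≈-refl) ≈-refl))) ≈-refl ⟨
    1+x^ (suc n) ⊗ R n (suc s) t ⊕ mono (suc n) ⊗ Q 0 n ∎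
    where
    e′ : s + suc t ≡ n
    e′ = trans (ℕₚ.+-suc s t) e
    w r q₀ y z q : Series
    w  = mono (suc n)
    r  = R n s (suc t)
    q₀ = Q 0 n
    y  = mono (suc s * suc n)
    z  = mono (suc s)
    q  = Q (suc s) t

  -- With w = q^(n+1), the induction step multiplies by 1 + w, whereas `Q` must grow by 1 - w. The
  -- excess 2 w `Q 0 n` is the last term of `R-telescope` at s = n, and the boundary term there is
  -- the new theta term q^((n+1)²) times `D n`.
  gauss-finite : ∀ n → D n ⊗ T n ≈ Q 0 n ⊕ const (+ 2) ⊗ R n n 0
  gauss-finite zero    = solveR 0 (con 1ℤ :* con 1ℤ := con 1ℤ :+ con (+ 2) :* con 0ℤ) ≈-refl
  gauss-finite (suc n) = begin
    D n ⊗ (const 1ℤ ⊕ w) ⊗ (T n ⊕ const (+ 2) ⊗ ε (suc n) ⊗ u)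
      ≈⟨ ⊗-cong ≈-refl (⊕-cong ≈-refl (⊗-cong (⊗-cong ≈-refl (ε-suc n)) ≈-refl)) ⟩
    D n ⊗ (const 1ℤ ⊕ w) ⊗ (T n ⊕ const (+ 2) ⊗ ⊖ ε n ⊗ u)
      ≈⟨ solveR 5 (λ d w t e u → d :* (con 1ℤ :+ w) :* (t :+ con (+ 2) :* :- e :* u)
           := (con 1ℤ :+ w) :* (d :* t) :+ con (+ 2) :* (con 1ℤ :+ w) :* (:- e :* u :* d)) ≈-refl (D n) w (T n) (ε n) u ⟩
    (const 1ℤ ⊕ w) ⊗ (D n ⊗ T n) ⊕ const (+ 2) ⊗ (const 1ℤ ⊕ w) ⊗ (⊖ ε n ⊗ u ⊗ D n)
      ≈⟨ ⊕-cong (⊗-cong ≈-refl (gauss-finite n)) ≈-refl ⟩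
    (const 1ℤ ⊕ w) ⊗ (q ⊕ const (+ 2) ⊗ r) ⊕ const (+ 2) ⊗ (const 1ℤ ⊕ w) ⊗ (⊖ ε n ⊗ u ⊗ D n)
      ≈⟨ solveR 6 (λ d w q e u r → (con 1ℤ :+ w) :* (q :+ con (+ 2) :* r) :+ con (+ 2) :* (con 1ℤ :+ w) :* (:- e :* u :* d)
           := q :* (con 1ℤ :+ :- w) :+ con (+ 2) :* (((con 1ℤ :+ w) :* r :+ w :* q :+ :- (e :* u :* con 1ℤ :* d)) :+ :- e :* (w :* u) :* con 1ℤ :* d))
           ≈-refl (D n) w q (ε n) u r ⟩
    q ⊗ (const 1ℤ ⊕ ⊖ w) ⊕ const (+ 2) ⊗ (((const 1ℤ ⊕ w) ⊗ r ⊕ w ⊗ q ⊕ ⊖ (ε n ⊗ u ⊗ const 1ℤ ⊗ D n)) ⊕ ⊖ ε n ⊗ (w ⊗ u) ⊗ const 1ℤ ⊗ D n)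
      ≈⟨ ⊕-cong (Q-last 0 n n refl) (⊗-cong ≈-refl (⊕-cong (isolate (R-telescope n 0 n (ℕₚ.+-identityʳ n)))
           (⊗-cong (⊗-cong (⊗-cong (ε-suc n) (mono-*-suc (suc n) (suc n))) ≈-refl) ≈-refl))) ⟨
    Q 0 (suc n) ⊕ const (+ 2) ⊗ R (suc n) (suc n) 0 ∎
    where
    w u q r : Series
    w = mono (suc n)
    u = mono (sq n)
    q = Q 0 n
    r = R n n 0

-- Every summand carries a power q^(s(n+1)) with s ≥ 1. Hence the remainder in `gauss-finite`
-- disappears as n grows, which leaves Gauss' product.
R-small : ∀ {d} n s t → Cong d (_< suc n) (R n s t) (const 0ℤ)
R-small n zero    t = Mod.≈-refl _ _ ℕₚ.≤-<-trans
R-small {d} n (suc s) t = begin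
  R n s (suc t) ⊕ ε (suc s) ⊗ mono (suc s * suc n) ⊗ Q (suc s) t ⊗ D s
    ≈⟨ ⊕-cong (R-small n s (suc t)) (⊗-cong (⊗-cong (⊗-cong ≈-refl (mono≈0 _ (ℕₚ.m≤m+n (suc n) (s * suc n)))) ≈-refl) ≈-refl) ⟩
  const 0ℤ ⊕ ε (suc s) ⊗ const 0ℤ ⊗ Q (suc s) t ⊗ D s
    ≈⟨ solveR 3 (λ a b c → con 0ℤ :+ a :* con 0ℤ :* b :* c := con 0ℤ) ≈-refl (ε (suc s)) (Q (suc s) t) (D s) ⟩
  const 0ℤ ∎
  where
  open Upto d (suc n)
  open ≈-Reasoning

module _ (a : ℕ → ℕ) (a≥ : ∀ k → k ≤ a k) where
  ∑-stable : ∀ n M → ∑ (n + suc M) (mono ∘ a) M ≡ ∑ (suc M) (mono ∘ a) M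
  ∑-stable zero    M = refl
  ∑-stable (suc n) M = begin
    (∑ (n + suc M) (mono ∘ a) ⊕ mono (a (n + suc M))) M          ≡⟨ ⊕-at _ _ M ⟩
    ∑ (n + suc M) (mono ∘ a) M ℤ.+ mono (a (n + suc M)) M        ≡⟨ cong₂ ℤ._+_ (∑-stable n M) (mono-small _ M (ℕₚ.≤-trans (ℕₚ.m≤n+m (suc M) n) (a≥ (n + suc M)))) ⟩
    ∑ (suc M) (mono ∘ a) M ℤ.+ 0ℤ                                ≡⟨ ℤₚ.+-identityʳ _ ⟩
    ∑ (suc M) (mono ∘ a) M                                       ∎
    where open ≡-Reasoning

  Θ≡∑ : ∀ {n M} → n < M → Θ a n ≡ ∑ M (mono ∘ a) n
  Θ≡∑ {n} {M} n<M = trans (sym (∑-stable (M ∸ suc n) n)) (cong (λ m → ∑ m (mono ∘ a) n) (ℕₚ.m∸n+n≡m n<M))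

  Θ≈∑ : ∀ {d K M} → K ≤ M → Cong d (_< K) (Θ a) (∑ M (mono ∘ a))
  Θ≈∑ {d} {K} {M} K≤M = mk λ n n<K → subst (λ z → d ∣ℤ.∣ z ℤ.- ∑ M (mono ∘ a) n) (sym (Θ≡∑ (ℕₚ.≤-trans n<K K≤M)))
    (subst (d ∣ℤ.∣_) (sym (ℤₚ.+-inverseʳ (∑ M (mono ∘ a) n))) ∣0)

k≤sq : ∀ k → k ≤ sq k
k≤sq k = ℕₚ.≤-trans (ℕₚ.n≤1+n k) (ℕₚ.m≤m*n (suc k) (suc k))

-- Since n² and n have the same parity, the substitution q ↦ -q in a sum of q^(n²) produces the
-- signs (-1)^n used in `T`.
sgn-square : ∀ n → sgn (n * n) ≡ sgn n
sgn-square zero    = refl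
sgn-square (suc n) = trans (cong sgn (e n)) (trans (sgn-+ (suc (n * n)) (n * 2)) (trans (cong (sgn (suc (n * n)) ℤ.*_) (sgn-*2 n))
  (trans (ℤₚ.*-identityʳ _) (cong ℤ.-_ (sgn-square n)))))
  where
  e : ∀ n → suc n * suc n ≡ suc (n * n) + n * 2
  e = solveℕ 1 (λ n → (lit 1 ⊞ n) ⊠ (lit 1 ⊞ n) ≜ lit 1 ⊞ n ⊠ n ⊞ n ⊠ lit 2) refl

φ⁻ φ′ : Series
φ⁻ = σ φ
φ′ = V 1 φ⁻

σ-affine : ∀ f n → σ (const 1ℤ ⊕ const (+ 2) ⊗ f) n ≡ (const 1ℤ ⊕ const (+ 2) ⊗ σ f) n
σ-affine f = ≈⇒≡ (≈-trans (≡⇒≈ (σ-⊕ (const 1ℤ) (const (+ 2) ⊗ f)))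
  (⊕-cong (≡⇒≈ (σ-const 1ℤ)) (≈-trans (≡⇒≈ (λ n → σ-⊗ n (const (+ 2)) f)) (⊗-cong (≡⇒≈ (σ-const (+ 2))) ≈-refl))))
  where open Exact

V-affine : ∀ m f n → V m (const 1ℤ ⊕ const (+ 2) ⊗ f) n ≡ (const 1ℤ ⊕ const (+ 2) ⊗ V m f) n
V-affine m f = ≈⇒≡ (≈-trans (≡⇒≈ (V-⊕ m (const 1ℤ) (const (+ 2) ⊗ f)))
  (⊕-cong (≡⇒≈ (V-const m 1ℤ)) (≡⇒≈ (V-scale m (+ 2) f))))
  where open Exact

T≡ : ∀ n k → T n k ≡ σ (const 1ℤ ⊕ const (+ 2) ⊗ ∑ n (mono ∘ sq)) k
T≡ n = ≈⇒≡ (go n)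
  where
  open Exact
  open ≈-Reasoning
  go : ∀ n → T n ≈ σ (const 1ℤ ⊕ const (+ 2) ⊗ ∑ n (mono ∘ sq))
  go zero    = ≈-sym (≈-trans (≡⇒≈ (σ-affine (const 0ℤ))) (≈-trans (⊕-cong ≈-refl (⊗-cong ≈-refl (≡⇒≈ (σ-const 0ℤ))))
    (solveR 0 (con 1ℤ :+ con (+ 2) :* con 0ℤ := con 1ℤ) ≈-refl)))
  go (suc n) = begin
    T n ⊕ const (+ 2) ⊗ ε (suc n) ⊗ mono (sq n)
      ≈⟨ ⊕-cong (≈-trans (go n) (≡⇒≈ (σ-affine s))) ≈-refl ⟩
    (const 1ℤ ⊕ const (+ 2) ⊗ σ s) ⊕ const (+ 2) ⊗ ε (suc n) ⊗ mono (sq n)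
      ≈⟨ solveR 3 (λ s e m → (con 1ℤ :+ con (+ 2) :* s) :+ con (+ 2) :* e :* m := con 1ℤ :+ con (+ 2) :* (s :+ e :* m)) ≈-refl (σ s) (ε (suc n)) (mono (sq n)) ⟩
    const 1ℤ ⊕ const (+ 2) ⊗ (σ s ⊕ ε (suc n) ⊗ mono (sq n))
      ≈⟨ ⊕-cong ≈-refl (⊗-cong ≈-refl (⊕-cong ≈-refl (≈-trans (≡⇒≈ (σ-mono (sq n))) (⊗-cong (≈-reflexive (cong const (sgn-square (suc n)))) ≈-refl)))) ⟨
    const 1ℤ ⊕ const (+ 2) ⊗ (σ s ⊕ σ (mono (sq n)))
      ≈⟨ ⊕-cong ≈-refl (⊗-cong ≈-refl (≡⇒≈ (σ-⊕ s (mono (sq n))))) ⟨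
    const 1ℤ ⊕ const (+ 2) ⊗ σ (s ⊕ mono (sq n))
      ≈⟨ ≡⇒≈ (σ-affine (s ⊕ mono (sq n))) ⟨
    σ (const 1ℤ ⊕ const (+ 2) ⊗ (s ⊕ mono (sq n))) ∎
    where s = ∑ n (mono ∘ sq)

gauss : ∀ n → Cong 0ℤ (_< n) (D n ⊗ φ⁻) (Q 0 n)
gauss n = begin
  D n ⊗ φ⁻
    ≈⟨ ⊗-cong ≈-refl (≈-trans (σ-cong (⊕-cong ≈-refl (⊗-cong ≈-refl (Θ≈∑ sq k≤sq ℕₚ.≤-refl)))) (≈-sym (≡⇒≈ (T≡ n)))) ⟩
  D n ⊗ T n
    ≈⟨ ≡⇒≈ (≈⇒≡ (gauss-finite n)) ⟩
  Q 0 n ⊕ const (+ 2) ⊗ R n n 0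
    ≈⟨ ⊕-cong ≈-refl (⊗-cong ≈-refl (weaken ℕₚ.m<n⇒m<1+n (R-small n n 0))) ⟩
  Q 0 n ⊕ const (+ 2) ⊗ const 0ℤ
    ≈⟨ solveR 1 (λ q → q :+ con (+ 2) :* con 0ℤ := q) ≈-refl (Q 0 n) ⟩
  Q 0 n ∎
  where
  open Upto 0ℤ n
  open ≈-Reasoning

-- Only factors with odd exponent change under q ↦ -q, so these two products measure how `D` and `Q`
-- change.
O⁺ O⁻ : ℕ → Series
O⁺ zero    = const 1ℤ
O⁺ (suc N) = O⁺ N ⊗ 1+x^ (suc (N * 2))
O⁻ zero    = const 1ℤ
O⁻ (suc N) = O⁻ N ⊗ 1-x^ (suc (N * 2))

head-⊗ : ∀ f g → f 0 ≡ 1ℤ → g 0 ≡ 1ℤ → (f ⊗ g) 0 ≡ 1ℤ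
head-⊗ f g f0 g0 = trans (⊗-0 f g) (cong₂ ℤ._*_ f0 g0)

head-1+x^ : ∀ m → 1+x^ (suc m) 0 ≡ 1ℤ
head-1+x^ m = ⊕-at (const 1ℤ) (mono (suc m)) 0

head-1-x^ : ∀ m → 1-x^ (suc m) 0 ≡ 1ℤ
head-1-x^ m = trans (⊕-at (const 1ℤ) (⊖ mono (suc m)) 0) (cong (λ z → 1ℤ ℤ.+ z) (⊖-at (mono (suc m)) 0))

head-D : ∀ n → D n 0 ≡ 1ℤ
head-D zero    = refl
head-D (suc n) = head-⊗ (D n) (1+x^ (suc n)) (head-D n) (head-1+x^ n)

head-O⁺ : ∀ n → O⁺ n 0 ≡ 1ℤ
head-O⁺ zero    = refl
head-O⁺ (suc n) = head-⊗ (O⁺ n) (1+x^ (suc (n * 2))) (head-O⁺ n) (head-1+x^ (n * 2))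

head-O⁻ : ∀ n → O⁻ n 0 ≡ 1ℤ
head-O⁻ zero    = refl
head-O⁻ (suc n) = head-⊗ (O⁻ n) (1-x^ (suc (n * 2))) (head-O⁻ n) (head-1-x^ (n * 2))

module _ where
  open Exact
  open ≈-Reasoning

  σ-1+x^ : ∀ m → σ (1+x^ m) ≈ const 1ℤ ⊕ ε m ⊗ mono m
  σ-1+x^ m = ≈-trans (≡⇒≈ (σ-⊕ (const 1ℤ) (mono m))) (⊕-cong (≡⇒≈ (σ-const 1ℤ)) (≡⇒≈ (σ-mono m)))

  σ-⊖ : ∀ f → σ (⊖ f) ≈ ⊖ σ f
  σ-⊖ f = ≡⇒≈ λ n → trans (cong (sgn n ℤ.*_) (⊖-at f n)) (trans (sym (ℤₚ.neg-distribʳ-* (sgn n) (f n))) (sym (⊖-at (σ f) n)))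

  σ-1-x^ : ∀ m → σ (1-x^ m) ≈ const 1ℤ ⊕ ⊖ (ε m ⊗ mono m)
  σ-1-x^ m = ≈-trans (≡⇒≈ (σ-⊕ (const 1ℤ) (⊖ mono m))) (⊕-cong (≡⇒≈ (σ-const 1ℤ)) (≈-trans (σ-⊖ (mono m)) (⊖-cong (≡⇒≈ (σ-mono m)))))

  ε-even : ∀ n → ε (n * 2) ≈ const 1ℤ
  ε-even n = ≈-reflexive (cong const (sgn-*2 n))

  ε-odd : ∀ n → ε (suc (n * 2)) ≈ ⊖ const 1ℤ
  ε-odd n = ≈-trans (ε-suc (n * 2)) (⊖-cong (ε-even n))

  σ-1+x^-even : ∀ n → σ (1+x^ (n * 2)) ≈ 1+x^ (n * 2)
  σ-1+x^-even n = ≈-trans (σ-1+x^ (n * 2)) (≈-trans (⊕-cong ≈-refl (⊗-cong (ε-even n) ≈-refl)) (solveR 1 (λ x → con 1ℤ :+ con 1ℤ :* x := con 1ℤ :+ x) ≈-refl (mono (n * 2))))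

  σ-1-x^-even : ∀ n → σ (1-x^ (n * 2)) ≈ 1-x^ (n * 2)
  σ-1-x^-even n = ≈-trans (σ-1-x^ (n * 2)) (≈-trans (⊕-cong ≈-refl (⊖-cong (⊗-cong (ε-even n) ≈-refl))) (solveR 1 (λ x → con 1ℤ :+ :- (con 1ℤ :* x) := con 1ℤ :+ :- x) ≈-refl (mono (n * 2))))

  σ-1+x^-odd : ∀ n → σ (1+x^ (suc (n * 2))) ≈ 1-x^ (suc (n * 2))
  σ-1+x^-odd n = ≈-trans (σ-1+x^ (suc (n * 2))) (≈-trans (⊕-cong ≈-refl (⊗-cong (ε-odd n) ≈-refl)) (solveR 1 (λ x → con 1ℤ :+ :- con 1ℤ :* x := con 1ℤ :+ :- x) ≈-refl (mono (suc (n * 2)))))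

  σ-1-x^-odd : ∀ n → σ (1-x^ (suc (n * 2))) ≈ 1+x^ (suc (n * 2))
  σ-1-x^-odd n = ≈-trans (σ-1-x^ (suc (n * 2))) (≈-trans (⊕-cong ≈-refl (⊖-cong (⊗-cong (ε-odd n) ≈-refl))) (solveR 1 (λ x → con 1ℤ :+ :- (:- con 1ℤ :* x) := con 1ℤ :+ x) ≈-refl (mono (suc (n * 2)))))

  V-1+x^ : ∀ m n → V m (1+x^ n) ≈ 1+x^ (n * suc m)
  V-1+x^ m n = ≈-trans (≡⇒≈ (V-⊕ m (const 1ℤ) (mono n))) (⊕-cong (≡⇒≈ (V-const m 1ℤ)) (≡⇒≈ (V-mono m n)))

  ⊖-scale : ∀ f → ⊖ f ≈ const (ℤ.- 1ℤ) ⊗ f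
  ⊖-scale f = ≡⇒≈ λ n → trans (⊖-at f n) (sym (trans (const-⊗ (ℤ.- 1ℤ) f n) (ℤₚ.-1*i≡-i (f n))))

  V-⊖ : ∀ m f → V m (⊖ f) ≈ ⊖ V m f
  V-⊖ m f = ≈-trans (V-cong m everywhere (⊖-scale f)) (≈-trans (≡⇒≈ (V-scale m (ℤ.- 1ℤ) f)) (≈-sym (⊖-scale (V m f))))

  V-1-x^ : ∀ m n → V m (1-x^ n) ≈ 1-x^ (n * suc m)
  V-1-x^ m n = ≈-trans (≡⇒≈ (V-⊕ m (const 1ℤ) (⊖ mono n))) (⊕-cong (≡⇒≈ (V-const m 1ℤ)) (≈-trans (V-⊖ m (mono n)) (⊖-cong (≡⇒≈ (V-mono m n)))))

  σ-⊗≈ : ∀ f g → σ (f ⊗ g) ≈ σ f ⊗ σ g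
  σ-⊗≈ f g = ≡⇒≈ λ n → σ-⊗ n f g

  V-⊗≈ : ∀ m f g → V m (f ⊗ g) ≈ V m f ⊗ V m g
  V-⊗≈ m f g = ≡⇒≈ (V-⊗ m f g)

  σ-O⁻ : ∀ N → σ (O⁻ N) ≈ O⁺ N
  σ-O⁻ zero    = ≡⇒≈ (σ-const 1ℤ)
  σ-O⁻ (suc N) = ≈-trans (σ-⊗≈ (O⁻ N) (1-x^ (suc (N * 2)))) (⊗-cong (σ-O⁻ N) (σ-1-x^-odd N))

  σ-O⁺ : ∀ N → σ (O⁺ N) ≈ O⁻ N
  σ-O⁺ zero    = ≡⇒≈ (σ-const 1ℤ)
  σ-O⁺ (suc N) = ≈-trans (σ-⊗≈ (O⁺ N) (1+x^ (suc (N * 2)))) (⊗-cong (σ-O⁺ N) (σ-1+x^-odd N))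

  -- The length 2N pairs each odd factor with the next even one: the odd factors change sign, and
  -- the even ones form `D N` in q².
  σ-D : ∀ N → σ (D (N * 2)) ≈ O⁻ N ⊗ V 1 (D N)
  σ-D zero    = ≈-trans (≡⇒≈ (σ-const 1ℤ)) (≈-trans (solveR 0 (con 1ℤ := con 1ℤ :* con 1ℤ) ≈-refl) (⊗-cong ≈-refl (≈-sym (≡⇒≈ (V-const 1 1ℤ)))))
  σ-D (suc N) = begin
    σ (D (N * 2) ⊗ 1+x^ (suc (N * 2)) ⊗ 1+x^ (suc N * 2))
      ≈⟨ ≈-trans (σ-⊗≈ (D (N * 2) ⊗ 1+x^ (suc (N * 2))) (1+x^ (suc N * 2))) (⊗-cong (σ-⊗≈ (D (N * 2)) (1+x^ (suc (N * 2)))) ≈-refl) ⟩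
    σ (D (N * 2)) ⊗ σ (1+x^ (suc (N * 2))) ⊗ σ (1+x^ (suc N * 2))
      ≈⟨ ⊗-cong (⊗-cong (σ-D N) (σ-1+x^-odd N)) (≈-trans (σ-1+x^-even (suc N)) (≈-sym (V-1+x^ 1 (suc N)))) ⟩
    O⁻ N ⊗ V 1 (D N) ⊗ 1-x^ (suc (N * 2)) ⊗ V 1 (1+x^ (suc N))
      ≈⟨ solveR 4 (λ a b c d → a :* b :* c :* d := a :* c :* (b :* d)) ≈-refl (O⁻ N) (V 1 (D N)) (1-x^ (suc (N * 2))) (V 1 (1+x^ (suc N))) ⟩
    O⁻ N ⊗ 1-x^ (suc (N * 2)) ⊗ (V 1 (D N) ⊗ V 1 (1+x^ (suc N)))
      ≈⟨ ⊗-cong ≈-refl (V-⊗≈ 1 (D N) (1+x^ (suc N))) ⟨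
    O⁻ (suc N) ⊗ V 1 (D (suc N)) ∎

  Q₀-suc : ∀ n → Q 0 (suc n) ≈ Q 0 n ⊗ 1-x^ (suc n)
  Q₀-suc n = Q-last 0 n n refl

  σ-Q : ∀ N → σ (Q 0 (N * 2)) ≈ O⁺ N ⊗ V 1 (Q 0 N)
  σ-Q zero    = ≈-trans (≡⇒≈ (σ-const 1ℤ)) (≈-trans (solveR 0 (con 1ℤ := con 1ℤ :* con 1ℤ) ≈-refl) (⊗-cong ≈-refl (≈-sym (≡⇒≈ (V-const 1 1ℤ)))))
  σ-Q (suc N) = begin
    σ (Q 0 (suc N * 2))
      ≈⟨ σ-cong (≈-trans (Q₀-suc (suc (N * 2))) (⊗-cong (Q₀-suc (N * 2)) ≈-refl)) ⟩
    σ (Q 0 (N * 2) ⊗ 1-x^ (suc (N * 2)) ⊗ 1-x^ (suc N * 2))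
      ≈⟨ ≈-trans (σ-⊗≈ (Q 0 (N * 2) ⊗ 1-x^ (suc (N * 2))) (1-x^ (suc N * 2))) (⊗-cong (σ-⊗≈ (Q 0 (N * 2)) (1-x^ (suc (N * 2)))) ≈-refl) ⟩
    σ (Q 0 (N * 2)) ⊗ σ (1-x^ (suc (N * 2))) ⊗ σ (1-x^ (suc N * 2))
      ≈⟨ ⊗-cong (⊗-cong (σ-Q N) (σ-1-x^-odd N)) (≈-trans (σ-1-x^-even (suc N)) (≈-sym (V-1-x^ 1 (suc N)))) ⟩
    O⁺ N ⊗ V 1 (Q 0 N) ⊗ 1+x^ (suc (N * 2)) ⊗ V 1 (1-x^ (suc N))
      ≈⟨ solveR 4 (λ a b c d → a :* b :* c :* d := a :* c :* (b :* d)) ≈-refl (O⁺ N) (V 1 (Q 0 N)) (1+x^ (suc (N * 2))) (V 1 (1-x^ (suc N))) ⟩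
    O⁺ N ⊗ 1+x^ (suc (N * 2)) ⊗ (V 1 (Q 0 N) ⊗ V 1 (1-x^ (suc N)))
      ≈⟨ ⊗-cong ≈-refl (≈-trans (V-cong 1 everywhere (Q₀-suc N)) (V-⊗≈ 1 (Q 0 N) (1-x^ (suc N)))) ⟨
    O⁺ (suc N) ⊗ V 1 (Q 0 (suc N)) ∎

exact : ∀ {d P f g} → Cong 0ℤ (λ _ → ⊤) f g → Cong d P f g
exact {d} {g = g} e = mk λ n _ → subst (λ z → d ∣ℤ.∣ z ℤ.- g n) (sym (≈⇒≡ e n)) (subst (d ∣ℤ.∣_) (sym (ℤₚ.+-inverseʳ (g n))) ∣0)

-- Gauss' product of length 2N under q ↦ -q, compared with the one of length N in q². Both contain
-- the products over even exponents, and the common `V 1 (D N)` cancels. So φ/φ′ is the limit of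
-- `O⁺ N` / `O⁻ N`.
O⁻φ≈O⁺φ′ : ∀ N → Cong 0ℤ (_< N) (O⁻ N ⊗ φ) (O⁺ N ⊗ φ′)
O⁻φ≈O⁺φ′ N = cancel ℕₚ.≤-<-trans (V 1 (D N)) (head-D N) (begin
  O⁻ N ⊗ φ ⊗ V 1 (D N)
    ≈⟨ solveR 3 (λ a b c → a :* b :* c := a :* c :* b) ≈-refl (O⁻ N) φ (V 1 (D N)) ⟩
  O⁻ N ⊗ V 1 (D N) ⊗ φ
    ≈⟨ ⊗-cong (exact (σ-D N)) (≡⇒≈ (σ-σ φ)) ⟨
  σ (D (N * 2)) ⊗ σ φ⁻
    ≈⟨ ≡⇒≈ (λ n → σ-⊗ n (D (N * 2)) φ⁻) ⟨
  σ (D (N * 2) ⊗ φ⁻)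
    ≈⟨ σ-cong (weaken (λ n<N → ℕₚ.<-≤-trans n<N (ℕₚ.m≤m*n N 2)) (gauss (N * 2))) ⟩
  σ (Q 0 (N * 2))
    ≈⟨ exact (σ-Q N) ⟩
  O⁺ N ⊗ V 1 (Q 0 N)
    ≈⟨ ⊗-cong ≈-refl (V-cong 1 ℕₚ.≤-<-trans (gauss N)) ⟨
  O⁺ N ⊗ V 1 (D N ⊗ φ⁻)
    ≈⟨ ⊗-cong ≈-refl (≡⇒≈ (V-⊗ 1 (D N) φ⁻)) ⟩
  O⁺ N ⊗ (V 1 (D N) ⊗ φ′)
    ≈⟨ solveR 3 (λ a b c → a :* (b :* c) := a :* c :* b) ≈-refl (O⁺ N) (V 1 (D N)) φ′ ⟩
  O⁺ N ⊗ φ′ ⊗ V 1 (D N) ∎)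
  where
  open Upto 0ℤ N
  open ≈-Reasoning

-- Since φ′ is even and `σ` exchanges the two odd products, the image of O⁻ φ = O⁺ φ′ is O⁺ φ⁻ = O⁻
-- φ′. Multiplying the two relations, O⁻ O⁺ cancels.
φφ⁻≈φ′² : Cong 0ℤ (λ _ → ⊤) (φ ⊗ φ⁻) (φ′ ⊗ φ′)
φφ⁻≈φ′² = limit go
  where
  go : ∀ N → Cong 0ℤ (_< N) (φ ⊗ φ⁻) (φ′ ⊗ φ′)
  go N = cancel ℕₚ.≤-<-trans (O⁻ N ⊗ O⁺ N) (head-⊗ (O⁻ N) (O⁺ N) (head-O⁻ N) (head-O⁺ N)) (begin
      φ ⊗ φ⁻ ⊗ (O⁻ N ⊗ O⁺ N)
        ≈⟨ solveR 4 (λ a b c d → a :* b :* (c :* d) := c :* a :* (d :* b)) ≈-refl φ φ⁻ (O⁻ N) (O⁺ N) ⟩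
      O⁻ N ⊗ φ ⊗ (O⁺ N ⊗ φ⁻)
        ≈⟨ ⊗-cong (O⁻φ≈O⁺φ′ N) (⊗-cong (≈-sym (exact (σ-O⁻ N))) ≈-refl) ⟩
      O⁺ N ⊗ φ′ ⊗ (σ (O⁻ N) ⊗ σ φ)
        ≈⟨ ⊗-cong ≈-refl (≈-trans (≈-sym (exact (σ-⊗≈ (O⁻ N) φ))) (≈-trans (σ-cong (O⁻φ≈O⁺φ′ N)) (exact (σ-⊗≈ (O⁺ N) φ′)))) ⟩
      O⁺ N ⊗ φ′ ⊗ (σ (O⁺ N) ⊗ σ φ′)
        ≈⟨ ⊗-cong ≈-refl (⊗-cong (exact (σ-O⁺ N)) (≡⇒≈ (σ-V₂ φ⁻))) ⟩
      O⁺ N ⊗ φ′ ⊗ (O⁻ N ⊗ φ′)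
        ≈⟨ solveR 3 (λ a b c → a :* b :* (c :* b) := b :* b :* (c :* a)) ≈-refl (O⁺ N) φ′ (O⁻ N) ⟩
      φ′ ⊗ φ′ ⊗ (O⁻ N ⊗ O⁺ N) ∎)
    where
    open Upto 0ℤ N
    open ≈-Reasoning

-- The generating function as a theta quotient

mono-diag : ∀ m → mono m m ≡ 1ℤ
mono-diag zero    = refl
mono-diag (suc m) = mono-diag m

mono-off : ∀ m n → n ≢ m → mono m n ≡ 0ℤ
mono-off zero    zero    ne = contradiction refl ne
mono-off zero    (suc n) ne = refl
mono-off (suc m) zero    ne = refl
mono-off (suc m) (suc n) ne = mono-off m n (ne ∘ cong suc)

binom≡ : ∀ c m n → binom c (suc m) n ≡ (const 1ℤ ⊕ const c ⊗ mono (suc m)) n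
binom≡ c m n = trans (lemma n) (sym (trans (⊕-at (const 1ℤ) (const c ⊗ mono (suc m)) n) (cong (λ z → const 1ℤ n ℤ.+ z) (const-⊗ c (mono (suc m)) n))))
  where
  lemma : ∀ n → binom c (suc m) n ≡ const 1ℤ n ℤ.+ c ℤ.* mono (suc m) n
  lemma zero    = sym (cong (λ z → 1ℤ ℤ.+ z) (ℤₚ.*-zeroʳ c))
  lemma (suc k) with suc k ℕ.≟ suc m
  ... | yes refl = sym (trans (ℤₚ.+-identityˡ _) (trans (cong (c ℤ.*_) (mono-diag m)) (ℤₚ.*-identityʳ c)))
  ... | no  k≢m  = sym (trans (ℤₚ.+-identityˡ _) (trans (cong (c ℤ.*_) (mono-off (suc m) (suc k) k≢m)) (ℤₚ.*-zeroʳ c)))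

invOneMinus-yes : ∀ m k → k % suc m ≡ 0 → invOneMinus m k ≡ 1ℤ
invOneMinus-yes m k e with k % suc m ℕ.≟ 0
... | yes _ = refl
... | no ne = contradiction e ne

invOneMinus-no : ∀ m k → k % suc m ≢ 0 → invOneMinus m k ≡ 0ℤ
invOneMinus-no m k ne with k % suc m ℕ.≟ 0
... | yes e = contradiction e ne
... | no _  = refl

invOnePlus-yes : ∀ m k → k % suc m ≡ 0 → invOnePlus m k ≡ sgn (k / suc m)
invOnePlus-yes m k e with k % suc m ℕ.≟ 0
... | yes _ = refl
... | no ne = contradiction e ne

invOnePlus-no : ∀ m k → k % suc m ≢ 0 → invOnePlus m k ≡ 0ℤ
invOnePlus-no m k ne with k % suc m ℕ.≟ 0
... | yes e = contradiction e ne
... | no _  = refl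

%-add : ∀ m k → (suc m + k) % suc m ≡ k % suc m
%-add m k = trans (cong (_% suc m) (ℕₚ.+-comm (suc m) k)) (DM.[m+n]%n≡m%n k (suc m))

/-add : ∀ m k → (suc m + k) / suc m ≡ suc (k / suc m)
/-add m k = trans (DM.m/n≡1+[m∸n]/n {suc m + k} {suc m} (ℕₚ.m≤m+n (suc m) k)) (cong (λ z → suc (z / suc m)) (ℕₚ.m+n∸m≡n (suc m) k))

shifts-low : ∀ m f n → n < m → shifts m f n ≡ 0ℤ
shifts-low (suc m) f zero    _         = refl
shifts-low (suc m) f (suc n) (s≤s n<m) = shifts-low m f n n<m

-- The functional equation i = 1 + q^(m+1) i of a geometric series, obtained from the periodicity of
-- remainders. It yields the inverse with no summation; `invOnePlus` is treated alike, each period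
-- changing the sign.
invOneMinus-rec : ∀ m n → invOneMinus m n ≡ const 1ℤ n ℤ.+ shifts (suc m) (invOneMinus m) n
invOneMinus-rec m n with n ℕ.<? suc m
invOneMinus-rec m zero | yes n<1+m = invOneMinus-yes m 0 refl
invOneMinus-rec m (suc n) | yes n<1+m = trans (invOneMinus-no m (suc n) λ e → ℕₚ.1+n≢0 (trans (sym (DM.m<n⇒m%n≡m n<1+m)) e))
  (sym (trans (ℤₚ.+-identityˡ _) (shifts-low (suc m) _ (suc n) n<1+m)))
invOneMinus-rec m n | no n≮1+m = subst (λ n → invOneMinus m n ≡ const 1ℤ n ℤ.+ shifts (suc m) (invOneMinus m) n) (ℕₚ.m+[n∸m]≡n (ℕₚ.≮⇒≥ n≮1+m)) (step (n ∸ suc m))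
  where
  step : ∀ k → invOneMinus m (suc m + k) ≡ 0ℤ ℤ.+ shifts (suc m) (invOneMinus m) (suc m + k)
  step k = trans (periodic (k % suc m ℕ.≟ 0)) (sym (trans (ℤₚ.+-identityˡ _) (shifts-skip (suc m) _ k)))
    where
    periodic : _ → invOneMinus m (suc m + k) ≡ invOneMinus m k
    periodic (yes e) = trans (invOneMinus-yes m (suc m + k) (trans (%-add m k) e)) (sym (invOneMinus-yes m k e))
    periodic (no ne) = trans (invOneMinus-no m (suc m + k) (ne ∘ trans (sym (%-add m k)))) (sym (invOneMinus-no m k ne))

invOnePlus-rec : ∀ m n → invOnePlus m n ≡ const 1ℤ n ℤ.+ ℤ.- shifts (suc m) (invOnePlus m) n
invOnePlus-rec m n with n ℕ.<? suc m
invOnePlus-rec m zero | yes n<1+m = trans (invOnePlus-yes m 0 refl) (cong sgn (DM.0/n≡0 (suc m)))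
invOnePlus-rec m (suc n) | yes n<1+m = trans (invOnePlus-no m (suc n) λ e → ℕₚ.1+n≢0 (trans (sym (DM.m<n⇒m%n≡m n<1+m)) e))
  (sym (trans (ℤₚ.+-identityˡ _) (cong ℤ.-_ (shifts-low (suc m) _ (suc n) n<1+m))))
invOnePlus-rec m n | no n≮1+m = subst (λ n → invOnePlus m n ≡ const 1ℤ n ℤ.+ ℤ.- shifts (suc m) (invOnePlus m) n) (ℕₚ.m+[n∸m]≡n (ℕₚ.≮⇒≥ n≮1+m)) (step (n ∸ suc m))
  where
  step : ∀ k → invOnePlus m (suc m + k) ≡ 0ℤ ℤ.+ ℤ.- shifts (suc m) (invOnePlus m) (suc m + k)
  step k = trans (periodic (k % suc m ℕ.≟ 0)) (sym (trans (ℤₚ.+-identityˡ _) (cong ℤ.-_ (shifts-skip (suc m) _ k))))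
    where
    periodic : _ → invOnePlus m (suc m + k) ≡ ℤ.- invOnePlus m k
    periodic (yes e) = trans (invOnePlus-yes m (suc m + k) (trans (%-add m k) e)) (trans (cong sgn (/-add m k)) (cong ℤ.-_ (sym (invOnePlus-yes m k e))))
    periodic (no ne) = trans (invOnePlus-no m (suc m + k) (ne ∘ trans (sym (%-add m k)))) (cong ℤ.-_ (sym (invOnePlus-no m k ne)))

opaque
  unfolding _⊗_
  factor≡ : ∀ j n → factor j n ≡ (binom 1ℤ (suc (2 * j)) ⊗ binom (ℤ.- 1ℤ) (3 * suc (2 * j)) ⊗ invOnePlus (3 * suc (2 * j) ∸ 1) ⊗ invOneMinus (2 * j)) n
  factor≡ j n = refl

  partialProd-suc : ∀ N n → partialProd (suc N) n ≡ (partialProd N ⊗ factor N) n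
  partialProd-suc N n = refl

partialProd-0 : ∀ n → partialProd 0 n ≡ const 1ℤ n
partialProd-0 zero    = refl
partialProd-0 (suc n) = refl

module _ where
  open Exact
  open ≈-Reasoning

  binom-plus : ∀ m → binom 1ℤ (suc m) ≈ 1+x^ (suc m)
  binom-plus m = ≈-trans (≡⇒≈ (binom≡ 1ℤ m)) (solveR 1 (λ x → con 1ℤ :+ con 1ℤ :* x := con 1ℤ :+ x) ≈-refl (mono (suc m)))

  binom-minus : ∀ m → binom (ℤ.- 1ℤ) (suc m) ≈ 1-x^ (suc m)
  binom-minus m = ≈-trans (≡⇒≈ (binom≡ (ℤ.- 1ℤ) m)) (solveR 1 (λ x → con 1ℤ :+ con (ℤ.- 1ℤ) :* x := con 1ℤ :+ :- x) ≈-refl (mono (suc m)))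

  invOneMinus-inverse : ∀ m → invOneMinus m ⊗ 1-x^ (suc m) ≈ const 1ℤ
  invOneMinus-inverse m = begin
    i ⊗ (const 1ℤ ⊕ ⊖ x)             ≈⟨ solveR 2 (λ i x → i :* (con 1ℤ :+ :- x) := i :+ :- (x :* i)) ≈-refl i x ⟩
    i ⊕ ⊖ (x ⊗ i)                    ≈⟨ ⊕-cong unfold ≈-refl ⟩
    (const 1ℤ ⊕ x ⊗ i) ⊕ ⊖ (x ⊗ i)   ≈⟨ solveR 1 (λ y → con 1ℤ :+ y :+ :- y := con 1ℤ) ≈-refl (x ⊗ i) ⟩
    const 1ℤ                         ∎
    where
    i x : Series
    i = invOneMinus m
    x = mono (suc m)
    unfold : i ≈ const 1ℤ ⊕ x ⊗ i
    unfold = ≡⇒≈ λ n → trans (invOneMinus-rec m n) (sym (trans (⊕-at (const 1ℤ) (x ⊗ i) n) (cong (λ z → const 1ℤ n ℤ.+ z) (mono-⊗ (suc m) i n))))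

  invOnePlus-inverse : ∀ m → invOnePlus m ⊗ 1+x^ (suc m) ≈ const 1ℤ
  invOnePlus-inverse m = begin
    i ⊗ (const 1ℤ ⊕ x)                 ≈⟨ solveR 2 (λ i x → i :* (con 1ℤ :+ x) := i :+ x :* i) ≈-refl i x ⟩
    i ⊕ x ⊗ i                          ≈⟨ ⊕-cong unfold ≈-refl ⟩
    (const 1ℤ ⊕ ⊖ (x ⊗ i)) ⊕ x ⊗ i     ≈⟨ solveR 1 (λ y → con 1ℤ :+ :- y :+ y := con 1ℤ) ≈-refl (x ⊗ i) ⟩
    const 1ℤ                           ∎
    where
    i x : Series
    i = invOnePlus m
    x = mono (suc m)
    unfold : i ≈ const 1ℤ ⊕ ⊖ (x ⊗ i)
    unfold = ≡⇒≈ λ n → trans (invOnePlus-rec m n) (sym (trans (⊕-at (const 1ℤ) (⊖ (x ⊗ i)) n) (cong (λ z → const 1ℤ n ℤ.+ z) (trans (⊖-at (x ⊗ i) n) (cong ℤ.-_ (mono-⊗ (suc m) i n))))))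

  factor-cleared : ∀ j → factor j ⊗ (V 2 (1+x^ (suc (j * 2))) ⊗ 1-x^ (suc (j * 2))) ≈ 1+x^ (suc (j * 2)) ⊗ V 2 (1-x^ (suc (j * 2)))
  factor-cleared j = begin
    factor j ⊗ (V 2 (1+x^ (suc (j * 2))) ⊗ 1-x^ (suc (j * 2)))
      ≈⟨ ⊗-cong factor≈ (⊗-cong (V-1+x^ 2 (suc (j * 2))) ≈-refl) ⟩
    b⁺ ⊗ b⁻ ⊗ i⁺ ⊗ i⁻ ⊗ (1+x^ (suc (j * 2) * 3) ⊗ 1-x^ (suc (j * 2)))
      ≈⟨ solveR 6 (λ a b c d e f → a :* b :* c :* d :* (e :* f) := a :* b :* (c :* e) :* (d :* f)) ≈-refl b⁺ b⁻ i⁺ i⁻ (1+x^ (suc (j * 2) * 3)) (1-x^ (suc (j * 2))) ⟩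
    b⁺ ⊗ b⁻ ⊗ (i⁺ ⊗ 1+x^ (suc (j * 2) * 3)) ⊗ (i⁻ ⊗ 1-x^ (suc (j * 2)))
      ≈⟨ ⊗-cong (⊗-cong ≈-refl (invOnePlus-inverse (suc (suc (j * 2 * 3))))) (invOneMinus-inverse (j * 2)) ⟩
    b⁺ ⊗ b⁻ ⊗ const 1ℤ ⊗ const 1ℤ
      ≈⟨ solveR 2 (λ a b → a :* b :* con 1ℤ :* con 1ℤ := a :* b) ≈-refl b⁺ b⁻ ⟩
    b⁺ ⊗ b⁻
      ≈⟨ ⊗-cong (binom-plus (j * 2)) (≈-trans (binom-minus _) (≈-sym (V-1-x^ 2 (suc (j * 2))))) ⟩
    1+x^ (suc (j * 2)) ⊗ V 2 (1-x^ (suc (j * 2))) ∎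
    where
    b⁺ b⁻ i⁺ i⁻ : Series
    b⁺ = binom 1ℤ (suc (j * 2))
    b⁻ = binom (ℤ.- 1ℤ) (suc (j * 2) * 3)
    i⁺ = invOnePlus (suc (j * 2) * 3 ∸ 1)
    i⁻ = invOneMinus (j * 2)
    factor≈ : factor j ≈ b⁺ ⊗ b⁻ ⊗ i⁺ ⊗ i⁻
    factor≈ = ≈-trans (≡⇒≈ (factor≡ j)) (≈-reflexive (cong₂ (λ a b → binom 1ℤ (suc a) ⊗ binom (ℤ.- 1ℤ) b ⊗ invOnePlus (b ∸ 1) ⊗ invOneMinus a)
      (ℕₚ.*-comm 2 j) (trans (ℕₚ.*-comm 3 (suc (2 * j))) (cong (λ a → suc a * 3) (ℕₚ.*-comm 2 j)))))

  partialProd-cleared : ∀ N → partialProd N ⊗ (V 2 (O⁺ N) ⊗ O⁻ N) ≈ O⁺ N ⊗ V 2 (O⁻ N)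
  partialProd-cleared zero    = ≈-trans (⊗-cong (≡⇒≈ partialProd-0) (⊗-cong (≡⇒≈ (V-const 2 1ℤ)) ≈-refl))
    (≈-trans (solveR 0 (con 1ℤ :* (con 1ℤ :* con 1ℤ) := con 1ℤ :* con 1ℤ) ≈-refl) (⊗-cong ≈-refl (≈-sym (≡⇒≈ (V-const 2 1ℤ)))))
  partialProd-cleared (suc N) = begin
    partialProd (suc N) ⊗ (V 2 (O⁺ N ⊗ a) ⊗ (O⁻ N ⊗ b))
      ≈⟨ ⊗-cong (≡⇒≈ (partialProd-suc N)) (⊗-cong (V-⊗≈ 2 (O⁺ N) a) ≈-refl) ⟩
    partialProd N ⊗ factor N ⊗ (V 2 (O⁺ N) ⊗ V 2 a ⊗ (O⁻ N ⊗ b))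
      ≈⟨ solveR 6 (λ p f x y z w → p :* f :* (x :* y :* (z :* w)) := p :* (x :* z) :* (f :* (y :* w))) ≈-refl (partialProd N) (factor N) (V 2 (O⁺ N)) (V 2 a) (O⁻ N) b ⟩
    partialProd N ⊗ (V 2 (O⁺ N) ⊗ O⁻ N) ⊗ (factor N ⊗ (V 2 a ⊗ b))
      ≈⟨ ⊗-cong (partialProd-cleared N) (factor-cleared N) ⟩
    O⁺ N ⊗ V 2 (O⁻ N) ⊗ (a ⊗ V 2 b)
      ≈⟨ solveR 4 (λ a b c d → a :* b :* (c :* d) := a :* c :* (b :* d)) ≈-refl (O⁺ N) (V 2 (O⁻ N)) a (V 2 b) ⟩
    O⁺ N ⊗ a ⊗ (V 2 (O⁻ N) ⊗ V 2 b)
      ≈⟨ ⊗-cong ≈-refl (V-⊗≈ 2 (O⁻ N) b) ⟨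
    O⁺ (suc N) ⊗ V 2 (O⁻ (suc N)) ∎
    where
    a b : Series
    a = 1+x^ (suc (N * 2))
    b = 1-x^ (suc (N * 2))

-- The partial product is O⁺/O⁻ at q divided by O⁺/O⁻ at q³, and O⁺/O⁻ agrees with φ/φ′ to the
-- required precision.
partialProd-theta : ∀ N → Cong 0ℤ (_< N) (partialProd N ⊗ (φ′ ⊗ V 2 φ)) (φ ⊗ V 2 φ′)
partialProd-theta N = cancel ℕₚ.≤-<-trans (V 2 (O⁺ N) ⊗ O⁻ N) (head-⊗ (V 2 (O⁺ N)) (O⁻ N) (head-O⁺ N) (head-O⁻ N)) (begin
  partialProd N ⊗ (φ′ ⊗ V 2 φ) ⊗ (V 2 (O⁺ N) ⊗ O⁻ N)
    ≈⟨ solveR 5 (λ p a b c d → p :* (a :* b) :* (c :* d) := p :* (c :* d) :* (a :* b)) ≈-refl (partialProd N) φ′ (V 2 φ) (V 2 (O⁺ N)) (O⁻ N) ⟩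
  partialProd N ⊗ (V 2 (O⁺ N) ⊗ O⁻ N) ⊗ (φ′ ⊗ V 2 φ)
    ≈⟨ ⊗-cong (exact (partialProd-cleared N)) ≈-refl ⟩
  O⁺ N ⊗ V 2 (O⁻ N) ⊗ (φ′ ⊗ V 2 φ)
    ≈⟨ solveR 4 (λ a b c d → a :* b :* (c :* d) := a :* c :* (b :* d)) ≈-refl (O⁺ N) (V 2 (O⁻ N)) φ′ (V 2 φ) ⟩
  O⁺ N ⊗ φ′ ⊗ (V 2 (O⁻ N) ⊗ V 2 φ)
    ≈⟨ ⊗-cong (≈-sym (O⁻φ≈O⁺φ′ N)) (≈-trans (≈-sym (≡⇒≈ (V-⊗ 2 (O⁻ N) φ))) (≈-trans (V-cong 2 ℕₚ.≤-<-trans (O⁻φ≈O⁺φ′ N)) (≡⇒≈ (V-⊗ 2 (O⁺ N) φ′)))) ⟩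
  O⁻ N ⊗ φ ⊗ (V 2 (O⁺ N) ⊗ V 2 φ′)
    ≈⟨ solveR 4 (λ a b c d → a :* b :* (c :* d) := b :* d :* (c :* a)) ≈-refl (O⁻ N) φ (V 2 (O⁺ N)) (V 2 φ′) ⟩
  φ ⊗ V 2 φ′ ⊗ (V 2 (O⁺ N) ⊗ O⁻ N) ∎)
  where
  open Upto 0ℤ N
  open ≈-Reasoning

head-φ : φ 0 ≡ 1ℤ
head-φ = trans (⊕-at (const 1ℤ) (const (+ 2) ⊗ θ) 0) (cong (λ z → 1ℤ ℤ.+ z) (trans (const-⊗ (+ 2) θ 0) (cong (+ 2 ℤ.*_) (trans (⊕-at (const 0ℤ) (mono 1) 0) refl))))

S3bar-theta : Cong 0ℤ (λ _ → ⊤) (S3bar ⊗ (φ′ ⊗ V 2 φ)) (φ ⊗ V 2 φ′)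
S3bar-theta = limit λ N → Upto.≈-trans 0ℤ N (Upto.⊗-cong 0ℤ N (truncate N) (Upto.≈-refl 0ℤ N)) (partialProd-theta N)
  where
  -- `S3bar` is a diagonal of the partial products. Two of them agree to the smaller precision
  -- because both solve the same theta equation, whose factor φ′ φ(q³) can be cancelled; the single
  -- factors need not be inspected.
  truncate : ∀ N → Cong 0ℤ (_< N) S3bar (partialProd N)
  truncate N = mk λ n n<N → at (cancel ℕₚ.≤-<-trans (φ′ ⊗ V 2 φ) (head-⊗ φ′ (V 2 φ) (trans (ℤₚ.*-identityˡ (φ 0)) head-φ) head-φ)
    (Upto.≈-trans 0ℤ (suc n) (partialProd-theta (suc n)) (Upto.≈-sym 0ℤ (suc n) (weaken (λ k<1+n → ℕₚ.<-≤-trans k<1+n n<N) (partialProd-theta N))))) n ℕₚ.≤-refl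

-- 3-dissection of the theta series

-- (3j+1)² = 1 + 3 a₁ j and (3j+2)² = 1 + 3 a₂ j
a₁ a₂ : ℕ → ℕ
a₁ j = j * (3 * j + 2)
a₂ j = suc (j * (3 * j + 4))

j≤a₁ : ∀ j → j ≤ a₁ j
j≤a₁ j = ℕₚ.≤-trans (ℕₚ.≤-reflexive (sym (ℕₚ.*-identityʳ j))) (ℕₚ.*-monoʳ-≤ j (ℕₚ.≤-trans (s≤s z≤n) (ℕₚ.m≤n+m 2 (3 * j))))

j≤a₂ : ∀ j → j ≤ a₂ j
j≤a₂ j = ℕₚ.m≤n⇒m≤1+n (ℕₚ.≤-trans (ℕₚ.≤-reflexive (sym (ℕₚ.*-identityʳ j))) (ℕₚ.*-monoʳ-≤ j (ℕₚ.≤-trans (s≤s z≤n) (ℕₚ.m≤n+m 4 (3 * j)))))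

-- The sum of q^((k²-1)/3) over the positive k prime to 3; the series b of the dissection of φ is 2
-- ψ.
ψ : Series
ψ = Θ a₁ ⊕ Θ a₂

module _ where
  open Exact
  open ≈-Reasoning
  -- A square is 1 modulo 3 or divisible by 9. As `sq` is indexed from 1, the indices 3M, 3M + 1, 3M
  -- + 2 stand for the roots 3M + 1, 3M + 2, 3M + 3, so the last of each three is the multiple of 3.
  ∑sq-dissection : ∀ M → ∑ (M * 3) (mono ∘ sq) ≈ V 2 (V 2 (∑ M (mono ∘ sq))) ⊕ mono 1 ⊗ V 2 (∑ M (mono ∘ a₁) ⊕ ∑ M (mono ∘ a₂))
  ∑sq-dissection zero = ≈-sym (≈-trans (⊕-cong (≈-trans (V-cong 2 everywhere (≡⇒≈ (V-const 2 0ℤ))) (≡⇒≈ (V-const 2 0ℤ)))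
      (⊗-cong ≈-refl (≈-trans (V-cong 2 everywhere (solveR 0 (con 0ℤ :+ con 0ℤ := con 0ℤ) ≈-refl)) (≡⇒≈ (V-const 2 0ℤ)))))
    (solveR 1 (λ x → con 0ℤ :+ x :* con 0ℤ := con 0ℤ) ≈-refl (mono 1)))
  ∑sq-dissection (suc M) = begin
    ∑ (M * 3) (mono ∘ sq) ⊕ mono (sq (M * 3)) ⊕ mono (sq (1 + M * 3)) ⊕ mono (sq (2 + M * 3))
      ≈⟨ ⊕-cong (⊕-cong (⊕-cong (∑sq-dissection M) first) second) third ⟩
    A ⊕ mono 1 ⊗ V 2 (B ⊕ C) ⊕ mono 1 ⊗ V 2 (mono (a₁ M)) ⊕ mono 1 ⊗ V 2 (mono (a₂ M)) ⊕ V 2 (V 2 (mono (sq M)))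
      ≈⟨ solveR 6 (λ a x b c d e → a :+ x :* b :+ x :* c :+ x :* d :+ e := (a :+ e) :+ x :* (b :+ (c :+ d))) ≈-refl
           A (mono 1) (V 2 (B ⊕ C)) (V 2 (mono (a₁ M))) (V 2 (mono (a₂ M))) (V 2 (V 2 (mono (sq M)))) ⟩
    (A ⊕ V 2 (V 2 (mono (sq M)))) ⊕ mono 1 ⊗ (V 2 (B ⊕ C) ⊕ (V 2 (mono (a₁ M)) ⊕ V 2 (mono (a₂ M))))
      ≈⟨ ⊕-cong (≈-trans (V-cong 2 everywhere (≡⇒≈ (V-⊕ 2 (∑ M (mono ∘ sq)) (mono (sq M))))) (≡⇒≈ (V-⊕ 2 (V 2 (∑ M (mono ∘ sq))) (V 2 (mono (sq M))))))
           (⊗-cong ≈-refl (≈-trans (V-cong 2 everywhere (solveR 4 (λ b c d e → (b :+ d) :+ (c :+ e) := (b :+ c) :+ (d :+ e)) ≈-refl B C (mono (a₁ M)) (mono (a₂ M))))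
             (≈-trans (≡⇒≈ (V-⊕ 2 (B ⊕ C) (mono (a₁ M) ⊕ mono (a₂ M)))) (⊕-cong ≈-refl (≡⇒≈ (V-⊕ 2 (mono (a₁ M)) (mono (a₂ M)))))))) ⟨
    V 2 (V 2 (∑ M (mono ∘ sq) ⊕ mono (sq M))) ⊕ mono 1 ⊗ V 2 ((B ⊕ mono (a₁ M)) ⊕ (C ⊕ mono (a₂ M))) ∎
    where
    A B C : Series
    A = V 2 (V 2 (∑ M (mono ∘ sq)))
    B = ∑ M (mono ∘ a₁)
    C = ∑ M (mono ∘ a₂)
    one-mod-3 : ∀ k m → k ≡ 1 + m * 3 → mono k ≈ mono 1 ⊗ V 2 (mono m)
    one-mod-3 k m refl = ≈-trans (≡⇒≈ (mono-+ 1 (m * 3))) (⊗-cong ≈-refl (≈-sym (≡⇒≈ (V-mono 2 m))))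
    first : mono (sq (M * 3)) ≈ mono 1 ⊗ V 2 (mono (a₁ M))
    first = one-mod-3 (sq (M * 3)) (a₁ M) (solveℕ 1 (λ j → (lit 1 ⊞ j ⊠ lit 3) ⊠ (lit 1 ⊞ j ⊠ lit 3) ≜ lit 1 ⊞ (j ⊠ (lit 3 ⊠ j ⊞ lit 2)) ⊠ lit 3) refl M)
    second : mono (sq (1 + M * 3)) ≈ mono 1 ⊗ V 2 (mono (a₂ M))
    second = one-mod-3 (sq (1 + M * 3)) (a₂ M) (solveℕ 1 (λ j → (lit 2 ⊞ j ⊠ lit 3) ⊠ (lit 2 ⊞ j ⊠ lit 3) ≜ lit 1 ⊞ (lit 1 ⊞ (j ⊠ (lit 3 ⊠ j ⊞ lit 4))) ⊠ lit 3) refl M)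
    third : mono (sq (2 + M * 3)) ≈ V 2 (V 2 (mono (sq M)))
    third = ≈-trans (≈-reflexive (cong mono (solveℕ 1 (λ j → (lit 3 ⊞ j ⊠ lit 3) ⊠ (lit 3 ⊞ j ⊠ lit 3) ≜ (lit 1 ⊞ j) ⊠ (lit 1 ⊞ j) ⊠ lit 3 ⊠ lit 3) refl M)))
      (≈-sym (≈-trans (V-cong 2 everywhere (≡⇒≈ (V-mono 2 (sq M)))) (≡⇒≈ (V-mono 2 (sq M * 3)))))

θ-dissection : Cong 0ℤ (λ _ → ⊤) θ (V 2 (V 2 θ) ⊕ mono 1 ⊗ V 2 ψ)
θ-dissection = limit go
  where
  go : ∀ K → Cong 0ℤ (_< K) θ (V 2 (V 2 θ) ⊕ mono 1 ⊗ V 2 ψ)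
  go K = begin
    θ
      ≈⟨ Θ≈∑ sq k≤sq (ℕₚ.m≤m*n K 3) ⟩
    ∑ (K * 3) (mono ∘ sq)
      ≈⟨ exact (∑sq-dissection K) ⟩
    V 2 (V 2 (∑ K (mono ∘ sq))) ⊕ mono 1 ⊗ V 2 (∑ K (mono ∘ a₁) ⊕ ∑ K (mono ∘ a₂))
      ≈⟨ ⊕-cong (V-cong 2 ℕₚ.≤-<-trans (V-cong 2 ℕₚ.≤-<-trans (Θ≈∑ sq k≤sq ℕₚ.≤-refl)))
           (⊗-cong ≈-refl (V-cong 2 ℕₚ.≤-<-trans (⊕-cong (Θ≈∑ a₁ j≤a₁ ℕₚ.≤-refl) (Θ≈∑ a₂ j≤a₂ ℕₚ.≤-refl)))) ⟨
    V 2 (V 2 θ) ⊕ mono 1 ⊗ V 2 ψ ∎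
    where
    open Upto 0ℤ K
    open ≈-Reasoning

module _ where
  open Exact
  open ≈-Reasoning

  φ-dissection : φ ≈ V 2 (V 2 φ) ⊕ mono 1 ⊗ V 2 (const (+ 2) ⊗ ψ)
  φ-dissection = begin
    const 1ℤ ⊕ const (+ 2) ⊗ θ
      ≈⟨ ⊕-cong ≈-refl (⊗-cong ≈-refl θ-dissection) ⟩
    const 1ℤ ⊕ const (+ 2) ⊗ (V 2 (V 2 θ) ⊕ mono 1 ⊗ V 2 ψ)
      ≈⟨ solveR 3 (λ a x b → con 1ℤ :+ con (+ 2) :* (a :+ x :* b) := (con 1ℤ :+ con (+ 2) :* a) :+ x :* (con (+ 2) :* b)) ≈-refl (V 2 (V 2 θ)) (mono 1) (V 2 ψ) ⟩
    (const 1ℤ ⊕ const (+ 2) ⊗ V 2 (V 2 θ)) ⊕ mono 1 ⊗ (const (+ 2) ⊗ V 2 ψ)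
      ≈⟨ ⊕-cong (≈-trans (V-cong 2 everywhere (≡⇒≈ (V-affine 2 θ))) (≡⇒≈ (V-affine 2 (V 2 θ)))) (⊗-cong ≈-refl (≡⇒≈ (V-scale 2 (+ 2) ψ))) ⟨
    V 2 (V 2 φ) ⊕ mono 1 ⊗ V 2 (const (+ 2) ⊗ ψ) ∎

  φ⁻-dissection : φ⁻ ≈ V 2 (V 2 φ⁻) ⊕ ⊖ (mono 1 ⊗ V 2 (σ (const (+ 2) ⊗ ψ)))
  φ⁻-dissection = begin
    σ φ
      ≈⟨ ≈-trans (σ-cong φ-dissection) (≈-trans (≡⇒≈ (σ-⊕ (V 2 (V 2 φ)) (mono 1 ⊗ V 2 b))) (⊕-cong ≈-refl (σ-⊗≈ (mono 1) (V 2 b)))) ⟩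
    σ (V 2 (V 2 φ)) ⊕ σ (mono 1) ⊗ σ (V 2 b)
      ≈⟨ ⊕-cong (≈-trans (≡⇒≈ (σ-V₃ (V 2 φ))) (V-cong 2 everywhere (≡⇒≈ (σ-V₃ φ)))) (⊗-cong (≡⇒≈ (σ-mono 1)) (≡⇒≈ (σ-V₃ b))) ⟩
    V 2 (V 2 φ⁻) ⊕ const (ℤ.- 1ℤ) ⊗ mono 1 ⊗ V 2 (σ b)
      ≈⟨ ⊕-cong ≈-refl (solveR 2 (λ x y → con (ℤ.- 1ℤ) :* x :* y := :- (x :* y)) ≈-refl (mono 1) (V 2 (σ b))) ⟩
    V 2 (V 2 φ⁻) ⊕ ⊖ (mono 1 ⊗ V 2 (σ b)) ∎
    where b = const (+ 2) ⊗ ψ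

  -- The substitution q ↦ -q² moves the exponents 1 modulo 3 to 2 modulo 3. Thus φ and φ′ occupy
  -- complementary nonzero classes, and their cross term falls into class 0.
  φ′-dissection : φ′ ≈ V 2 (V 2 φ′) ⊕ ⊖ (mono 2 ⊗ V 2 (V 1 (σ (const (+ 2) ⊗ ψ))))
  φ′-dissection = begin
    V 1 φ⁻
      ≈⟨ ≈-trans (V-cong 1 everywhere φ⁻-dissection) (≡⇒≈ (V-⊕ 1 (V 2 (V 2 φ⁻)) (⊖ (mono 1 ⊗ V 2 b)))) ⟩
    V 1 (V 2 (V 2 φ⁻)) ⊕ V 1 (⊖ (mono 1 ⊗ V 2 b))
      ≈⟨ ⊕-cong (≈-trans (≡⇒≈ (V₂-V₃ (V 2 φ⁻))) (V-cong 2 everywhere (≡⇒≈ (V₂-V₃ φ⁻))))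
           (≈-trans (V-⊖ 1 (mono 1 ⊗ V 2 b)) (⊖-cong (≈-trans (V-⊗≈ 1 (mono 1) (V 2 b)) (⊗-cong (≡⇒≈ (V-mono 1 1)) (≡⇒≈ (V₂-V₃ b)))))) ⟩
    V 2 (V 2 φ′) ⊕ ⊖ (mono 2 ⊗ V 2 (V 1 b)) ∎
    where b = σ (const (+ 2) ⊗ ψ)

U-mono-V : ∀ m j f n → 0 < j → j ≤ m → U m (mono j ⊗ V m f) n ≡ 0ℤ
U-mono-V m j f n 0<j j≤m = trans (mono-⊗ j (V m f) (n * suc m)) (gap n)
  where
  low : ∀ i f k → k < i → spread m i f k ≡ 0ℤ
  low i f k k<i = trans (spread-shifts m i f k) (shifts-low i (V m f) k k<i)
  vgap : ∀ n f r → 0 < r → r ≤ m → V m f (r + n * suc m) ≡ 0ℤ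
  vgap zero f (suc r) _ r<m = low m (tail f) (r + 0) (subst (_< m) (sym (ℕₚ.+-identityʳ r)) r<m)
  vgap (suc n) f (suc r) 0<r r<m = trans (cong (spread m m (tail f)) e) (trans (spread-shifts m m (tail f) (m + (suc r + n * suc m))) (trans (shifts-skip m (V m (tail f)) (suc r + n * suc m)) (vgap n (tail f) (suc r) 0<r r<m)))
    where
    e : r + suc (m + n * suc m) ≡ m + suc (r + n * suc m)
    e = solveℕ 3 (λ r m x → r ⊞ (lit 1 ⊞ (m ⊞ x)) ≜ m ⊞ (lit 1 ⊞ (r ⊞ x))) refl r m (n * suc m)
  gap : ∀ n → shifts j (V m f) (n * suc m) ≡ 0ℤ
  gap zero    = shifts-low j (V m f) 0 0<j
  gap (suc n) = trans (cong (shifts j (V m f)) e) (trans (shifts-skip j (V m f) (suc m ∸ j + n * suc m)) (vgap n f (suc m ∸ j) (ℕₚ.m<n⇒0<n∸m (s≤s j≤m)) (bound j 0<j)))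
    where
    e : suc n * suc m ≡ j + (suc m ∸ j + n * suc m)
    e = trans (cong (_+ n * suc m) (sym (ℕₚ.m+[n∸m]≡n (ℕₚ.m≤n⇒m≤1+n j≤m)))) (ℕₚ.+-assoc j (suc m ∸ j) (n * suc m))
    bound : ∀ j → 0 < j → suc m ∸ j ≤ m
    bound (suc j) _ = ℕₚ.m∸n≤m m j

-- Sums of two squares

∑-⊗ : ∀ M F g → Cong 0ℤ (λ _ → ⊤) (g ⊗ ∑ M F) (∑ M (λ k → g ⊗ F k))
∑-⊗ zero    F g = Exact.solveR 1 (λ g → g Exact.:* Exact.con 0ℤ Exact.:= Exact.con 0ℤ) Exact.≈-refl g
∑-⊗ (suc M) F g = Exact.≈-trans (Exact.solveR 3 (λ g a b → g Exact.:* (a Exact.:+ b) Exact.:= g Exact.:* a Exact.:+ g Exact.:* b) Exact.≈-refl g (∑ M F) (F M)) (Exact.⊕-cong (∑-⊗ M F g) Exact.≈-refl)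

∑-cong : ∀ {d P} (down : DownClosed P) M {F G} → (∀ k → Cong d P (F k) (G k)) → Cong d P (∑ M F) (∑ M G)
∑-cong {d} {P} down zero    e = Mod.≈-refl d P down
∑-cong {d} {P} down (suc M) e = Mod.⊕-cong d P down (∑-cong down M e) (e M)

∑-head : ∀ M F → Cong 0ℤ (λ _ → ⊤) (∑ (suc M) F) (F 0 ⊕ ∑ M (F ∘ suc))
∑-head zero    F = solveR 1 (λ x → con 0ℤ :+ x := x :+ con 0ℤ) ≈-refl (F 0)
  where open Exact
∑-head (suc M) F = ≈-trans (⊕-cong (∑-head M F) ≈-refl) (solveR 3 (λ a b c → a :+ b :+ c := a :+ (b :+ c)) ≈-refl (F 0) (∑ M (F ∘ suc)) (F (suc M)))
  where open Exact

-- Both sides count ordered pairs (x, y); the right-hand sum runs over min x y and |x - y|.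
square-expansion : ∀ K M J j → K ≤ M →
  let X = λ j → ∑ M (λ e → mono (sq (j + e))) in
  Cong 0ℤ (_< K) (X j ⊗ X j)
    (∑ J (λ i → mono (2 * sq (j + i)) ⊕ const (+ 2) ⊗ ∑ M (λ e → mono (sq (j + i) + sq (suc (j + i) + e)))) ⊕ X (j + J) ⊗ X (j + J))
square-expansion K M zero j K≤M = ≈-trans (≈-reflexive (cong (λ i → X i ⊗ X i) (sym (ℕₚ.+-identityʳ j))))
  (solveR 1 (λ x → x := con 0ℤ :+ x) ≈-refl (X (j + 0) ⊗ X (j + 0)))
  where
  open Upto 0ℤ K
  X : ℕ → Series
  X j = ∑ M (λ e → mono (sq (j + e)))
square-expansion K M (suc J) j K≤M = begin
  X j ⊗ X j
    ≈⟨ square-expansion K M J j K≤M ⟩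
  S ⊕ X (j + J) ⊗ X (j + J)
    ≈⟨ ⊕-cong ≈-refl (⊗-cong peel peel) ⟩
  S ⊕ (m ⊕ X (suc (j + J))) ⊗ (m ⊕ X (suc (j + J)))
    ≈⟨ solveR 3 (λ s m x → s :+ (m :+ x) :* (m :+ x) := s :+ (m :* m :+ con (+ 2) :* (m :* x)) :+ x :* x) ≈-refl S m (X (suc (j + J))) ⟩
  S ⊕ (m ⊗ m ⊕ const (+ 2) ⊗ (m ⊗ X (suc (j + J)))) ⊕ X (suc (j + J)) ⊗ X (suc (j + J))
    ≈⟨ ⊕-cong (⊕-cong ≈-refl (⊕-cong
         (≈-trans (≈-sym (≡⇒≈ (mono-+ (sq (j + J)) (sq (j + J))))) (≈-reflexive (cong mono (solveℕ 1 (λ x → x ⊞ x ≜ lit 2 ⊠ x) refl (sq (j + J))))))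
         (⊗-cong ≈-refl (≈-trans (exact (∑-⊗ M _ m)) (∑-cong ℕₚ.≤-<-trans M (λ e → ≈-sym (≡⇒≈ (mono-+ (sq (j + J)) (sq (suc (j + J) + e))))))))))
         (≈-reflexive (cong (λ i → X i ⊗ X i) (sym (ℕₚ.+-suc j J)))) ⟩
  ∑ (suc J) (λ i → mono (2 * sq (j + i)) ⊕ const (+ 2) ⊗ ∑ M (λ e → mono (sq (j + i) + sq (suc (j + i) + e)))) ⊕ X (j + suc J) ⊗ X (j + suc J) ∎
  where
  open Upto 0ℤ K
  open ≈-Reasoning
  X : ℕ → Series
  X j = ∑ M (λ e → mono (sq (j + e)))
  S m : Series
  S = ∑ J (λ i → mono (2 * sq (j + i)) ⊕ const (+ 2) ⊗ ∑ M (λ e → mono (sq (j + i) + sq (suc (j + i) + e))))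
  m = mono (sq (j + J))
  peel : X (j + J) ≈ m ⊕ X (suc (j + J))
  peel = begin
    ∑ M (λ e → mono (sq (j + J + e)))
      ≈⟨ solveR 1 (λ x → x := x :+ con 0ℤ) ≈-refl _ ⟩
    ∑ M (λ e → mono (sq (j + J + e))) ⊕ const 0ℤ
      -- The window is lengthened by its term e = M, whose exponent is at least K and hence
      -- invisible, so that M terms are left once the first is removed.
      ≈⟨ ⊕-cong ≈-refl (≈-sym (mono≈0 _ (ℕₚ.≤-trans K≤M (ℕₚ.≤-trans (ℕₚ.m≤n+m M (j + J)) (k≤sq (j + J + M)))))) ⟩
    ∑ (suc M) (λ e → mono (sq (j + J + e)))
      ≈⟨ exact (∑-head M (λ e → mono (sq (j + J + e)))) ⟩
    mono (sq (j + J + 0)) ⊕ ∑ M (λ e → mono (sq (j + J + suc e)))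
      ≈⟨ ⊕-cong (≈-reflexive (cong (mono ∘ sq) (ℕₚ.+-identityʳ (j + J)))) (∑-cong ℕₚ.≤-<-trans M (λ e → ≈-reflexive (cong (mono ∘ sq) (ℕₚ.+-suc (j + J) e)))) ⟩
    m ⊕ X (suc (j + J)) ∎

U-cong : ∀ m {d K f g} → Cong d (_< K * suc m) f g → Cong d (_< K) (U m f) (U m g)
U-cong m e = mk λ n n<K → at e (n * suc m) (ℕₚ.*-monoˡ-< (suc m) n<K)

U-cong∞ : ∀ m {d f g} → Cong d (λ _ → ⊤) f g → Cong d (λ _ → ⊤) (U m f) (U m g)
U-cong∞ m e = mk λ n _ → at e (n * suc m) tt

module _ where
  open Exact
  open ≈-Reasoning

  U-⊕≈ : ∀ m f g → U m (f ⊕ g) ≈ U m f ⊕ U m g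
  U-⊕≈ m f g = ≡⇒≈ (U-⊕ m f g)

  U-const : ∀ m c → U m (const c) ≈ const c
  U-const m c = ≡⇒≈ λ { zero → refl ; (suc n) → refl }

  U-∑ : ∀ m M F → U m (∑ M F) ≈ ∑ M (λ k → U m (F k))
  U-∑ m zero    F = U-const m 0ℤ
  U-∑ m (suc M) F = ≈-trans (U-⊕≈ m (∑ M F) (F M)) (⊕-cong (U-∑ m M F) ≈-refl)

  ∑-⊕ : ∀ M F G → ∑ M (λ k → F k ⊕ G k) ≈ ∑ M F ⊕ ∑ M G
  ∑-⊕ zero    F G = solveR 0 (con 0ℤ := con 0ℤ :+ con 0ℤ) ≈-refl
  ∑-⊕ (suc M) F G = ≈-trans (⊕-cong (∑-⊕ M F G) ≈-refl)
    (solveR 4 (λ a b c d → a :+ b :+ (c :+ d) := (a :+ c) :+ (b :+ d)) ≈-refl (∑ M F) (∑ M G) (F M) (G M))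

  ∑-zero : ∀ M → ∑ M (λ _ → const 0ℤ) ≈ const 0ℤ
  ∑-zero zero    = ≈-refl
  ∑-zero (suc M) = ≈-trans (⊕-cong (∑-zero M) ≈-refl) (solveR 0 (con 0ℤ :+ con 0ℤ := con 0ℤ) ≈-refl)

  ∑-swap : ∀ M N (F : ℕ → ℕ → Series) → ∑ M (λ i → ∑ N (F i)) ≈ ∑ N (λ j → ∑ M (λ i → F i j))
  ∑-swap zero    N F = ≈-sym (∑-zero N)
  ∑-swap (suc M) N F = ≈-trans (⊕-cong (∑-swap M N F) ≈-refl) (≈-sym (∑-⊕ N _ _))

  ∑-pairs : ∀ M F → ∑ (M * 2) F ≈ ∑ M (λ v → F (v * 2) ⊕ F (suc (v * 2)))
  ∑-pairs zero    F = ≈-refl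
  ∑-pairs (suc M) F = ≈-trans (⊕-cong (⊕-cong (∑-pairs M F) ≈-refl) ≈-refl)
    (solveR 3 (λ a b c → a :+ b :+ c := a :+ (b :+ c)) ≈-refl (∑ M (λ v → F (v * 2) ⊕ F (suc (v * 2)))) (F (M * 2)) (F (suc (M * 2))))

  U-even : ∀ {k} m → k ≡ m * 2 → U 1 (mono k) ≈ mono m
  U-even m refl = ≈-trans (U-cong∞ 1 (≈-sym (≡⇒≈ (V-mono 1 m)))) (≡⇒≈ (U-V 1 (mono m)))

  U-odd : ∀ {k} m → k ≡ 1 + m * 2 → U 1 (mono k) ≈ const 0ℤ
  U-odd m refl = ≈-trans (U-cong∞ 1 (≈-trans (≡⇒≈ (mono-+ 1 (m * 2))) (⊗-cong ≈-refl (≈-sym (≡⇒≈ (V-mono 1 m))))))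
    (≡⇒≈ λ n → trans (U-mono-V 1 1 (mono m) n (s≤s z≤n) (s≤s z≤n)) (sym (const-0 n)))

  drop-zero : ∀ {f g h} → f ≈ const 0ℤ → g ≈ h → f ⊕ g ≈ h
  drop-zero {h = h} e e′ = ≈-trans (⊕-cong e e′) (solveR 1 (λ h → con 0ℤ :+ h := h) ≈-refl h)

X : ℕ → ℕ → Series
X M j = ∑ M (λ e → mono (sq (j + e)))

-- Each pair of distinct positive integers is met once, through its smaller member i + 1 and its
-- difference e + 1.
pairs : ℕ → ℕ → Series
pairs J M = ∑ J (λ i → ∑ M (λ e → mono (sq i + sq (suc i + e))))

θ²-expansion : ∀ {K J M} → K ≤ J → K ≤ M →
  Cong 0ℤ (_< K) (θ ⊗ θ) (∑ J (λ i → mono (2 * sq i)) ⊕ const (+ 2) ⊗ pairs J M)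
θ²-expansion {K} {J} {M} K≤J K≤M = begin
  θ ⊗ θ
    ≈⟨ ⊗-cong (Θ≈∑ sq k≤sq K≤M) (Θ≈∑ sq k≤sq K≤M) ⟩
  X M 0 ⊗ X M 0
    ≈⟨ square-expansion K M J 0 K≤M ⟩
  ∑ J (λ i → mono (2 * sq i) ⊕ const (+ 2) ⊗ ∑ M (λ e → mono (sq i + sq (suc i + e)))) ⊕ X M J ⊗ X M J
    ≈⟨ ⊕-cong (≈-trans (exact (∑-⊕ J _ _)) (⊕-cong ≈-refl (exact (Exact.≈-sym (∑-⊗ J _ (const (+ 2))))))) (⊗-cong tail≈0 ≈-refl) ⟩
  (∑ J (λ i → mono (2 * sq i)) ⊕ const (+ 2) ⊗ pairs J M) ⊕ const 0ℤ ⊗ X M J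
    ≈⟨ solveR 2 (λ a b → a :+ con 0ℤ :* b := a) ≈-refl _ (X M J) ⟩
  ∑ J (λ i → mono (2 * sq i)) ⊕ const (+ 2) ⊗ pairs J M ∎
  where
  open Upto 0ℤ K
  open ≈-Reasoning
  tail≈0 : X M J ≈ const 0ℤ
  tail≈0 = ≈-trans (∑-cong ℕₚ.≤-<-trans M (λ e → mono≈0 (sq (J + e)) (ℕₚ.≤-trans K≤J (ℕₚ.≤-trans (ℕₚ.m≤m+n J e) (k≤sq (J + e)))))) (exact (∑-zero M))

-- Only even roots survive, and (2x)²/2 = 2x²: halving turns `θ` into the diagonal x = y of θ².
U₂-θ : ∀ K → Cong 0ℤ (_< K) (U 1 θ) (∑ K (λ i → mono (2 * sq i)))
U₂-θ K = begin
  U 1 θ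
    ≈⟨ U-cong 1 (Θ≈∑ sq k≤sq ℕₚ.≤-refl) ⟩
  U 1 (∑ (K * 2) (mono ∘ sq))
    ≈⟨ exact (Exact.≈-trans (U-cong∞ 1 (∑-pairs K (mono ∘ sq))) (U-∑ 1 K _)) ⟩
  ∑ K (λ v → U 1 (mono (sq (v * 2)) ⊕ mono (sq (suc (v * 2)))))
    ≈⟨ ∑-cong ℕₚ.≤-<-trans K (λ v → exact (Exact.≈-trans (U-⊕≈ 1 _ _) (drop-zero
         (U-odd (v * 2 * suc v) (solveℕ 1 (λ v → (lit 1 ⊞ v ⊠ lit 2) ⊠ (lit 1 ⊞ v ⊠ lit 2) ≜ lit 1 ⊞ v ⊠ lit 2 ⊠ (lit 1 ⊞ v) ⊠ lit 2) refl v))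
         (U-even (2 * sq v) (solveℕ 1 (λ v → (lit 2 ⊞ v ⊠ lit 2) ⊠ (lit 2 ⊞ v ⊠ lit 2) ≜ lit 2 ⊠ ((lit 1 ⊞ v) ⊠ (lit 1 ⊞ v)) ⊠ lit 2) refl v))))) ⟩
  ∑ K (λ v → mono (2 * sq v)) ∎
  where
  open Upto 0ℤ K
  open ≈-Reasoning

-- a² + (a + 2b)² = 2 (b² + (a + b)²)
U₂-pairs : ∀ K → Cong 0ℤ (_< K) (U 1 (pairs (K * 2) (K * 2))) (pairs K (K * 2))
U₂-pairs K = begin
  U 1 (pairs (K * 2) (K * 2))
    ≈⟨ exact (Exact.≈-trans (U-∑ 1 (K * 2) _) (∑-cong everywhere (K * 2) (λ i → Exact.≈-trans (U-cong∞ 1 (∑-pairs K _)) (U-∑ 1 K _)))) ⟩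
  ∑ (K * 2) (λ i → ∑ K (λ v → U 1 (mono (sq i + sq (suc i + v * 2)) ⊕ mono (sq i + sq (suc i + suc (v * 2))))))
    ≈⟨ ∑-cong ℕₚ.≤-<-trans (K * 2) (λ i → ∑-cong ℕₚ.≤-<-trans K (λ v → exact (Exact.≈-trans (U-⊕≈ 1 _ _) (drop-zero
         (U-odd (suc (suc (i * i + i * v * 2 + 3 * i + v * v * 2 + 4 * v))) (solveℕ 2 (λ i v →
            (lit 1 ⊞ i) ⊠ (lit 1 ⊞ i) ⊞ (lit 1 ⊞ (lit 1 ⊞ i ⊞ v ⊠ lit 2)) ⊠ (lit 1 ⊞ (lit 1 ⊞ i ⊞ v ⊠ lit 2))
              ≜ lit 1 ⊞ (lit 1 ⊞ (lit 1 ⊞ (i ⊠ i ⊞ i ⊠ v ⊠ lit 2 ⊞ lit 3 ⊠ i ⊞ v ⊠ v ⊠ lit 2 ⊞ lit 4 ⊠ v))) ⊠ lit 2) refl i v))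
         (U-even (sq v + sq (suc v + i)) (solveℕ 2 (λ i v →
            (lit 1 ⊞ i) ⊠ (lit 1 ⊞ i) ⊞ (lit 1 ⊞ (lit 1 ⊞ i ⊞ (lit 1 ⊞ v ⊠ lit 2))) ⊠ (lit 1 ⊞ (lit 1 ⊞ i ⊞ (lit 1 ⊞ v ⊠ lit 2)))
              ≜ ((lit 1 ⊞ v) ⊠ (lit 1 ⊞ v) ⊞ (lit 1 ⊞ (lit 1 ⊞ v ⊞ i)) ⊠ (lit 1 ⊞ (lit 1 ⊞ v ⊞ i))) ⊠ lit 2) refl i v)))))) ⟩
  ∑ (K * 2) (λ i → ∑ K (λ v → mono (sq v + sq (suc v + i))))
    -- Halving has made v + 1 the smaller member and i + 1 the difference, so exchanging the sums
    -- restores the shape of `pairs`.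
    ≈⟨ exact (∑-swap (K * 2) K _) ⟩
  pairs K (K * 2) ∎
  where
  open Upto 0ℤ K
  open ≈-Reasoning

-- This is r₂(2n) = r₂(n) on one quadrant: φ² = 1 + 4 (θ + θ²), with θ for a half-axis and θ² for
-- the interior. Halving sends axis points to diagonal ones and diagonal points to axis ones, and
-- permutes the rest, as division by 1 + i does on Gaussian integers.
U₂-θ² : Cong 0ℤ (λ _ → ⊤) (U 1 θ ⊕ U 1 (θ ⊗ θ)) (θ ⊕ θ ⊗ θ)
U₂-θ² = limit go
  where
  a : ℕ → Series
  a J = ∑ J (λ i → mono (2 * sq i))
  go : ∀ K → Cong 0ℤ (_< K) (U 1 θ ⊕ U 1 (θ ⊗ θ)) (θ ⊕ θ ⊗ θ)
  go K = begin
    U 1 θ ⊕ U 1 (θ ⊗ θ)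
      ≈⟨ ⊕-cong (U₂-θ K) (≈-trans (U-cong 1 (θ²-expansion {K * 2} {K * 2} {K * 2} ℕₚ.≤-refl ℕₚ.≤-refl)) (exact (U-⊕≈ 1 _ _))) ⟩
    a K ⊕ (U 1 (a (K * 2)) ⊕ U 1 (const (+ 2) ⊗ pairs (K * 2) (K * 2)))
      ≈⟨ ⊕-cong ≈-refl (⊕-cong
           (≈-trans (exact (Exact.≈-trans (U-∑ 1 (K * 2) _) (∑-cong everywhere (K * 2) (λ i → U-even (sq i) (ℕₚ.*-comm 2 (sq i))))))
                    (≈-sym (Θ≈∑ sq k≤sq (ℕₚ.m≤m*n K 2))))
           (≈-trans (≡⇒≈ (U-scale 1 (+ 2) (pairs (K * 2) (K * 2)))) (⊗-cong ≈-refl (U₂-pairs K)))) ⟩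
    a K ⊕ (θ ⊕ const (+ 2) ⊗ pairs K (K * 2))
      ≈⟨ solveR 3 (λ a b c → a :+ (b :+ c) := b :+ (a :+ c)) ≈-refl (a K) θ (const (+ 2) ⊗ pairs K (K * 2)) ⟩
    θ ⊕ (a K ⊕ const (+ 2) ⊗ pairs K (K * 2))
      ≈⟨ ⊕-cong ≈-refl (θ²-expansion ℕₚ.≤-refl (ℕₚ.m≤m*n K 2)) ⟨
    θ ⊕ θ ⊗ θ ∎
    where
    open Upto 0ℤ K
    open ≈-Reasoning

U₂-φ² : Cong 0ℤ (λ _ → ⊤) (U 1 (φ ⊗ φ)) (φ ⊗ φ)
U₂-φ² = begin
  U 1 (φ ⊗ φ)
    ≈⟨ U-cong∞ 1 expand ⟩
  U 1 (const 1ℤ ⊕ const (+ 4) ⊗ (θ ⊕ θ ⊗ θ))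
    ≈⟨ ≈-trans (U-⊕≈ 1 _ _) (⊕-cong (U-const 1 1ℤ) (≈-trans (≡⇒≈ (U-scale 1 (+ 4) (θ ⊕ θ ⊗ θ))) (⊗-cong ≈-refl (≈-trans (U-⊕≈ 1 θ (θ ⊗ θ)) U₂-θ²)))) ⟩
  const 1ℤ ⊕ const (+ 4) ⊗ (θ ⊕ θ ⊗ θ)
    ≈⟨ expand ⟨
  φ ⊗ φ ∎
  where
  open Exact
  open ≈-Reasoning
  expand : φ ⊗ φ ≈ const 1ℤ ⊕ const (+ 4) ⊗ (θ ⊕ θ ⊗ θ)
  expand = solveR 1 (λ t → (con 1ℤ :+ con (+ 2) :* t) :* (con 1ℤ :+ con (+ 2) :* t) := con 1ℤ :+ con (+ 4) :* (t :+ t :* t)) ≈-refl θ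

-- Parts of theta products with exponents divisible by 3

module _ where
  open Exact
  open ≈-Reasoning

  mono-2 : mono 2 ≈ mono 1 ⊗ mono 1
  mono-2 = ≡⇒≈ (mono-+ 1 1)

  V₃-mono-1 : V 2 (mono 1) ≈ mono 1 ⊗ mono 1 ⊗ mono 1
  V₃-mono-1 = ≈-trans (≡⇒≈ (V-mono 2 1)) (≈-trans (≡⇒≈ (mono-+ 2 1)) (⊗-cong mono-2 ≈-refl))

  U₃-parts : ∀ f g h → U 2 (V 2 f ⊕ mono 1 ⊗ V 2 g ⊕ mono 2 ⊗ V 2 h) ≈ f
  U₃-parts f g h = begin
    U 2 (V 2 f ⊕ mono 1 ⊗ V 2 g ⊕ mono 2 ⊗ V 2 h)
      ≈⟨ ≈-trans (U-⊕≈ 2 _ _) (⊕-cong (U-⊕≈ 2 _ _) ≈-refl) ⟩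
    U 2 (V 2 f) ⊕ U 2 (mono 1 ⊗ V 2 g) ⊕ U 2 (mono 2 ⊗ V 2 h)
      ≈⟨ ⊕-cong (⊕-cong (≡⇒≈ (U-V 2 f)) (vanish 1 g (s≤s z≤n) (s≤s z≤n))) (vanish 2 h (s≤s z≤n) (s≤s (s≤s z≤n))) ⟩
    f ⊕ const 0ℤ ⊕ const 0ℤ
      ≈⟨ solveR 1 (λ f → f :+ con 0ℤ :+ con 0ℤ := f) ≈-refl f ⟩
    f ∎
    where
    vanish : ∀ j g → 0 < j → j ≤ 2 → U 2 (mono j ⊗ V 2 g) ≈ const 0ℤ
    vanish j g 0<j j≤2 = ≡⇒≈ λ n → trans (U-mono-V 2 j g n 0<j j≤2) (sym (const-0 n))

  module _ (f g a b a′ b′ : Series) (f≈ : f ≈ V 2 a ⊕ mono 1 ⊗ V 2 b) (g≈ : g ≈ V 2 a′ ⊕ ⊖ (mono 2 ⊗ V 2 b′)) where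
    private
      x A B A′ B′ : Series
      x  = mono 1
      A  = V 2 a
      B  = V 2 b
      A′ = V 2 a′
      B′ = V 2 b′

      g≈′ : g ≈ A′ ⊕ ⊖ (x ⊗ x ⊗ B′)
      g≈′ = ≈-trans g≈ (⊕-cong ≈-refl (⊖-cong (⊗-cong mono-2 ≈-refl)))

      V-⊗₂ : ∀ u v → V 2 (u ⊗ v) ≈ V 2 u ⊗ V 2 v
      V-⊗₂ = V-⊗≈ 2

      V-⊗₃ : ∀ u v w → V 2 (u ⊗ v ⊗ w) ≈ V 2 u ⊗ V 2 v ⊗ V 2 w
      V-⊗₃ u v w = ≈-trans (V-⊗₂ (u ⊗ v) w) (⊗-cong (V-⊗₂ u v) ≈-refl)

      V-scaled : ∀ c u v w → V 2 (const c ⊗ (u ⊗ v ⊗ w)) ≈ const c ⊗ (V 2 u ⊗ V 2 v ⊗ V 2 w)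
      V-scaled c u v w = ≈-trans (≡⇒≈ (V-scale 2 c (u ⊗ v ⊗ w))) (⊗-cong ≈-refl (V-⊗₃ u v w))

      V-x⊗ : ∀ u v w → V 2 (x ⊗ (u ⊗ v ⊗ w)) ≈ x ⊗ x ⊗ x ⊗ (V 2 u ⊗ V 2 v ⊗ V 2 w)
      V-x⊗ u v w = ≈-trans (V-⊗₂ x (u ⊗ v ⊗ w)) (⊗-cong V₃-mono-1 (V-⊗₃ u v w))

      V-core : ∀ u → V 2 (u ⊗ (a ⊗ a′ ⊕ const (ℤ.- + 2) ⊗ (x ⊗ b ⊗ b′))) ≈ V 2 u ⊗ (A ⊗ A′ ⊕ const (ℤ.- + 2) ⊗ (x ⊗ x ⊗ x ⊗ B ⊗ B′))
      V-core u = ≈-trans (V-⊗₂ u _) (⊗-cong ≈-refl (≈-trans (≡⇒≈ (V-⊕ 2 _ _)) (⊕-cong (V-⊗₂ a a′)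
        (≈-trans (V-scaled (ℤ.- + 2) x b b′) (⊗-cong ≈-refl (⊗-cong (⊗-cong V₃-mono-1 ≈-refl) ≈-refl))))))

    -- For f = A + x B and g = A′ - x² B′, the class 0 part of f g² is A′ (A A′ - 2 x³ B B′), and
    -- that of g f² is A (A A′ - 2 x³ B B′). The shared bracket is what makes the ratio of the two
    -- so simple.
    U₃-fgg : U 2 (f ⊗ g ⊗ g) ≈ a′ ⊗ (a ⊗ a′ ⊕ const (ℤ.- + 2) ⊗ (x ⊗ b ⊗ b′))
    U₃-fgg = begin
      U 2 (f ⊗ g ⊗ g)
        ≈⟨ U-cong∞ 2 (⊗-cong (⊗-cong f≈ g≈′) g≈′) ⟩
      U 2 ((A ⊕ x ⊗ B) ⊗ (A′ ⊕ ⊖ (x ⊗ x ⊗ B′)) ⊗ (A′ ⊕ ⊖ (x ⊗ x ⊗ B′)))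
        ≈⟨ U-cong∞ 2 (solveR 5 (λ x A B A′ B′ → (A :+ x :* B) :* (A′ :+ :- (x :* x :* B′)) :* (A′ :+ :- (x :* x :* B′))
             := A′ :* (A :* A′ :+ con (ℤ.- + 2) :* (x :* x :* x :* B :* B′))
                :+ x :* (B :* A′ :* A′ :+ x :* x :* x :* (A :* B′ :* B′))
                :+ x :* x :* (con (ℤ.- + 2) :* (A :* A′ :* B′) :+ x :* x :* x :* (B :* B′ :* B′))) ≈-refl x A B A′ B′) ⟩
      U 2 (A′ ⊗ (A ⊗ A′ ⊕ const (ℤ.- + 2) ⊗ (x ⊗ x ⊗ x ⊗ B ⊗ B′))
           ⊕ x ⊗ (B ⊗ A′ ⊗ A′ ⊕ x ⊗ x ⊗ x ⊗ (A ⊗ B′ ⊗ B′))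
           ⊕ x ⊗ x ⊗ (const (ℤ.- + 2) ⊗ (A ⊗ A′ ⊗ B′) ⊕ x ⊗ x ⊗ x ⊗ (B ⊗ B′ ⊗ B′)))
        ≈⟨ U-cong∞ 2 (⊕-cong (⊕-cong (V-core a′)
             (⊗-cong ≈-refl (≈-trans (≡⇒≈ (V-⊕ 2 _ _)) (⊕-cong (V-⊗₃ b a′ a′) (V-x⊗ a b′ b′)))))
             (⊗-cong mono-2 (≈-trans (≡⇒≈ (V-⊕ 2 _ _)) (⊕-cong (V-scaled (ℤ.- + 2) a a′ b′) (V-x⊗ b b′ b′))))) ⟨
      U 2 (V 2 (a′ ⊗ (a ⊗ a′ ⊕ const (ℤ.- + 2) ⊗ (x ⊗ b ⊗ b′)))
           ⊕ x ⊗ V 2 (b ⊗ a′ ⊗ a′ ⊕ x ⊗ (a ⊗ b′ ⊗ b′))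
           ⊕ mono 2 ⊗ V 2 (const (ℤ.- + 2) ⊗ (a ⊗ a′ ⊗ b′) ⊕ x ⊗ (b ⊗ b′ ⊗ b′)))
        ≈⟨ U₃-parts _ _ _ ⟩
      a′ ⊗ (a ⊗ a′ ⊕ const (ℤ.- + 2) ⊗ (x ⊗ b ⊗ b′)) ∎

    U₃-gff : U 2 (g ⊗ f ⊗ f) ≈ a ⊗ (a ⊗ a′ ⊕ const (ℤ.- + 2) ⊗ (x ⊗ b ⊗ b′))
    U₃-gff = begin
      U 2 (g ⊗ f ⊗ f)
        ≈⟨ U-cong∞ 2 (⊗-cong (⊗-cong g≈′ f≈) f≈) ⟩
      U 2 ((A′ ⊕ ⊖ (x ⊗ x ⊗ B′)) ⊗ (A ⊕ x ⊗ B) ⊗ (A ⊕ x ⊗ B))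
        ≈⟨ U-cong∞ 2 (solveR 5 (λ x A B A′ B′ → (A′ :+ :- (x :* x :* B′)) :* (A :+ x :* B) :* (A :+ x :* B)
             := A :* (A :* A′ :+ con (ℤ.- + 2) :* (x :* x :* x :* B :* B′))
                :+ x :* (con (+ 2) :* (A′ :* A :* B) :+ con (ℤ.- 1ℤ) :* (x :* x :* x :* (B′ :* B :* B)))
                :+ x :* x :* (A′ :* B :* B :+ con (ℤ.- 1ℤ) :* (B′ :* A :* A))) ≈-refl x A B A′ B′) ⟩
      U 2 (A ⊗ (A ⊗ A′ ⊕ const (ℤ.- + 2) ⊗ (x ⊗ x ⊗ x ⊗ B ⊗ B′))
           ⊕ x ⊗ (const (+ 2) ⊗ (A′ ⊗ A ⊗ B) ⊕ const (ℤ.- 1ℤ) ⊗ (x ⊗ x ⊗ x ⊗ (B′ ⊗ B ⊗ B)))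
           ⊕ x ⊗ x ⊗ (A′ ⊗ B ⊗ B ⊕ const (ℤ.- 1ℤ) ⊗ (B′ ⊗ A ⊗ A)))
        ≈⟨ U-cong∞ 2 (⊕-cong (⊕-cong (V-core a)
             (⊗-cong ≈-refl (≈-trans (≡⇒≈ (V-⊕ 2 _ _)) (⊕-cong (V-scaled (+ 2) a′ a b) (≈-trans (≡⇒≈ (V-scale 2 (ℤ.- 1ℤ) _)) (⊗-cong ≈-refl (V-x⊗ b′ b b)))))))
             (⊗-cong mono-2 (≈-trans (≡⇒≈ (V-⊕ 2 _ _)) (⊕-cong (V-⊗₃ a′ b b) (V-scaled (ℤ.- 1ℤ) b′ a a))))) ⟨
      U 2 (V 2 (a ⊗ (a ⊗ a′ ⊕ const (ℤ.- + 2) ⊗ (x ⊗ b ⊗ b′)))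
           ⊕ x ⊗ V 2 (const (+ 2) ⊗ (a′ ⊗ a ⊗ b) ⊕ const (ℤ.- 1ℤ) ⊗ (x ⊗ (b′ ⊗ b ⊗ b)))
           ⊕ mono 2 ⊗ V 2 (a′ ⊗ b ⊗ b ⊕ const (ℤ.- 1ℤ) ⊗ (b′ ⊗ a ⊗ a)))
        ≈⟨ U₃-parts _ _ _ ⟩
      a ⊗ (a ⊗ a′ ⊕ const (ℤ.- + 2) ⊗ (x ⊗ b ⊗ b′)) ∎

    U₃-proportion : a ⊗ U 2 (f ⊗ g ⊗ g) ≈ a′ ⊗ U 2 (g ⊗ f ⊗ f)
    U₃-proportion = begin
      a ⊗ U 2 (f ⊗ g ⊗ g)   ≈⟨ ⊗-cong ≈-refl U₃-fgg ⟩
      a ⊗ (a′ ⊗ c)          ≈⟨ solveR 3 (λ a b c → a :* (b :* c) := b :* (a :* c)) ≈-refl a a′ c ⟩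
      a′ ⊗ (a ⊗ c)          ≈⟨ ⊗-cong ≈-refl U₃-gff ⟨
      a′ ⊗ U 2 (g ⊗ f ⊗ f)  ∎
      where c = a ⊗ a′ ⊕ const (ℤ.- + 2) ⊗ (x ⊗ b ⊗ b′)

-- Congruences modulo 3 and 4

S S₂ S₆ : Series
S  = S3bar
S₂ = U 1 S
S₆ = U 2 S₂

head-φ⁻ : φ⁻ 0 ≡ 1ℤ
head-φ⁻ = trans (ℤₚ.*-identityˡ (φ 0)) head-φ

module _ where
  open Everywhere (+ 3)
  open ≈-Reasoning

  V₃φ≈φ³ : V 2 φ ≈ φ ⊗ φ ⊗ φ
  V₃φ≈φ³ = ≈-sym (frobenius φ)

  V₃φ′≈φ′³ : V 2 φ′ ≈ φ′ ⊗ φ′ ⊗ φ′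
  V₃φ′≈φ′³ = ≈-sym (frobenius φ′)

  -- Cubing in place of q ↦ q³ turns the theta quotient into S φ′ φ³ ≡ φ φ′³. Replacing one φ′² by φ
  -- φ⁻ exposes the common factor φ′ φ².
  Sφ≈φ⁻ : S ⊗ φ ≈ φ⁻
  Sφ≈φ⁻ = cancel everywhere (φ′ ⊗ φ ⊗ φ) (head-⊗ (φ′ ⊗ φ) φ (head-⊗ φ′ φ head-φ⁻ head-φ) head-φ) (begin
    S ⊗ φ ⊗ (φ′ ⊗ φ ⊗ φ)
      ≈⟨ solveR 3 (λ s f g → s :* f :* (g :* f :* f) := s :* (g :* (f :* f :* f))) ≈-refl S φ φ′ ⟩
    S ⊗ (φ′ ⊗ (φ ⊗ φ ⊗ φ))
      ≈⟨ ⊗-cong ≈-refl (⊗-cong ≈-refl V₃φ≈φ³) ⟨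
    S ⊗ (φ′ ⊗ V 2 φ)
      ≈⟨ exact S3bar-theta ⟩
    φ ⊗ V 2 φ′
      ≈⟨ ⊗-cong ≈-refl V₃φ′≈φ′³ ⟩
    φ ⊗ (φ′ ⊗ φ′ ⊗ φ′)
      ≈⟨ ⊗-cong ≈-refl (⊗-cong (exact φφ⁻≈φ′²) ≈-refl) ⟨
    φ ⊗ (φ ⊗ φ⁻ ⊗ φ′)
      ≈⟨ solveR 3 (λ f m g → f :* (f :* m :* g) := m :* (g :* f :* f)) ≈-refl φ φ⁻ φ′ ⟩
    φ⁻ ⊗ (φ′ ⊗ φ ⊗ φ) ∎)

  -- The multiplier is φ⁻² because at q² it becomes φ′² = φ φ⁻, which converts S into φ⁻². That is
  -- φ² at -q, with the same even part as φ², and halving reproduces φ².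
  S₂φ⁻²≈φ² : S₂ ⊗ (φ⁻ ⊗ φ⁻) ≈ φ ⊗ φ
  S₂φ⁻²≈φ² = begin
    U 1 S ⊗ (φ⁻ ⊗ φ⁻)
      ≈⟨ ≡⇒≈ (U-⊗-V 1 S (φ⁻ ⊗ φ⁻)) ⟨
    U 1 (S ⊗ V 1 (φ⁻ ⊗ φ⁻))
      ≈⟨ U-cong∞ 1 (begin
           S ⊗ V 1 (φ⁻ ⊗ φ⁻)   ≈⟨ ⊗-cong ≈-refl (≡⇒≈ (V-⊗ 1 φ⁻ φ⁻)) ⟩
           S ⊗ (φ′ ⊗ φ′)       ≈⟨ ⊗-cong ≈-refl (exact φφ⁻≈φ′²) ⟨
           S ⊗ (φ ⊗ φ⁻)        ≈⟨ solveR 3 (λ s f m → s :* (f :* m) := s :* f :* m) ≈-refl S φ φ⁻ ⟩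
           S ⊗ φ ⊗ φ⁻          ≈⟨ ⊗-cong Sφ≈φ⁻ ≈-refl ⟩
           φ⁻ ⊗ φ⁻             ≈⟨ ≡⇒≈ (λ n → σ-⊗ n φ φ) ⟨
           σ (φ ⊗ φ)           ∎) ⟩
    U 1 (σ (φ ⊗ φ))
      ≈⟨ ≡⇒≈ (U₂-σ (φ ⊗ φ)) ⟩
    U 1 (φ ⊗ φ)
      ≈⟨ exact U₂-φ² ⟩
    φ ⊗ φ ∎

  σS₂φ²≈φ⁻² : σ S₂ ⊗ (φ ⊗ φ) ≈ φ⁻ ⊗ φ⁻
  σS₂φ²≈φ⁻² = begin
    σ S₂ ⊗ (φ ⊗ φ)         ≈⟨ ⊗-cong ≈-refl (⊗-cong (≡⇒≈ (σ-σ φ)) (≡⇒≈ (σ-σ φ))) ⟨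
    σ S₂ ⊗ (σ φ⁻ ⊗ σ φ⁻)   ≈⟨ ⊗-cong ≈-refl (≡⇒≈ (λ n → σ-⊗ n φ⁻ φ⁻)) ⟨
    σ S₂ ⊗ σ (φ⁻ ⊗ φ⁻)     ≈⟨ ≡⇒≈ (λ n → σ-⊗ n S₂ (φ⁻ ⊗ φ⁻)) ⟨
    σ (S₂ ⊗ (φ⁻ ⊗ φ⁻))     ≈⟨ σ-cong S₂φ⁻²≈φ² ⟩
    σ (φ ⊗ φ)              ≈⟨ ≡⇒≈ (λ n → σ-⊗ n φ φ) ⟩
    φ⁻ ⊗ φ⁻                ∎

  -- Before extraction the multiplier φ′² becomes φ′⁶ = φ² φ⁻² φ′², whose φ⁻² turns S₂ into φ². Of
  -- the resulting φ⁴ φ′², the cube φ³ ≡ φ(q³) leaves the extraction and φ φ′² stays inside.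
  S₆φ′² : S₆ ⊗ (φ′ ⊗ φ′) ≈ φ ⊗ U 2 (φ ⊗ φ′ ⊗ φ′)
  S₆φ′² = begin
    U 2 S₂ ⊗ (φ′ ⊗ φ′)
      ≈⟨ ≡⇒≈ (U-⊗-V 2 S₂ (φ′ ⊗ φ′)) ⟨
    U 2 (S₂ ⊗ V 2 (φ′ ⊗ φ′))
      ≈⟨ U-cong∞ 2 (begin
           S₂ ⊗ V 2 (φ′ ⊗ φ′)
             ≈⟨ ⊗-cong ≈-refl (≈-trans (≡⇒≈ (V-⊗ 2 φ′ φ′)) (⊗-cong V₃φ′≈φ′³ V₃φ′≈φ′³)) ⟩
           S₂ ⊗ (φ′ ⊗ φ′ ⊗ φ′ ⊗ (φ′ ⊗ φ′ ⊗ φ′))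
             ≈⟨ solveR 2 (λ s g → s :* (g :* g :* g :* (g :* g :* g)) := s :* (g :* g :* (g :* g)) :* (g :* g)) ≈-refl S₂ φ′ ⟩
           S₂ ⊗ (φ′ ⊗ φ′ ⊗ (φ′ ⊗ φ′)) ⊗ (φ′ ⊗ φ′)
             ≈⟨ ⊗-cong (⊗-cong ≈-refl (⊗-cong (exact φφ⁻≈φ′²) (exact φφ⁻≈φ′²))) ≈-refl ⟨
           S₂ ⊗ (φ ⊗ φ⁻ ⊗ (φ ⊗ φ⁻)) ⊗ (φ′ ⊗ φ′)
             ≈⟨ solveR 4 (λ s f m g → s :* (f :* m :* (f :* m)) :* (g :* g) := s :* (m :* m) :* (f :* f :* g :* g)) ≈-refl S₂ φ φ⁻ φ′ ⟩
           S₂ ⊗ (φ⁻ ⊗ φ⁻) ⊗ (φ ⊗ φ ⊗ φ′ ⊗ φ′)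
             ≈⟨ ⊗-cong S₂φ⁻²≈φ² ≈-refl ⟩
           φ ⊗ φ ⊗ (φ ⊗ φ ⊗ φ′ ⊗ φ′)
             ≈⟨ solveR 2 (λ f g → f :* f :* (f :* f :* g :* g) := f :* g :* g :* (f :* f :* f)) ≈-refl φ φ′ ⟩
           φ ⊗ φ′ ⊗ φ′ ⊗ (φ ⊗ φ ⊗ φ)
             ≈⟨ ⊗-cong ≈-refl V₃φ≈φ³ ⟨
           φ ⊗ φ′ ⊗ φ′ ⊗ V 2 φ ∎) ⟩
    U 2 (φ ⊗ φ′ ⊗ φ′ ⊗ V 2 φ)
      ≈⟨ ≡⇒≈ (U-⊗-V 2 (φ ⊗ φ′ ⊗ φ′) φ) ⟩
    U 2 (φ ⊗ φ′ ⊗ φ′) ⊗ φ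
      ≈⟨ ≡⇒≈ (λ n → ⊗-comm n (U 2 (φ ⊗ φ′ ⊗ φ′)) φ) ⟩
    φ ⊗ U 2 (φ ⊗ φ′ ⊗ φ′) ∎

  -- Here φ² becomes φ⁶, two factors of which turn S₂(-q) into φ⁻². The rest is φ⁻² φ⁴ = φ′⁴ φ²: the
  -- cube φ′³ leaves, φ′ φ² stays.
  σS₆φ² : σ S₆ ⊗ (φ ⊗ φ) ≈ φ′ ⊗ U 2 (φ′ ⊗ φ ⊗ φ)
  σS₆φ² = begin
    σ S₆ ⊗ (φ ⊗ φ)
      ≈⟨ ⊗-cong (≡⇒≈ (U₃-σ S₂)) ≈-refl ⟨
    U 2 (σ S₂) ⊗ (φ ⊗ φ)
      ≈⟨ ≡⇒≈ (U-⊗-V 2 (σ S₂) (φ ⊗ φ)) ⟨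
    U 2 (σ S₂ ⊗ V 2 (φ ⊗ φ))
      ≈⟨ U-cong∞ 2 (begin
           σ S₂ ⊗ V 2 (φ ⊗ φ)
             ≈⟨ ⊗-cong ≈-refl (≈-trans (≡⇒≈ (V-⊗ 2 φ φ)) (⊗-cong V₃φ≈φ³ V₃φ≈φ³)) ⟩
           σ S₂ ⊗ (φ ⊗ φ ⊗ φ ⊗ (φ ⊗ φ ⊗ φ))
             ≈⟨ solveR 2 (λ s f → s :* (f :* f :* f :* (f :* f :* f)) := s :* (f :* f) :* (f :* f :* f :* f)) ≈-refl (σ S₂) φ ⟩
           σ S₂ ⊗ (φ ⊗ φ) ⊗ (φ ⊗ φ ⊗ φ ⊗ φ)
             ≈⟨ ⊗-cong σS₂φ²≈φ⁻² ≈-refl ⟩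
           φ⁻ ⊗ φ⁻ ⊗ (φ ⊗ φ ⊗ φ ⊗ φ)
             ≈⟨ solveR 2 (λ m f → m :* m :* (f :* f :* f :* f) := f :* m :* (f :* m) :* (f :* f)) ≈-refl φ⁻ φ ⟩
           φ ⊗ φ⁻ ⊗ (φ ⊗ φ⁻) ⊗ (φ ⊗ φ)
             ≈⟨ ⊗-cong (⊗-cong (exact φφ⁻≈φ′²) (exact φφ⁻≈φ′²)) ≈-refl ⟩
           φ′ ⊗ φ′ ⊗ (φ′ ⊗ φ′) ⊗ (φ ⊗ φ)
             ≈⟨ solveR 2 (λ g f → g :* g :* (g :* g) :* (f :* f) := g :* f :* f :* (g :* g :* g)) ≈-refl φ′ φ ⟩
           φ′ ⊗ φ ⊗ φ ⊗ (φ′ ⊗ φ′ ⊗ φ′)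
             ≈⟨ ⊗-cong ≈-refl V₃φ′≈φ′³ ⟨
           φ′ ⊗ φ ⊗ φ ⊗ V 2 φ′ ∎) ⟩
    U 2 (φ′ ⊗ φ ⊗ φ ⊗ V 2 φ′)
      ≈⟨ ≡⇒≈ (U-⊗-V 2 (φ′ ⊗ φ ⊗ φ) φ′) ⟩
    U 2 (φ′ ⊗ φ ⊗ φ) ⊗ φ′
      ≈⟨ ≡⇒≈ (λ n → ⊗-comm n (U 2 (φ′ ⊗ φ ⊗ φ)) φ′) ⟩
    φ′ ⊗ U 2 (φ′ ⊗ φ ⊗ φ) ∎

  -- Times φ² φ′², the two sides are φ³ and φ′³ times the extractions just found. The cubes are
  -- φ(q³) and φ′(q³), exactly the coefficients `a` and `a′` in `U₃-proportion` for the dissections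
  -- of φ and φ′.
  S₆-even : S₆ ≈ σ S₆
  S₆-even = cancel everywhere (φ ⊗ φ ⊗ (φ′ ⊗ φ′)) (head-⊗ (φ ⊗ φ) (φ′ ⊗ φ′) (head-⊗ φ φ head-φ head-φ) (head-⊗ φ′ φ′ head-φ⁻ head-φ⁻)) (begin
    S₆ ⊗ (φ ⊗ φ ⊗ (φ′ ⊗ φ′))
      ≈⟨ solveR 3 (λ s f g → s :* (f :* f :* (g :* g)) := f :* f :* (s :* (g :* g))) ≈-refl S₆ φ φ′ ⟩
    φ ⊗ φ ⊗ (S₆ ⊗ (φ′ ⊗ φ′))
      ≈⟨ ⊗-cong ≈-refl S₆φ′² ⟩
    φ ⊗ φ ⊗ (φ ⊗ U 2 (φ ⊗ φ′ ⊗ φ′))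
      ≈⟨ solveR 2 (λ f u → f :* f :* (f :* u) := f :* f :* f :* u) ≈-refl φ (U 2 (φ ⊗ φ′ ⊗ φ′)) ⟩
    φ ⊗ φ ⊗ φ ⊗ U 2 (φ ⊗ φ′ ⊗ φ′)
      ≈⟨ ⊗-cong V₃φ≈φ³ ≈-refl ⟨
    V 2 φ ⊗ U 2 (φ ⊗ φ′ ⊗ φ′)
      ≈⟨ exact (U₃-proportion φ φ′ (V 2 φ) (const (+ 2) ⊗ ψ) (V 2 φ′) (V 1 (σ (const (+ 2) ⊗ ψ))) φ-dissection φ′-dissection) ⟩
    V 2 φ′ ⊗ U 2 (φ′ ⊗ φ ⊗ φ)
      ≈⟨ ⊗-cong V₃φ′≈φ′³ ≈-refl ⟩
    φ′ ⊗ φ′ ⊗ φ′ ⊗ U 2 (φ′ ⊗ φ ⊗ φ)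
      ≈⟨ solveR 2 (λ g u → g :* g :* g :* u := g :* g :* (g :* u)) ≈-refl φ′ (U 2 (φ′ ⊗ φ ⊗ φ)) ⟩
    φ′ ⊗ φ′ ⊗ (φ′ ⊗ U 2 (φ′ ⊗ φ ⊗ φ))
      ≈⟨ ⊗-cong ≈-refl σS₆φ² ⟨
    φ′ ⊗ φ′ ⊗ (σ S₆ ⊗ (φ ⊗ φ))
      ≈⟨ solveR 3 (λ s f g → g :* g :* (s :* (f :* f)) := s :* (f :* f :* (g :* g))) ≈-refl (σ S₆) φ φ′ ⟩
    σ S₆ ⊗ (φ ⊗ φ ⊗ (φ′ ⊗ φ′)) ∎)

3∣S₆-odd : ∀ n → sgn n ≡ ℤ.- 1ℤ → + 3 ∣ℤ.∣ S₆ n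
3∣S₆-odd n odd = subst (+ 3 ∣ℤ.∣_)
  -- At odd n the symmetry gives 3 ∣ 2c for the coefficient c, and c = 3c - 2c.
  (trans (cong (λ s → + 3 ℤ.* S₆ n ℤ.+ ℤ.- (S₆ n ℤ.- s ℤ.* S₆ n)) odd)
    (solveℤ 1 (λ c → ⟪ + 3 ⟫ ∙ c ∔ ∼ (c ∔ ∼ (⟪ ℤ.- 1ℤ ⟫ ∙ c)) ≐ c) refl (S₆ n)))
  (∣ℤ.∣m∣n⇒∣m+n (∣ℤ.∣m⇒∣m*n (S₆ n) ∣ℤ.∣-refl) (∣ℤ.∣m⇒∣-m (at S₆-even n tt)))

Θ-zero : ∀ a n → (∀ k → a k ≢ n) → Θ a n ≡ 0ℤ
Θ-zero a n ne = go (suc n)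
  where
  go : ∀ M → ∑ M (mono ∘ a) n ≡ 0ℤ
  go zero    = const-0 n
  go (suc M) = trans (⊕-at (∑ M (mono ∘ a)) (mono (a M)) n) (cong₂ ℤ._+_ (go M) (mono-off (a M) n (ne M ∘ sym)))

-- Modulo 4 a series 1 + 2x is its own inverse, and a product of such series adds their x. So the
-- theta quotient becomes a sum of four theta series; their signs do not affect where they vanish.
S-mod-4 : Cong (+ 4) (λ _ → ⊤) S (const 1ℤ ⊕ const (+ 2) ⊗ (θ ⊕ V 2 (V 1 (σ θ)) ⊕ V 1 (σ θ) ⊕ V 2 θ))
S-mod-4 = begin
  S
    -- S is multiplied by the square of the denominator, which is 1 modulo 4; `w` collects the
    -- correction.
    ≈⟨ solveR 3 (λ s c d → s := s :* ((con 1ℤ :+ con (+ 2) :* c) :* (con 1ℤ :+ con (+ 2) :* d)) :* ((con 1ℤ :+ con (+ 2) :* c) :* (con 1ℤ :+ con (+ 2) :* d))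
         :+ con (+ 4) :* (:- s :* ((c :+ c :* c) :+ (d :+ d :* d) :+ con (+ 4) :* (c :+ c :* c) :* (d :+ d :* d)))) ≈-refl S c d ⟩
  S ⊗ (1+2 c ⊗ 1+2 d) ⊗ (1+2 c ⊗ 1+2 d) ⊕ const (+ 4) ⊗ w
    ≈⟨ ⊕-cong (⊗-cong main ≈-refl) (⊗-cong const≈0 ≈-refl) ⟩
  1+2 a ⊗ 1+2 b ⊗ (1+2 c ⊗ 1+2 d) ⊕ const 0ℤ ⊗ w
    ≈⟨ solveR 5 (λ a b c d w → (con 1ℤ :+ con (+ 2) :* a) :* (con 1ℤ :+ con (+ 2) :* b) :* ((con 1ℤ :+ con (+ 2) :* c) :* (con 1ℤ :+ con (+ 2) :* d)) :+ con 0ℤ :* w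
         := (con 1ℤ :+ con (+ 2) :* (a :+ b :+ c :+ d)) :+ con (+ 4) :* (a :* b :+ c :* d :+ (a :+ b) :* (c :+ d)
              :+ con (+ 2) :* (a :* b :* (c :+ d) :+ (a :+ b) :* c :* d) :+ con (+ 4) :* (a :* b :* c :* d))) ≈-refl a b c d w ⟩
  1+2 (a ⊕ b ⊕ c ⊕ d) ⊕ const (+ 4) ⊗ v
    ≈⟨ ⊕-cong ≈-refl (⊗-cong const≈0 ≈-refl) ⟩
  1+2 (a ⊕ b ⊕ c ⊕ d) ⊕ const 0ℤ ⊗ v
    ≈⟨ solveR 2 (λ x v → x :+ con 0ℤ :* v := x) ≈-refl (1+2 (a ⊕ b ⊕ c ⊕ d)) v ⟩
  1+2 (a ⊕ b ⊕ c ⊕ d) ∎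
  where
  open Everywhere (+ 4)
  open ≈-Reasoning
  1+2 : Series → Series
  1+2 f = const 1ℤ ⊕ const (+ 2) ⊗ f
  a b c d w v : Series
  a = θ
  b = V 2 (V 1 (σ θ))
  c = V 1 (σ θ)
  d = V 2 θ
  w = ⊖ S ⊗ ((c ⊕ c ⊗ c) ⊕ (d ⊕ d ⊗ d) ⊕ const (+ 4) ⊗ (c ⊕ c ⊗ c) ⊗ (d ⊕ d ⊗ d))
  v = a ⊗ b ⊕ c ⊗ d ⊕ (a ⊕ b) ⊗ (c ⊕ d) ⊕ const (+ 2) ⊗ (a ⊗ b ⊗ (c ⊕ d) ⊕ (a ⊕ b) ⊗ c ⊗ d) ⊕ const (+ 4) ⊗ (a ⊗ b ⊗ c ⊗ d)
  φ′≈ : φ′ ≈ 1+2 c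
  φ′≈ = ≈-trans (V-cong 1 everywhere (≡⇒≈ (σ-affine θ))) (≡⇒≈ (V-affine 1 (σ θ)))
  main : S ⊗ (1+2 c ⊗ 1+2 d) ≈ 1+2 a ⊗ 1+2 b
  main = begin
    S ⊗ (1+2 c ⊗ 1+2 d)   ≈⟨ ⊗-cong ≈-refl (⊗-cong φ′≈ (≡⇒≈ (V-affine 2 θ))) ⟨
    S ⊗ (φ′ ⊗ V 2 φ)      ≈⟨ exact S3bar-theta ⟩
    φ ⊗ V 2 φ′            ≈⟨ ⊗-cong ≈-refl (≈-trans (V-cong 2 everywhere φ′≈) (≡⇒≈ (V-affine 2 c))) ⟩
    1+2 a ⊗ 1+2 b         ∎

-- At 6r the four theta series read θ at 6r, r, 3r and 2r, and r ≢ 0 removes the constant term.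
-- Writing r * 1 gives all four hypotheses the form r * c with c ∣ 6.
4∣S : ∀ r → r ≢ 0 → (∀ k → sq k ≢ r * 1) → (∀ k → sq k ≢ r * 2) → (∀ k → sq k ≢ r * 3) → (∀ k → sq k ≢ r * 6) → + 4 ∣ℤ.∣ S (r * 3 * 2)
4∣S r r≢0 ne₁ ne₂ ne₃ ne₆ = subst (+ 4 ∣ℤ.∣_) (trans (cong (λ z → S N ℤ.- z) rhs≡0) (ℤₚ.+-identityʳ (S N))) (at S-mod-4 N tt)
  where
  N : ℕ
  N = r * 3 * 2
  a b c d : Series
  a = θ
  b = V 2 (V 1 (σ θ))
  c = V 1 (σ θ)
  d = V 2 θ
  N≡ : N ≡ r * 2 * 3
  N≡ = solveℕ 1 (λ r → r ⊠ lit 3 ⊠ lit 2 ≜ r ⊠ lit 2 ⊠ lit 3) refl r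
  σθ≡0 : ∀ n → θ n ≡ 0ℤ → σ θ n ≡ 0ℤ
  σθ≡0 n e = trans (cong (sgn n ℤ.*_) e) (ℤₚ.*-zeroʳ (sgn n))
  a≡0 : a N ≡ 0ℤ
  a≡0 = Θ-zero sq N λ k e → ne₆ k (trans e (ℕₚ.*-assoc r 3 2))
  c≡0 : c N ≡ 0ℤ
  c≡0 = trans (U-V 1 (σ θ) (r * 3)) (σθ≡0 (r * 3) (Θ-zero sq (r * 3) ne₃))
  d≡0 : d N ≡ 0ℤ
  d≡0 = trans (cong d N≡) (trans (U-V 2 θ (r * 2)) (Θ-zero sq (r * 2) ne₂))
  b≡0 : b N ≡ 0ℤ
  b≡0 = trans (cong b N≡) (trans (U-V 2 c (r * 2)) (trans (U-V 1 (σ θ) r) (σθ≡0 r (Θ-zero sq r λ k e → ne₁ k (trans e (sym (ℕₚ.*-identityʳ r)))))))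
  const-N : const 1ℤ N ≡ 0ℤ
  const-N = off N λ e → r≢0 (ℕₚ.m*n≡0⇒m≡0 r 3 (ℕₚ.m*n≡0⇒m≡0 (r * 3) 2 e))
    where
    off : ∀ n → n ≢ 0 → const 1ℤ n ≡ 0ℤ
    off zero    n≢0 = contradiction refl n≢0
    off (suc n) _   = refl
  sum≡0 : (a ⊕ b ⊕ c ⊕ d) N ≡ 0ℤ
  sum≡0 = trans (⊕-at (a ⊕ b ⊕ c) d N) (cong₂ ℤ._+_ (trans (⊕-at (a ⊕ b) c N) (cong₂ ℤ._+_ (trans (⊕-at a b N) (cong₂ ℤ._+_ a≡0 b≡0)) c≡0)) d≡0)
  rhs≡0 : (const 1ℤ ⊕ const (+ 2) ⊗ (a ⊕ b ⊕ c ⊕ d)) N ≡ 0ℤ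
  rhs≡0 = trans (⊕-at (const 1ℤ) _ N) (cong₂ ℤ._+_ const-N (trans (const-⊗ (+ 2) (a ⊕ b ⊕ c ⊕ d) N) (cong (+ 2 ℤ.*_) sum≡0)))

-- x = 4x - 3x, and 12 divides both terms.
3∣x∧4∣x⇒12∣x : ∀ {x} → + 3 ∣ℤ.∣ x → + 4 ∣ℤ.∣ x → + 12 ∣ℤ.∣ x
3∣x∧4∣x⇒12∣x {x} (∣ℤ.divides a x≡a*3) (∣ℤ.divides b x≡b*4) = ∣ℤ.divides (a ℤ.- b) (begin
  x                                          ≡⟨ solveℤ 1 (λ x → x ≐ x ∙ ⟪ + 4 ⟫ ∔ ∼ (x ∙ ⟪ + 3 ⟫)) refl x ⟩
  x ℤ.* + 4 ℤ.- x ℤ.* + 3                    ≡⟨ cong₂ (λ y z → y ℤ.* + 4 ℤ.- z ℤ.* + 3) x≡a*3 x≡b*4 ⟩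
  a ℤ.* + 3 ℤ.* + 4 ℤ.- b ℤ.* + 4 ℤ.* + 3    ≡⟨ solveℤ 2 (λ a b → a ∙ ⟪ + 3 ⟫ ∙ ⟪ + 4 ⟫ ∔ ∼ (b ∙ ⟪ + 4 ⟫ ∙ ⟪ + 3 ⟫) ≐ (a ∔ ∼ b) ∙ ⟪ + 12 ⟫) refl a b ⟩
  (a ℤ.- b) ℤ.* + 12                         ∎)
  where open ≡-Reasoning

-- Parity and the p-adic valuation of the index

sgn-odd : ∀ n → ¬ 2 ∣ₙ n → sgn n ≡ ℤ.- 1ℤ
sgn-odd zero          2∤n = contradiction (2 ∣ₙ.∣0) 2∤n
sgn-odd (suc zero)    2∤n = refl
sgn-odd (suc (suc n)) 2∤n = trans (ℤₚ.neg-involutive (sgn n)) (sgn-odd n (2∤n ∘ ∣ₙ.∣m∣n⇒∣m+n ∣ₙ.∣-refl))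

prime∣^ : ∀ {q} → Prime q → ∀ m k → q ∣ₙ m ^ k → q ∣ₙ m
prime∣^ pr m zero    q∣1 = ∣ₙ.∣-trans q∣1 (∣ₙ.1∣ m)
prime∣^ pr m (suc k) q∣  = [ id , prime∣^ pr m k ] (euclidsLemma m (m ^ k) pr q∣)

-- Descent: p divides the root, and cancelling p² lowers α by one. At α = 0 a single p is left
-- opposite p², which would force p ∣ w.
odd-valuation⇒¬square : ∀ {p} → Prime p → ∀ α {w} k → ¬ p ∣ₙ w → k * k ≢ p ^ (2 * α + 1) * w
odd-valuation⇒¬square {p} pr α {w} k p∤w e = descend α k e (p∣root α k e)
  where
  instance _ = prime⇒nonZero pr

  p∣root : ∀ α k → k * k ≡ p ^ (2 * α + 1) * w → p ∣ₙ k
  p∣root α k e = reduce (euclidsLemma k k pr (subst (p ∣ₙ_) (sym e)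
    (∣ₙ.∣m⇒∣m*n w (subst (λ s → p ∣ₙ p ^ s) (ℕₚ.+-comm 1 (2 * α)) (∣ₙ.m∣m*n (p ^ (2 * α)))))))

  descend : ∀ α k → k * k ≡ p ^ (2 * α + 1) * w → ¬ p ∣ₙ k
  descend zero k e (∣ₙ.divides j refl) = p∤w (∣ₙ.divides (j * j) (sym (ℕₚ.*-cancelˡ-≡ (j * j * p) w p (begin
    p * (j * j * p)    ≡⟨ solveℕ 2 (λ j p → p ⊠ (j ⊠ j ⊠ p) ≜ j ⊠ p ⊠ (j ⊠ p)) refl j p ⟩
    j * p * (j * p)    ≡⟨ e ⟩
    p ^ 1 * w          ≡⟨ cong (_* w) (ℕₚ.*-identityʳ p) ⟩
    p * w              ∎))))
    where open ≡-Reasoning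
  descend (suc α) k e (∣ₙ.divides j refl) = descend α j e′ (p∣root α j e′)
    where
    open ≡-Reasoning
    e′ : j * j ≡ p ^ (2 * α + 1) * w
    e′ = ℕₚ.*-cancelˡ-≡ (j * j) (p ^ (2 * α + 1) * w) p (ℕₚ.*-cancelˡ-≡ (p * (j * j)) (p * (p ^ (2 * α + 1) * w)) p (begin
      p * (p * (j * j))                  ≡⟨ solveℕ 2 (λ j p → p ⊠ (p ⊠ (j ⊠ j)) ≜ j ⊠ p ⊠ (j ⊠ p)) refl j p ⟩
      j * p * (j * p)                    ≡⟨ e ⟩
      p ^ (2 * suc α + 1) * w            ≡⟨ cong (λ s → p ^ s * w) (solveℕ 1 (λ α → lit 2 ⊠ (lit 1 ⊞ α) ⊞ lit 1 ≜ lit 2 ⊞ (lit 2 ⊠ α ⊞ lit 1)) refl α) ⟩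
      p * (p * p ^ (2 * α + 1)) * w      ≡⟨ solveℕ 3 (λ p x w → p ⊠ (p ⊠ x) ⊠ w ≜ p ⊠ (p ⊠ (x ⊠ w))) refl p (p ^ (2 * α + 1)) w ⟩
      p * (p * (p ^ (2 * α + 1) * w))    ∎))

theorem4p9 : (p : ℕ) → Prime p → 5 ≤ p → LegendreMinusOneIsMinusOne p →
    (α n : ℕ) → (i : ℕ) → 1 ≤ i → i ≤ p ∸ 1 →
    (+ 12) ∣ S3bar (48 * p ^ (2 * α + 2) * n + 6 * (8 * i + p) * p ^ (2 * α + 1))
theorem4p9 p pr 5≤p _ α n i 1≤i i≤p-1 = subst (λ N → + 12 ∣ S3bar N) (sym index)
  (∣ℤ.∣⇒∣ᵤ (3∣x∧4∣x⇒12∣x (3∣S₆-odd r (sgn-odd r 2∤r)) (4∣S r r≢0 (¬square 1 1∣6) (¬square 2 2∣6) (¬square 3 3∣6) (¬square 6 ∣ₙ.∣-refl))))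
  where
  P u r : ℕ
  P = p ^ (2 * α + 1)
  -- What remains of the index after taking out 6 p^(2α+1). It is 8i modulo p, hence prime to p, and
  -- p modulo 2, hence odd.
  u = p * (8 * n + 1) + 8 * i
  r = P * u

  -- The association r * 3 * 2 makes the value of `S3bar` there `S₆ r` by definition.
  index : 48 * p ^ (2 * α + 2) * n + 6 * (8 * i + p) * P ≡ r * 3 * 2
  index = trans
    (cong (λ s → 48 * p ^ s * n + 6 * (8 * i + p) * P) (ℕₚ.+-suc (2 * α) 1))
    (solveℕ 4 (λ p P n i → lit 48 ⊠ (p ⊠ P) ⊠ n ⊞ lit 6 ⊠ (lit 8 ⊠ i ⊞ p) ⊠ P ≜ P ⊠ (p ⊠ (lit 8 ⊠ n ⊞ lit 1) ⊞ lit 8 ⊠ i) ⊠ lit 3 ⊠ lit 2) refl p P n i)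

  1∣6 : 1 ∣ₙ 6
  1∣6 = ∣ₙ.1∣ 6
  2∣6 : 2 ∣ₙ 6
  2∣6 = ∣ₙ.divides 3 refl
  3∣6 : 3 ∣ₙ 6
  3∣6 = ∣ₙ.divides 2 refl

  p∤small : ∀ m → 0 < m → m < p → ¬ p ∣ₙ m
  p∤small (suc m) _ m<p p∣m = ℕₚ.<⇒≱ m<p (∣ₙ.∣⇒≤ p∣m)

  p∤2 : ¬ p ∣ₙ 2
  p∤2 = p∤small 2 (s≤s z≤n) (ℕₚ.≤-trans (s≤s (s≤s (s≤s z≤n))) 5≤p)

  p∤6 : ¬ p ∣ₙ 6
  p∤6 p∣6 = [ p∤2 , p∤small 3 (s≤s z≤n) (ℕₚ.≤-trans (s≤s (s≤s (s≤s (s≤s z≤n)))) 5≤p) ] (euclidsLemma 2 3 pr p∣6)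

  p∤i : ¬ p ∣ₙ i
  p∤i = p∤small i 1≤i (ℕₚ.≤-trans (s≤s i≤p-1) (ℕₚ.≤-reflexive (ℕₚ.m+[n∸m]≡n (ℕₚ.≤-trans (s≤s z≤n) 5≤p))))

  p∤u : ¬ p ∣ₙ u
  p∤u p∣u = [ p∤2 ∘ prime∣^ pr 2 3 , p∤i ] (euclidsLemma 8 i pr (∣ₙ.∣m+n∣m⇒∣n p∣u (∣ₙ.m∣m*n (8 * n + 1))))

  2∤p : ¬ 2 ∣ₙ p
  2∤p 2∣p = [ (λ ()) , (λ 2≡p → 5≰2 (subst (5 ≤_) (sym 2≡p) 5≤p)) ]′ (prime⇒irreducible pr 2∣p)
    where
    5≰2 : ¬ 5 ≤ 2
    5≰2 (s≤s (s≤s ()))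

  2∤u : ¬ 2 ∣ₙ u
  2∤u 2∣u = 2∤p (∣ₙ.∣m+n∣m⇒∣n {m = (p * n + i) * 4 * 2}
    (subst (2 ∣ₙ_) (solveℕ 3 (λ p n i → p ⊠ (lit 8 ⊠ n ⊞ lit 1) ⊞ lit 8 ⊠ i ≜ (p ⊠ n ⊞ i) ⊠ lit 4 ⊠ lit 2 ⊞ p) refl p n i) 2∣u)
    (∣ₙ.n∣m*n ((p * n + i) * 4)))

  2∤r : ¬ 2 ∣ₙ r
  2∤r 2∣r = [ 2∤p ∘ prime∣^ prime[2] p (2 * α + 1) , 2∤u ] (euclidsLemma P u prime[2] 2∣r)

  r≢0 : r ≢ 0
  r≢0 r≡0 = 2∤r (subst (2 ∣ₙ_) (sym r≡0) (2 ∣ₙ.∣0))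

  -- For c ∣ 6 the cofactor u c is prime to p, since p ≥ 5, so r c has p-adic valuation exactly 2α +
  -- 1.
  ¬square : ∀ c → c ∣ₙ 6 → ∀ k → sq k ≢ r * c
  ¬square c c∣6 k e = odd-valuation⇒¬square pr α (suc k)
    ([ p∤u , (λ p∣c → p∤6 (∣ₙ.∣-trans p∣c c∣6)) ] ∘ euclidsLemma u c pr)
    (trans e (ℕₚ.*-assoc P u c))
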